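{- Let $r\geq 3$ be an integer and let $G$ be an $r$-graph with edge set $E$. (a) If $r$ is even and $r\geq 4$, then for every positive integer $k$, $G$ has $k$ 1-factors $M_1,\ldots,M_k$ such that $$\frac{|\bigcup_{i=1}^k M_i|}{|E|}\geq 1-\prod_{i=1}^k \frac{(r^2-3r+1)i-(r^2-5r+3)}{(r^2-2r-1)i-(r^2-4r-1)}$$ and $\sum_{i=1}^k |M_i\cap C|\leq (r-1)k+2$ for every edge cut $C$ of $G$ with $|C|=r+1$. (b) If $r$ is odd and $r\geq 3$, then for every positive integer $k$, $G$ has $k$ 1-factors $M_1,\ldots,M_k$ such that $$\frac{|\bigcup_{i=1}^k M_i|}{|E|}\geq 1-\prod_{i=1}^k \frac{(r^2-2r-1)i-(r^2-4r+1)}{(r^2-r-2)i-(r^2-3r-2)},$$ $\sum_{i=1}^k |M_i\cap C|=k$ for every edge cut $C$ of $G$ with $|C|=r$, and $\sum_{i=1}^k |M_i\cap D|\leq rk+2$ for every edge cut $D$ of $G$ with $|D|=r+2$.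
   Context: For a graph $G$ and $S\subseteq V(G)$, $\partial S$ denotes the set of edges of $G$ with exactly one end in $S$; an edge cut is a set of the form $\partial S$. For a positive integer $r$, an $r$-graph is an $r$-regular graph $G$ such that $|\partial S|\geq r$ for every $S\subseteq V(G)$ of odd cardinality. A 1-factor is a perfect matching. The 1-factors $M_1,\ldots,M_k$ need not be distinct. -}

module Defs where

open import Data.Nat as ℕ using (ℕ; zero; suc; _%_)
open import Data.Integer as ℤ using (ℤ; +_)
open import Data.Rational as ℚ using (ℚ; 0ℚ; 1ℚ; _÷_; NonZero; ≢-nonZero)
open import Data.Rational.Properties using (_≟_)
open import Data.Fin using (Fin)
open import Data.Fin.Properties using () renaming (_≟_ to _≟ᶠ_)
open import Data.Fin.Subset using (Subset; ∣_∣; _∩_; ⋃; ⁅_⁆)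
open import Data.Bool using (Bool; _xor_; _∨_)
open import Data.Vec using (lookup; tabulate)
open import Data.List as List using (List)
open import Data.Product using (_×_; proj₁; proj₂)
open import Relation.Nullary using (¬_; yes; no)
open import Relation.Nullary.Decidable using (⌊_⌋)
open import Relation.Binary.PropositionalEquality using (_≡_)

-- A finite multigraph (parallel edges allowed, no loops):
-- vertices Fin n, edges Fin m, each edge with two distinct ends.
record Graph : Set where
  field
    n       : ℕ
    m       : ℕ
    ends    : Fin m → Fin n × Fin n
    loopless : ∀ e → ¬ (proj₁ (ends e) ≡ proj₂ (ends e))
open Graph public

VSet : Graph → Set
VSet G = Subset (n G)

ESet : Graph → Set
ESet G = Subset (m G)

∂ : (G : Graph) → VSet G → ESet G
∂ G S = tabulate λ e → lookup S (proj₁ (ends G e)) xor lookup S (proj₂ (ends G e))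

incident : (G : Graph) → Fin (n G) → ESet G
incident G v = tabulate λ e → ⌊ proj₁ (ends G e) ≟ᶠ v ⌋ ∨ ⌊ proj₂ (ends G e) ≟ᶠ v ⌋

degree : (G : Graph) → Fin (n G) → ℕ
degree G v = ∣ incident G v ∣

Regular : ℕ → Graph → Set
Regular r G = ∀ v → degree G v ≡ r

Odd : ℕ → Set
Odd x = x % 2 ≡ 1

IsRGraph : ℕ → Graph → Set
IsRGraph r G = Regular r G × (∀ (S : VSet G) → Odd ∣ S ∣ → r ℕ.≤ ∣ ∂ G S ∣)

IsOneFactor : (G : Graph) → ESet G → Set
IsOneFactor G M = ∀ v → ∣ M ∩ incident G v ∣ ≡ 1

sumFin : (k : ℕ) → (Fin k → ℕ) → ℕ
sumFin zero    f = 0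
sumFin (suc k) f = f Fin.zero ℕ.+ sumFin k (λ i → f (Fin.suc i))
  where import Data.Fin as Fin

prodFrom1 : ℕ → (ℕ → ℚ) → ℚ
prodFrom1 zero    f = 1ℚ
prodFrom1 (suc k) f = prodFrom1 k f ℚ.* f (suc k)

-- the rational number a/b for integers a, b (b ≠ 0 in all uses; 0 if b = 0)
frac : ℤ → ℤ → ℚ
frac a b with (b ℚ./ 1) ≟ 0ℚ
... | yes _ = 0ℚ
... | no b≢0 = (a ℚ./ 1) ÷ (b ℚ./ 1)
  where instance _ : NonZero (b ℚ./ 1)
                 _ = ≢-nonZero b≢0

unionFin : ∀ {m} (k : ℕ) → (Fin k → Subset m) → Subset m
unionFin k Ms = ⋃ (List.tabulate Ms)

ℕtoℚ : ℕ → ℚ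
ℕtoℚ x = (+ x) ℚ./ 1

Even : ℕ → Set
Even x = x % 2 ≡ 0

{-# OPTIONS --safe #-}
-- Put w₀ = 2, d = r − 2 if r is even and w₀ = 1, d = (r − 1)/2 if r is odd, and w k = w₀ + k d.  The
-- perfect matchings are chosen one at a time so that t(X) = Σᵢ |Mᵢ ∩ ∂X| ≤ (|∂X| − r) w k + k for every
-- odd X.  This says exactly that the weights W(e) = w k − #{i | e ∈ Mᵢ}, divided by Q = r w k − k, satisfy
-- the inequalities of Edmonds' perfect matching polytope.  Hence some perfect matching meets every tight
-- odd cut in a single edge and contains at least the fraction w k / Q of the uncovered edges.  Adding it
-- keeps the invariant: where the bound is attained t(X) grows by 1, and elsewhere the parities
-- t(X) ≡ k and |∂X| ≡ r (mod 2) leave enough room.  The factors in the theorem are 1 − w k / Q.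
--
-- Edmonds' theorem is proved in the form: for every objective, some perfect matching inside the support
-- of W attains at least the average under W.  A nontrivial tight odd cut splits the problem into its two
-- contractions.  If there is none, W is moved along a direction of zero degree at every vertex until an
-- edge leaves the support or an odd cut becomes tight.  On at most four vertices the direction is the
-- difference to a perfect matching; otherwise every vertex has at least three edges in the support, so
-- that there are more edges than vertices and the incidence matrix has a kernel.
module Submission where

-- The new matching has two duties: covering many uncovered edges and meeting tight odd cuts once.
-- Every matching in a convex combination equal to W / Q does the latter, but the per-objective form
-- yields only one matching, so tightness enters the objective as a penalty larger than any gain.
-- That form pays off in gluing: instead of pairing two convex combinations along a cut, one
-- matching from each side must agree on one cut edge, which prices on the cut edges arrange. The
-- constants: if the bound at |∂X| = r + 2h is missed, the next matching may use all of ∂X; this is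
-- affordable for every h ≥ 1 once d ≥ 1 and r ≤ 2d + 1. For odd r, d = (r - 1) / 2 is the least
-- such d, and at |∂X| = r + 2 the bound reads 2 w k + k = r k + 2. For even r, w₀ = 2 and d = r - 2
-- are read off the stated denominators r w k - k; cuts of size r + 1 do not occur, because |∂S| ≡ r
-- |S| (mod 2). All weights are integers: W is scaled by Q, and a step of rational length rescales
-- Q. Contractions keep the index sets of vertices and edges.

module MatchingPolytope where
  open import Algebra using (CommutativeMonoid; CommutativeRing)
  import Algebra.Properties.CommutativeMonoid.Sum
  import Algebra.Properties.Semiring.Sum
  open import Data.Bool using (Bool; true; false; _∧_; _∨_; _xor_; not; if_then_else_)
  import Data.Bool.Properties as Bool
  open import Data.Empty using (⊥; ⊥-elim)
  open import Data.Fin using (Fin; zero; suc)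
  open import Data.Fin.Properties using (any?; all?) renaming (_≟_ to _≟ᶠ_)
  open import Data.Fin.Subset using (Subset; ∣_∣; _∩_)
  open import Data.Fin.Subset.Properties using (anySubset?)
  open import Data.Integer
    using (ℤ; +_; 0ℤ; 1ℤ; _+_; _*_; -_; _-_; _≤_; _<_; +≤+; +<+; _≤?_; _<?_; positive; nonNegative)
  open import Data.Integer.Properties
    using (≤-refl; ≤-reflexive; ≤-trans; ≤-antisym; ≤-total; <-irrefl; <⇒≤; ≤-<-trans; <-≤-trans; ≮⇒≥; ≰⇒>; <-cmp; <⇒≱;
           +-mono-≤; +-mono-<; +-mono-<-≤; +-mono-≤-<; *-monoˡ-≤-nonNeg; *-cancelˡ-≤-pos; *-cancelˡ-≡; *-zeroʳ; *-zeroˡ; *-identityʳ; *-identityˡ; +-identityʳ; +-identityˡ; +-comm; *-comm; *-assoc; i≤j⇒0≤j-i; 0≤i-j⇒j≤i; ≤∧≢⇒<)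
    renaming (_≟_ to _≟ᶻ_)
  import Data.Integer.Properties as ℤ
  open import Data.Integer.Tactic.RingSolver using (solve-∀)
  open import Data.List using (List; []; _∷_; map; _++_; allFin)
  open import Data.List.Membership.Propositional using (_∈_)
  open import Data.List.Membership.Propositional.Properties using (∈-map⁺; ∈-++⁺ˡ; ∈-++⁺ʳ; ∈-allFin)
  open import Data.List.Relation.Unary.Any using (here; there)
  open import Data.Nat using (ℕ; zero; suc; s≤s; z≤n)
  import Data.Nat as ℕ
  import Data.Nat.Properties as ℕ
  import Data.Nat.Tactic.RingSolver as ℕ
  open import Data.Product using (Σ; ∃; _×_; _,_; proj₁; proj₂)
  open import Data.Rational using (ℚ; 0ℚ; 1ℚ)
  import Data.Rational as ℚ
  import Data.Rational.Properties as ℚ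
  import Data.Rational.Unnormalised as ℚᵘ
  import Data.Rational.Unnormalised.Properties as ℚᵘ
  open import Data.Sum using (_⊎_; inj₁; inj₂; [_,_])
  open import Data.Vec using (Vec; lookup; tabulate; []; _∷_)
  open import Data.Vec.Properties using (lookup∘tabulate; lookup-zipWith; lookup-replicate; tabulate-cong)
  open import Defs using (frac; prodFrom1; Graph; ESet; ∂; incident; IsRGraph; IsOneFactor; sumFin; unionFin; ℕtoℚ)
  open import Function using (_∘_; const; id)
  open import Relation.Binary using (tri<; tri≈; tri>)
  open import Relation.Binary.PropositionalEquality
    using (_≡_; _≢_; _≗_; refl; sym; trans; cong; cong₂; subst; subst₂; module ≡-Reasoning)
  open import Relation.Nullary using (¬_; Dec; yes; no; contradiction)
  open import Relation.Nullary.Decidable using (⌊_⌋; _×-dec_; ¬?; _→-dec_)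

  -- Finite sums over ℤ and over the field of two elements, finite search

  module SumAt {c ℓ} (M : CommutativeMonoid c ℓ) where
    open import Algebra.Properties.CommutativeMonoid.Sum M
    open CommutativeMonoid M renaming (ε to 0#; refl to ≈-refl; sym to ≈-sym; trans to ≈-trans)

    sum-zero : ∀ {n} (f : Fin n → Carrier) → (∀ i → f i ≈ 0#) → sum f ≈ 0#
    sum-zero {n} f f≈0 = ≈-trans (sum-cong-≋ f≈0) (sum-replicate-zero n)

    sum-at : ∀ {n} (f : Fin n → Carrier) i → (∀ j → j ≢ i → f j ≈ 0#) → sum f ≈ f i
    sum-at {suc n} f zero f≈0 =
      ≈-trans (∙-congˡ (sum-zero (f ∘ suc) λ j → f≈0 (suc j) λ ())) (identityʳ _)
    sum-at {suc n} f (suc i) f≈0 =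
      ≈-trans (∙-cong (f≈0 zero λ ()) (sum-at (f ∘ suc) i λ j j≢i → f≈0 (suc j) λ { refl → j≢i refl }))
              (identityˡ _)

  open Algebra.Properties.Semiring.Sum ℤ.+-*-semiring
    using (sum; sum-cong-≗; ∑-distrib-+; *-distribˡ-sum; ∑-comm)
  open SumAt ℤ.+-0-commutativeMonoid using (sum-zero; sum-at)
  open Algebra.Properties.Semiring.Sum (CommutativeRing.semiring Bool.xor-∧-commutativeRing)
    using () renaming (sum to par; sum-cong-≗ to par-cong; ∑-distrib-+ to par-xor; *-distribˡ-sum to par-∧; ∑-comm to par-comm)
  open SumAt (CommutativeRing.+-commutativeMonoid Bool.xor-∧-commutativeRing)
    using () renaming (sum-at to par-at)

  ≤-by : ∀ {a b x} → 0ℤ ≤ x → b - a ≡ x → a ≤ b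
  ≤-by 0≤x eq = 0≤i-j⇒j≤i (subst (0ℤ ≤_) (sym eq) 0≤x)

  0≤+ : ∀ {a b} → 0ℤ ≤ a → 0ℤ ≤ b → 0ℤ ≤ a + b
  0≤+ = +-mono-≤

  0≤* : ∀ {a b} → 0ℤ ≤ a → 0ℤ ≤ b → 0ℤ ≤ a * b
  0≤* {a} {b} 0≤a 0≤b = subst (_≤ a * b) (*-zeroʳ a) (*-monoˡ-≤-nonNeg a {{nonNegative 0≤a}} 0≤b)

  0<* : ∀ {a b} → 0ℤ < a → 0ℤ < b → 0ℤ < a * b
  0<* {a} {b} 0<a 0<b = subst (_< a * b) (*-zeroʳ a) (ℤ.*-monoˡ-<-pos a {{positive 0<a}} 0<b)

  *-monoˡ : ∀ {a b c} → 0ℤ ≤ c → a ≤ b → c * a ≤ c * b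
  *-monoˡ {c = c} 0≤c = *-monoˡ-≤-nonNeg c {{nonNegative 0≤c}}

  *-cancelˡ : ∀ {a b c} → 0ℤ < c → c * a ≤ c * b → a ≤ b
  *-cancelˡ {a} {b} {c} 0<c = *-cancelˡ-≤-pos a b c {{positive 0<c}}

  0≤- : ∀ {a b} → a ≤ b → 0ℤ ≤ b - a
  0≤- = i≤j⇒0≤j-i

  0<- : ∀ {a b} → a < b → 0ℤ < b - a
  0<- {a} {b} a<b = subst (_< b - a) (ℤ.+-inverseʳ a) (ℤ.+-monoˡ-< (- a) a<b)

  0<-neg : ∀ {a} → a < 0ℤ → 0ℤ < - a
  0<-neg a<0 = ℤ.neg-mono-< a<0

  ≢0∧≥0⇒>0 : ∀ {a} → 0ℤ ≤ a → a ≢ 0ℤ → 0ℤ < a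
  ≢0∧≥0⇒>0 0≤a a≢0 = ≤∧≢⇒< 0≤a (a≢0 ∘ sym)

  +-cancelʳ-< : ∀ a b {c} → a + c < b + c → a < b
  +-cancelʳ-< a b {c} lt = ≰⇒> λ b≤a → <⇒≱ lt (+-mono-≤ b≤a ≤-refl)

  <⇒≢0 : ∀ {a} → 0ℤ < a → a ≢ 0ℤ
  <⇒≢0 0<a a≡0 = <-irrefl (sym a≡0) 0<a

  ⟦_⟧ : Bool → ℤ
  ⟦ b ⟧ = if b then 1ℤ else 0ℤ

  0≤⟦_⟧ : ∀ b → 0ℤ ≤ ⟦ b ⟧
  0≤⟦ false ⟧ = ≤-refl
  0≤⟦ true ⟧ = +≤+ z≤n

  ⟦_⟧≤1 : ∀ b → ⟦ b ⟧ ≤ 1ℤ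
  ⟦ false ⟧≤1 = +≤+ z≤n
  ⟦ true ⟧≤1 = ≤-refl

  is : ∀ {n} → Fin n → Fin n → Bool
  is i j = ⌊ i ≟ᶠ j ⌋

  is-refl : ∀ {n} (i : Fin n) → is i i ≡ true
  is-refl i with i ≟ᶠ i
  ... | yes _ = refl
  ... | no i≢i = contradiction refl i≢i

  is-≢ : ∀ {n} {i j : Fin n} → i ≢ j → is i j ≡ false
  is-≢ {i = i} {j} i≢j with i ≟ᶠ j
  ... | yes i≡j = contradiction i≡j i≢j
  ... | no _ = refl

  is⇒≡ : ∀ {n} {i j : Fin n} → is i j ≡ true → i ≡ j
  is⇒≡ {i = i} {j} eq with i ≟ᶠ j
  is⇒≡ _ | yes i≡j = i≡j
  is⇒≡ () | no _

  true≢false : ∀ {b} → b ≡ true → b ≡ false → ⊥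
  true≢false refl ()

  ∧-true : ∀ {b c} → b ∧ c ≡ true → b ≡ true × c ≡ true
  ∧-true {true} {true} _ = refl , refl

  ≢true⇒false : ∀ {b} → b ≢ true → b ≡ false
  ≢true⇒false {false} _ = refl
  ≢true⇒false {true} b≢ = contradiction refl b≢

  sum-mono : ∀ {n} {f g : Fin n → ℤ} → (∀ i → f i ≤ g i) → sum f ≤ sum g
  sum-mono {zero} f≤g = ≤-refl
  sum-mono {suc n} f≤g = +-mono-≤ (f≤g zero) (sum-mono (f≤g ∘ suc))

  sum-nonneg : ∀ {n} {f : Fin n → ℤ} → (∀ i → 0ℤ ≤ f i) → 0ℤ ≤ sum f
  sum-nonneg {zero} 0≤f = ≤-refl
  sum-nonneg {suc n} 0≤f = 0≤+ (0≤f zero) (sum-nonneg (0≤f ∘ suc))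

  sum-< : ∀ {n} {f g : Fin n → ℤ} i → (∀ j → f j ≤ g j) → f i < g i → sum f < sum g
  sum-< zero f≤g fi<gi = +-mono-<-≤ fi<gi (sum-mono (f≤g ∘ suc))
  sum-< (suc i) f≤g fi<gi = +-mono-≤-< (f≤g zero) (sum-< i (f≤g ∘ suc) fi<gi)

  ∃-pos : ∀ {n} (f : Fin n → ℤ) i → f i < 0ℤ → 0ℤ ≤ sum f → ∃ λ j → 0ℤ < f j
  ∃-pos {n} f i fi<0 0≤∑ with any? (λ j → 0ℤ <? f j)
  ... | yes pos = pos
  ... | no ∄pos = contradiction
        (subst (sum f <_) (sum-zero {n} (λ _ → 0ℤ) λ _ → refl)
          (sum-< i (λ j → ≮⇒≥ λ 0<fj → ∄pos (j , 0<fj)) fi<0))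
        (ℤ.≤⇒≯ 0≤∑)

  sum-zero⁻¹ : ∀ {n} {f : Fin n → ℤ} → (∀ i → 0ℤ ≤ f i) → sum f ≡ 0ℤ → ∀ i → f i ≡ 0ℤ
  sum-zero⁻¹ {n} {f} 0≤f ∑≡0 i with f i ≟ᶻ 0ℤ
  ... | yes fi≡0 = fi≡0
  ... | no fi≢0 = contradiction
        (subst (_< sum f) (sum-zero {n} (λ _ → 0ℤ) λ _ → refl)
          (sum-< i 0≤f (≢0∧≥0⇒>0 (0≤f i) fi≢0)))
        (ℤ.≤⇒≯ (≤-reflexive ∑≡0))

  infixl 8 _·_

  opaque
    _·_ : ∀ {n} → (Fin n → ℤ) → (Fin n → ℤ) → ℤ
    f · g = sum λ i → f i * g i

  opaque
    unfolding _·_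

    ·-unfold : ∀ {n} (f g : Fin n → ℤ) → f · g ≡ sum (λ i → f i * g i)
    ·-unfold f g = refl

    ·-cong : ∀ {n} {f g f′ g′ : Fin n → ℤ} → (∀ i → f i * g i ≡ f′ i * g′ i) → f · g ≡ f′ · g′
    ·-cong = sum-cong-≗

    ·-congʳ : ∀ {n} (f : Fin n → ℤ) {g g′} → g ≗ g′ → f · g ≡ f · g′
    ·-congʳ f g≗g′ = sum-cong-≗ λ i → cong (f i *_) (g≗g′ i)

    ·-congˡ : ∀ {n} (g : Fin n → ℤ) {f f′} → f ≗ f′ → f · g ≡ f′ · g
    ·-congˡ g f≗f′ = sum-cong-≗ λ i → cong (_* g i) (f≗f′ i)

    ·-+ʳ : ∀ {n} (f g h : Fin n → ℤ) → f · (λ i → g i + h i) ≡ f · g + f · h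
    ·-+ʳ f g h = trans (sum-cong-≗ λ i → ℤ.*-distribˡ-+ (f i) (g i) (h i))
                       (∑-distrib-+ (λ i → f i * g i) λ i → f i * h i)

    ·-+ˡ : ∀ {n} (f g h : Fin n → ℤ) → (λ i → f i + g i) · h ≡ f · h + g · h
    ·-+ˡ f g h = trans (sum-cong-≗ λ i → ℤ.*-distribʳ-+ (h i) (f i) (g i))
                       (∑-distrib-+ (λ i → f i * h i) λ i → g i * h i)

    ·-*ˡ : ∀ {n} a (f g : Fin n → ℤ) → (λ i → a * f i) · g ≡ a * f · g
    ·-*ˡ a f g = trans (sum-cong-≗ λ i → *-assoc a (f i) (g i)) (sym (*-distribˡ-sum a λ i → f i * g i))

    ·-*ʳ : ∀ {n} a (f g : Fin n → ℤ) → f · (λ i → a * g i) ≡ a * f · g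
    ·-*ʳ a f g = trans (sum-cong-≗ λ i → comm a (f i) (g i)) (sym (*-distribˡ-sum a λ i → f i * g i))
      where
      comm : ∀ a x y → x * (a * y) ≡ a * (x * y)
      comm = solve-∀

    ·-comm : ∀ {n} (f g : Fin n → ℤ) → f · g ≡ g · f
    ·-comm f g = sum-cong-≗ λ i → *-comm (f i) (g i)

    ·-at : ∀ {n} (f : Fin n → ℤ) i → f · (⟦_⟧ ∘ is i) ≡ f i
    ·-at f i = trans (sum-at _ i λ j j≢i → trans (cong (λ b → f j * ⟦ b ⟧) (is-≢ (j≢i ∘ sym))) (*-zeroʳ (f j)))
                     (trans (cong (λ b → f i * ⟦ b ⟧) (is-refl i)) (*-identityʳ (f i)))

    ·-zeroˡ : ∀ {n} (g : Fin n → ℤ) → (λ _ → 0ℤ) · g ≡ 0ℤ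
    ·-zeroˡ g = sum-zero _ λ i → *-zeroˡ (g i)

    ·-nonneg : ∀ {n} {f g : Fin n → ℤ} → (∀ i → 0ℤ ≤ f i) → (∀ i → 0ℤ ≤ g i) → 0ℤ ≤ f · g
    ·-nonneg 0≤f 0≤g = sum-nonneg λ i → 0≤* (0≤f i) (0≤g i)

    ·-monoʳ : ∀ {n} {f g h : Fin n → ℤ} → (∀ i → 0ℤ ≤ f i) → (∀ i → f i ≢ 0ℤ → g i ≤ h i) → f · g ≤ f · h
    ·-monoʳ {f = f} {g} {h} 0≤f g≤h = sum-mono term
      where
      term : ∀ i → f i * g i ≤ f i * h i
      term i with f i ≟ᶻ 0ℤ
      ... | yes fi≡0 = ≤-reflexive (trans (cong (_* g i) fi≡0) (cong (_* h i) (sym fi≡0)))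
      ... | no fi≢0 = *-monoˡ (0≤f i) (g≤h i fi≢0)

  ·-comb : ∀ {n} a b (f g h : Fin n → ℤ) → (λ i → a * f i + b * g i) · h ≡ a * f · h + b * g · h
  ·-comb a b f g h = trans (·-+ˡ (λ i → a * f i) (λ i → b * g i) h) (cong₂ _+_ (·-*ˡ a f h) (·-*ˡ b g h))

  parity : ∀ {n} (f g : Fin n → Bool) → Bool
  parity f g = par λ i → f i ∧ g i

  par-is : ∀ {n} (f : Fin n → Bool) i → par (λ j → f j ∧ is i j) ≡ f i
  par-is f i = trans (par-at _ i λ j j≢i → trans (cong (f j ∧_) (is-≢ (j≢i ∘ sym))) (Bool.∧-zeroʳ (f j)))
                     (trans (cong (f i ∧_) (is-refl i)) (Bool.∧-identityʳ (f i)))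

  subsets : ∀ n → List (Vec Bool n)
  subsets zero = [] ∷ []
  subsets (suc n) = map (false ∷_) (subsets n) ++ map (true ∷_) (subsets n)

  ∈-subsets : ∀ {n} (X : Vec Bool n) → X ∈ subsets n
  ∈-subsets [] = here refl
  ∈-subsets (false ∷ X) = ∈-++⁺ˡ (∈-map⁺ (false ∷_) (∈-subsets X))
  ∈-subsets (true ∷ X) = ∈-++⁺ʳ _ (∈-map⁺ (true ∷_) (∈-subsets X))

  -- Totality and transitivity are asked only among elements satisfying `P`: the cross-multiplied
  -- comparison of the ratio test is transitive only for negative slopes.
  least : ∀ {I : Set} (xs : List I) {P : I → Set} (P? : ∀ x → Dec (P x)) (_≼_ : I → I → Set) →
    (∀ x y → P x → P y → x ≼ y ⊎ y ≼ x) →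
    (∀ x y z → P x → P y → P z → x ≼ y → y ≼ z → x ≼ z) →
    (∀ x → x ∈ xs → ¬ P x) ⊎ ∃ λ x → P x × ∀ y → y ∈ xs → P y → x ≼ y
  least [] P? _≼_ total trans≼ = inj₁ λ _ ()
  least (x ∷ xs) {P} P? _≼_ total trans≼ with P? x | least xs P? _≼_ total trans≼
  ... | no ¬Px | inj₁ none = inj₁ λ { y (here refl) → ¬Px ; y (there y∈) → none y y∈ }
  ... | no ¬Px | inj₂ (z , Pz , min) =
    inj₂ (z , Pz , λ { y (here refl) Py → contradiction Py ¬Px ; y (there y∈) → min y y∈ })
  ... | yes Px | inj₁ none =
    inj₂ (x , Px , λ { y (here refl) _ → [ id , id ] (total x x Px Px)
                     ; y (there y∈) Py → contradiction Py (none y y∈) })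
  ... | yes Px | inj₂ (z , Pz , min) with total x z Px Pz
  ... | inj₁ x≼z = inj₂ (x , Px , λ { y (here refl) _ → [ id , id ] (total x x Px Px)
                                    ; y (there y∈) Py → trans≼ x z y Px Pz Py x≼z (min y y∈ Py) })
  ... | inj₂ z≼x = inj₂ (z , Pz , λ { y (here refl) _ → z≼x ; y (there y∈) → min y y∈ })

  -- The search runs over subsets as vectors, which represent boolean functions only up to pointwise
  -- equality; hence `P` must respect it.
  ∃-function? : ∀ {n} {P : (Fin n → Bool) → Set} → (∀ {f g} → f ≗ g → P f → P g) →
    (∀ f → Dec (P f)) → Dec (∃ P)
  ∃-function? {n} {P} resp P? with anySubset? (λ X → P? (lookup X))
  ... | yes (X , PX) = yes (lookup X , PX)
  ... | no ∄ = no λ { (f , Pf) → ∄ (tabulate f , resp (λ i → sym (lookup∘tabulate f i)) Pf) }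

  -- Cardinalities, Gaussian elimination and parity

  card : ∀ {n} → (Fin n → Bool) → ℤ
  card f = sum (⟦_⟧ ∘ f)

  _∖_ : ∀ {n} → (Fin n → Bool) → Fin n → Fin n → Bool
  (f ∖ i) j = f j ∧ not (is i j)

  ∖-true : ∀ {n} {f : Fin n → Bool} {i j} → (f ∖ i) j ≡ true → f j ≡ true × i ≢ j
  ∖-true {f = f} {i} {j} eq with f j | i ≟ᶠ j
  ∖-true eq | true | no i≢j = refl , i≢j

  ∖-false : ∀ {n} {f : Fin n → Bool} {i j} → f j ≡ false → (f ∖ i) j ≡ false
  ∖-false fj = cong (_∧ _) fj

  card-is : ∀ {n} (i : Fin n) → card (is i) ≡ 1ℤ
  card-is i = trans (sum-at _ i λ j j≢i → cong ⟦_⟧ (is-≢ (j≢i ∘ sym))) (cong ⟦_⟧ (is-refl i))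

  card-∖ : ∀ {n} (f : Fin n → Bool) i → f i ≡ true → card f ≡ card (f ∖ i) + 1ℤ
  card-∖ f i fi = trans (sum-cong-≗ term)
    (trans (∑-distrib-+ (⟦_⟧ ∘ (f ∖ i)) (⟦_⟧ ∘ is i)) (cong (λ x → card (f ∖ i) + x) (card-is i)))
    where
    term : ∀ j → ⟦ f j ⟧ ≡ ⟦ (f ∖ i) j ⟧ + ⟦ is i j ⟧
    term j with i ≟ᶠ j
    ... | yes refl rewrite fi = refl
    ... | no _ with f j
    ... | true = refl
    ... | false = refl

  card-nonneg : ∀ {n} (f : Fin n → Bool) → 0ℤ ≤ card f
  card-nonneg f = sum-nonneg λ i → 0≤⟦ f i ⟧

  card-pick : ∀ {n} (f : Fin n → Bool) → 0ℤ < card f → ∃ λ i → f i ≡ true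
  card-pick f 0<card with any? (λ i → f i Bool.≟ true)
  ... | yes found = found
  ... | no none = contradiction
    (sum-zero (⟦_⟧ ∘ f) λ i → cong ⟦_⟧ (≢true⇒false λ fi → none (i , fi))) (<⇒≢0 0<card)

  card-mono : ∀ {n} {f g : Fin n → Bool} → (∀ i → f i ≡ true → g i ≡ true) → card f ≤ card g
  card-mono {f = f} {g} f⊆g = sum-mono term
    where
    term : ∀ i → ⟦ f i ⟧ ≤ ⟦ g i ⟧
    term i with f i in fi
    ... | false = 0≤⟦ g i ⟧
    ... | true rewrite f⊆g i fi = ≤-refl

  card-strict : ∀ {n} {f g : Fin n → Bool} i → (∀ j → f j ≡ true → g j ≡ true) →
    f i ≡ false → g i ≡ true → card f < card g
  card-strict {f = f} {g} i f⊆g fi gi = subst (card f <_) (sym (card-∖ g i gi))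
    (≤-<-trans (card-mono f⊆g∖i) (subst (_< card (g ∖ i) + 1ℤ) (+-identityʳ _) (ℤ.+-monoʳ-< (card (g ∖ i)) (+<+ (s≤s z≤n)))))
    where
    f⊆g∖i : ∀ j → f j ≡ true → (g ∖ i) j ≡ true
    f⊆g∖i j fj rewrite f⊆g j fj | is-≢ {i = i} {j} (λ { refl → true≢false fj fi }) = refl

  -- Gaussian elimination, one equation at a time: eliminating a variable e from the remaining
  -- equations also removes e from the support.
  kernel : ∀ {m} k (L : Fin k → Fin m → ℤ) (act : Fin k → Bool) (sup : Fin m → Bool) →
    card act < card sup →
    Σ (Fin m → ℤ) λ y → (∃ λ e → y e ≢ 0ℤ) × (∀ e → sup e ≡ false → y e ≡ 0ℤ) ×
      (∀ i → act i ≡ true → L i · y ≡ 0ℤ)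
  kernel zero L act sup lt with card-pick sup lt
  ... | e , se = (⟦_⟧ ∘ is e) , (e , λ eq → contradiction (trans (sym (cong ⟦_⟧ (is-refl e))) eq) λ ()) ,
    (λ f sf → cong ⟦_⟧ (is-≢ λ { refl → true≢false se sf })) , λ ()
  kernel (suc k) L act sup lt with act zero in a0
  ... | false with kernel k (L ∘ suc) (act ∘ suc) sup (subst (_< card sup) (+-identityˡ _) lt)
  ...   | y , y≢0 , supp , ker = y , y≢0 , supp ,
          λ { zero ai → contradiction (trans (sym a0) ai) λ () ; (suc i) ai → ker i ai }
  kernel (suc k) L act sup lt | true
    with any? (λ e → (sup e Bool.≟ true) ×-dec ¬? (L zero e ≟ᶻ 0ℤ))
  ... | no none with kernel k (L ∘ suc) (act ∘ suc) sup
          (≤-<-trans (ℤ.i≤suc[i] (card (act ∘ suc))) lt)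
  ...   | y , y≢0 , supp , ker = y , y≢0 , supp , λ { zero _ → ker₀ ; (suc i) ai → ker i ai }
    where
    term : ∀ e → L zero e * y e ≡ 0ℤ * 0ℤ
    term e with sup e in se
    ... | false = trans (cong (L zero e *_) (supp e se)) (*-zeroʳ (L zero e))
    ... | true with L zero e ≟ᶻ 0ℤ
    ...   | yes L≡0 = trans (cong (_* y e) L≡0) (*-zeroˡ (y e))
    ...   | no L≢0 = contradiction (e , se , L≢0) none
    ker₀ : L zero · y ≡ 0ℤ
    ker₀ = trans (·-cong {f′ = λ _ → 0ℤ} {λ _ → 0ℤ} term) (·-zeroˡ (λ _ → 0ℤ))
  kernel {m} (suc k) L act sup lt | true | yes (e , se , a≢0)
    with kernel k (λ i f → L zero e * L (suc i) f + - L (suc i) e * L zero f) (act ∘ suc) (sup ∖ e) lt′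
    where
    lt′ : card (act ∘ suc) < card (sup ∖ e)
    lt′ = +-cancelʳ-< (card (act ∘ suc)) (card (sup ∖ e)) (subst₂ _<_ (+-comm 1ℤ (card (act ∘ suc))) (card-∖ sup e se) lt)
  ... | y′ , (e′ , y′≢0) , supp , ker = y , (e′ , y≢0) , supp′ , λ { zero _ → ker₀ ; (suc i) ai → ker₊ i ai }
    where
    a = L zero e
    -- `y′` vanishes at `e`, so the coordinate at `e` is free; this value solves the pivot equation,
    -- since `L zero · y` becomes a (L₀ · y′) + b a = 0.
    b = - (L zero · y′)
    y : Fin m → ℤ
    y f = a * y′ f + b * ⟦ is e f ⟧
    off : ∀ f → e ≢ f → y f ≡ a * y′ f
    off f e≢f rewrite is-≢ e≢f | *-zeroʳ b = +-identityʳ _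
    e≢e′ : e ≢ e′
    e≢e′ refl = y′≢0 (supp e (trans (cong (λ c → sup e ∧ not c) (is-refl e)) (Bool.∧-zeroʳ (sup e))))
    y≢0 : y e′ ≢ 0ℤ
    y≢0 eq with ℤ.i*j≡0⇒i≡0∨j≡0 a (trans (sym (off e′ e≢e′)) eq)
    ... | inj₁ a≡0 = a≢0 a≡0
    ... | inj₂ y≡0 = y′≢0 y≡0
    supp′ : ∀ f → sup f ≡ false → y f ≡ 0ℤ
    supp′ f sf = trans (off f λ { refl → true≢false se sf })
      (trans (cong (a *_) (supp f (∖-false {f = sup} sf))) (*-zeroʳ a))
    expand : ∀ i → L i · y ≡ a * L i · y′ + b * L i e
    expand i = trans (·-+ʳ (L i) (λ f → a * y′ f) (λ f → b * ⟦ is e f ⟧))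
      (cong₂ _+_ (·-*ʳ a (L i) y′) (trans (·-*ʳ b (L i) (⟦_⟧ ∘ is e)) (cong (b *_) (·-at (L i) e))))
    ker₀ : L zero · y ≡ 0ℤ
    ker₀ = trans (expand zero) (cancel a (L zero · y′))
      where
      cancel : ∀ a x → a * x + - x * a ≡ 0ℤ
      cancel = solve-∀
    ker₊ : ∀ i → act (suc i) ≡ true → L (suc i) · y ≡ 0ℤ
    ker₊ i ai = trans (expand (suc i)) (trans (swap (a * L (suc i) · y′) (L (suc i) e) (L zero · y′))
      (trans (sym (·-comb a (- L (suc i) e) (L (suc i)) (L zero) y′)) (ker i ai)))
      where
      swap : ∀ x l z → x + - z * l ≡ x + - l * z
      swap = solve-∀

  odd : ℕ → Bool
  odd zero = false
  odd (suc k) = not (odd k)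

  card-par : ∀ {n} (f : Fin n → Bool) → ∃ λ k → card f ≡ + k × par f ≡ odd k
  card-par {zero} f = 0 , refl , refl
  card-par {suc n} f with f zero | card-par (f ∘ suc)
  ... | false | k , eq , po = k , trans (+-identityˡ _) eq , po
  ... | true | k , eq , po = suc k , cong (λ x → 1ℤ + x) eq , cong not po

  card≡⟦⟧⇒par : ∀ {n} (f : Fin n → Bool) {b} → card f ≡ ⟦ b ⟧ → par f ≡ b
  card≡⟦⟧⇒par f eq with card-par f
  card≡⟦⟧⇒par f {false} eq | k , ck , po with trans (sym ck) eq
  ... | refl = po
  card≡⟦⟧⇒par f {true} eq | k , ck , po with trans (sym ck) eq
  ... | refl = po

  par⇒card≥1 : ∀ {n} (f : Fin n → Bool) → par f ≡ true → 1ℤ ≤ card f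
  par⇒card≥1 f pf with card-par f
  ... | zero , ck , po = contradiction (trans (sym po) pf) λ ()
  ... | suc k , ck , po = subst (1ℤ ≤_) (sym ck) (+≤+ (s≤s z≤n))

  card≡1⇒unique : ∀ {n} (f : Fin n → Bool) → card f ≡ 1ℤ → ∀ {i j} → f i ≡ true → f j ≡ true → i ≡ j
  card≡1⇒unique f c {i} {j} fi fj with i ≟ᶠ j
  ... | yes i≡j = i≡j
  ... | no i≢j = contradiction
    (trans (sym (cong₂ (λ a b → ⟦ a ∧ not b ⟧) fj (is-≢ i≢j)))
           (sum-zero⁻¹ (λ k → 0≤⟦ (f ∖ i) k ⟧) zero-card j)) λ ()
    where
    zero-card : card (f ∖ i) ≡ 0ℤ
    zero-card = ℤ.i-j≡0⇒i≡j _ _ (trans (shift (card (f ∖ i))) (cong (λ x → x - 1ℤ) (trans (sym (card-∖ f i fi)) c)))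
      where
      shift : ∀ x → x - 0ℤ ≡ x + 1ℤ - 1ℤ
      shift = solve-∀

  ·-card : ∀ {n} (f g : Fin n → Bool) → (⟦_⟧ ∘ f) · (⟦_⟧ ∘ g) ≡ card (λ i → f i ∧ g i)
  ·-card f g = trans (·-unfold (⟦_⟧ ∘ f) (⟦_⟧ ∘ g)) (sum-cong-≗ λ i → mult (f i) (g i))
    where
    mult : ∀ a b → ⟦ a ⟧ * ⟦ b ⟧ ≡ ⟦ a ∧ b ⟧
    mult false b = *-zeroˡ ⟦ b ⟧
    mult true b = *-identityˡ ⟦ b ⟧

  par-is′ : ∀ {n} (f : Fin n → Bool) i → par (λ j → f j ∧ is j i) ≡ f i
  par-is′ f i = trans (par-at _ i λ j j≢i → trans (cong (f j ∧_) (is-≢ j≢i)) (Bool.∧-zeroʳ (f j)))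
                      (trans (cong (f i ∧_) (is-refl i)) (Bool.∧-identityʳ (f i)))

  -- Cuts and the scaled perfect matching polytope

  cut : ∀ {m n} → (Fin m → Fin n) → (Fin m → Fin n) → (Fin n → Bool) → Fin m → Bool
  cut p q X e = X (p e) xor X (q e)

  χ : ∀ {m n} → (Fin m → Fin n) → (Fin m → Fin n) → (Fin n → Bool) → Fin m → ℤ
  χ p q X e = ⟦ cut p q X e ⟧

  -- Weights on the edges (p e , q e) that lie in Q times the perfect matching polytope of the
  -- graph on the active vertices A.  Loops and inactive vertices, which contractions leave behind,
  -- carry no weight.
  record Fractional {m n} (p q : Fin m → Fin n) (A : Fin n → Bool) (W : Fin m → ℤ) (Q : ℤ) : Set where
    field
      nonneg : ∀ e → 0ℤ ≤ W e
      degree : ∀ v → W · χ p q (is v) ≡ Q * ⟦ A v ⟧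
      loop   : ∀ e → p e ≡ q e → W e ≡ 0ℤ
      odd-cut : ∀ X → parity X A ≡ true → Q ≤ W · χ p q X

  record Perfect {m n} (p q : Fin m → Fin n) (A : Fin n → Bool) (W : Fin m → ℤ) (M : Fin m → Bool) : Set where
    field
      degree  : ∀ v → (⟦_⟧ ∘ M) · χ p q (is v) ≡ ⟦ A v ⟧
      support : ∀ e → M e ≡ true → W e ≢ 0ℤ

  module _ {m n} {p q : Fin m → Fin n} where

    χ-cong : ∀ {X Y} → X ≗ Y → χ p q X ≗ χ p q Y
    χ-cong X≗Y e = cong₂ (λ a b → ⟦ a xor b ⟧) (X≗Y (p e)) (X≗Y (q e))

    cut-not : ∀ X e → cut p q (not ∘ X) e ≡ cut p q X e
    cut-not X e = Bool.xor-annihilates-not (X (p e)) (X (q e))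

    χ-not : ∀ X → χ p q (not ∘ X) ≗ χ p q X
    χ-not X e = cong ⟦_⟧ (cut-not X e)

    -- Over the field of two elements the cut of `X` is the sum of the stars of its vertices, so
    -- exchanging the two sums reduces every cut to degrees.
    cut-parity : ∀ {M D} → (∀ v → parity M (cut p q (is v)) ≡ D v) → ∀ X → parity M (cut p q X) ≡ parity X D
    cut-parity {M} {D} M-degree X = begin
      par (λ e → M e ∧ (X (p e) xor X (q e)))
        ≡⟨ par-cong (λ e → cong (M e ∧_) (sym (by-vertex e))) ⟩
      par (λ e → M e ∧ par λ v → X v ∧ cut p q (is v) e)
        ≡⟨ par-cong (λ e → par-∧ (M e) (λ v → X v ∧ cut p q (is v) e)) ⟩
      par (λ e → par λ v → M e ∧ (X v ∧ cut p q (is v) e))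
        ≡⟨ par-comm (λ e v → M e ∧ (X v ∧ cut p q (is v) e)) ⟩
      par (λ v → par λ e → M e ∧ (X v ∧ cut p q (is v) e))
        ≡⟨ par-cong (λ v → trans (par-cong λ e → swap (M e) (X v) (cut p q (is v) e))
             (sym (par-∧ (X v) (λ e → M e ∧ cut p q (is v) e)))) ⟩
      par (λ v → X v ∧ parity M (cut p q (is v)))
        ≡⟨ par-cong (λ v → cong (X v ∧_) (M-degree v)) ⟩
      par (λ v → X v ∧ D v) ∎
      where
      open ≡-Reasoning
      swap : ∀ a b c → a ∧ (b ∧ c) ≡ b ∧ (a ∧ c)
      swap false false c = refl
      swap false true c = refl
      swap true false c = refl
      swap true true c = refl
      by-vertex : ∀ e → par (λ v → X v ∧ cut p q (is v) e) ≡ X (p e) xor X (q e)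
      by-vertex e = trans (par-cong λ v → Bool.∧-distribˡ-xor (X v) (is v (p e)) (is v (q e)))
        (trans (par-xor (λ v → X v ∧ is v (p e)) (λ v → X v ∧ is v (q e)))
               (cong₂ _xor_ (par-is′ X (p e)) (par-is′ X (q e))))

    matching-parity : ∀ {A W M} → Perfect p q A W M → ∀ X → parity M (cut p q X) ≡ parity X A
    matching-parity {A} {W} {M} PM = cut-parity {M} {A} λ v →
      card≡⟦⟧⇒par (λ e → M e ∧ cut p q (is v) e) (trans (sym (·-card M (cut p q (is v)))) (Perfect.degree PM v))

    module _ {A W Q} (F : Fractional p q A W Q) (0<Q : 0ℤ < Q) where

      -- The whole vertex set has an empty cut, of weight 0 < Q; were it odd, its cut inequality
      -- would fail.
      total-even : parity (const true) A ≡ false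
      total-even = ≢true⇒false λ eq → <⇒≱ 0<Q (subst (Q ≤_)
        (trans (·-comm W _) (·-zeroˡ W)) (Fractional.odd-cut F (const true) eq))

      complement-odd : ∀ {X} → parity X A ≡ true → parity (not ∘ X) A ≡ true
      complement-odd {X} X-odd = trans (par-cong λ v → split (X v) (A v))
        (trans (par-xor A (λ v → X v ∧ A v)) (cong₂ _xor_ total-even X-odd))
        where
        split : ∀ a b → not a ∧ b ≡ b xor (a ∧ b)
        split false b = sym (Bool.xor-identityʳ b)
        split true b = sym (Bool.xor-same b)

  -- Contracting the outside of a tight odd set

  module Contraction {m n} {p q : Fin m → Fin n} {A W Q} (F : Fractional p q A W Q) (0<Q : 0ℤ < Q)
    (S : Fin n → Bool) (s : Fin n) (s∉S : S s ≡ false)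
    (S-odd : parity S A ≡ true) (S-tight : W · χ p q S ≡ Q) where

    module F = Fractional F

    meets : Fin m → Bool
    meets e = S (p e) ∨ S (q e)

    -- The retraction that merges everything outside `S` into `s`, itself a vertex outside `S`.
    -- Edges that miss `S` turn into loops at `s`, which is why `W′` discards them.
    ρ : Fin n → Fin n
    ρ v = if S v then v else s

    p′ q′ : Fin m → Fin n
    p′ = ρ ∘ p
    q′ = ρ ∘ q

    A′ : Fin n → Bool
    A′ v = if S v then A v else is s v

    W′ : Fin m → ℤ
    W′ e = if meets e then W e else 0ℤ

    W′-χ : ∀ X → W′ · χ p′ q′ X ≡ W · χ p q (X ∘ ρ)
    W′-χ X = ·-cong term
      where
      term : ∀ e → W′ e * χ p′ q′ X e ≡ W e * χ p q (X ∘ ρ) e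
      term e with S (p e) | S (q e)
      ... | true | _ = refl
      ... | false | true = refl
      ... | false | false rewrite Bool.xor-same (X s) = sym (*-zeroʳ (W e))

    outside-odd : parity (not ∘ S) A ≡ true
    outside-odd = complement-odd F 0<Q S-odd

    -- Modulo 2 the merged vertex stands for all active vertices outside `S`: it counts once, and
    -- their number is odd.
    parity-ρ : ∀ X → parity X A′ ≡ parity (X ∘ ρ) A
    parity-ρ X = begin
      parity X A′
        ≡⟨ par-cong left ⟩
      par (λ v → (S v ∧ (X v ∧ A v)) xor (X v ∧ is s v))
        ≡⟨ par-xor (λ v → S v ∧ (X v ∧ A v)) (λ v → X v ∧ is s v) ⟩
      inner xor par (λ v → X v ∧ is s v)
        ≡⟨ cong (inner xor_) (trans (par-is X s) (sym (Bool.∧-identityʳ (X s)))) ⟩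
      inner xor (X s ∧ true)
        ≡⟨ cong (inner xor_) (trans (cong (X s ∧_) (sym outside-odd)) (par-∧ (X s) (λ v → not (S v) ∧ A v))) ⟩
      inner xor par (λ v → X s ∧ (not (S v) ∧ A v))
        ≡⟨ sym (par-xor (λ v → S v ∧ (X v ∧ A v)) (λ v → X s ∧ (not (S v) ∧ A v))) ⟩
      par (λ v → (S v ∧ (X v ∧ A v)) xor (X s ∧ (not (S v) ∧ A v)))
        ≡⟨ par-cong right ⟩
      parity (X ∘ ρ) A ∎
      where
      open ≡-Reasoning
      inner = par λ v → S v ∧ (X v ∧ A v)
      left : ∀ v → X v ∧ A′ v ≡ (S v ∧ (X v ∧ A v)) xor (X v ∧ is s v)
      left v with S v in Sv
      ... | false = refl
      ... | true rewrite is-≢ {i = s} {v} (λ { refl → true≢false Sv s∉S }) | Bool.∧-zeroʳ (X v) =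
        sym (Bool.xor-identityʳ _)
      right : ∀ v → (S v ∧ (X v ∧ A v)) xor (X s ∧ (not (S v) ∧ A v)) ≡ X (ρ v) ∧ A v
      right v with S v
      ... | false = refl
      ... | true = trans (cong (λ b → (X v ∧ A v) xor b) (Bool.∧-zeroʳ (X s))) (Bool.xor-identityʳ _)

    is-ρ-in : ∀ {v} → S v ≡ true → is v ∘ ρ ≗ is v
    is-ρ-in {v} Sv u with S u in Su
    ... | true = refl
    ... | false = trans (is-≢ λ { refl → true≢false Sv s∉S }) (sym (is-≢ λ { refl → true≢false Sv Su }))

    is-ρ-s : is s ∘ ρ ≗ not ∘ S
    is-ρ-s u with S u in Su
    ... | true = is-≢ λ { refl → true≢false Su s∉S }
    ... | false = is-refl s

    χ-s : χ p′ q′ (is s) ≗ χ p q S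
    χ-s e = trans (χ-cong {p = p} {q} is-ρ-s e) (χ-not {p = p} {q} S e)

    -- The only new degree condition is at `s`, whose star is the cut of `S`; it has weight Q
    -- exactly because `S` is tight. Odd cuts pull back along `ρ` to odd cuts of the same weight.
    contracted : Fractional p′ q′ A′ W′ Q
    contracted = record
      { nonneg = nonneg ; degree = degree ; loop = loop
      ; odd-cut = λ X odd → subst (Q ≤_) (sym (W′-χ X)) (F.odd-cut (X ∘ ρ) (trans (sym (parity-ρ X)) odd)) }
      where
      nonneg : ∀ e → 0ℤ ≤ W′ e
      nonneg e with meets e
      ... | true = F.nonneg e
      ... | false = ≤-refl
      loop : ∀ e → p′ e ≡ q′ e → W′ e ≡ 0ℤ
      loop e eq with S (p e) in Sp | S (q e) in Sq
      ... | true | true = F.loop e eq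
      ... | false | false = refl
      ... | true | false = contradiction s∉S (λ s∉ → true≢false (subst (λ x → S x ≡ true) eq Sp) s∉)
      ... | false | true = contradiction s∉S (λ s∉ → true≢false (subst (λ x → S x ≡ true) (sym eq) Sq) s∉)
      degree : ∀ v → W′ · χ p′ q′ (is v) ≡ Q * ⟦ A′ v ⟧
      degree v with S v in Sv
      ... | true = trans (W′-χ (is v)) (trans (·-congʳ W (χ-cong (is-ρ-in Sv))) (F.degree v))
      ... | false with s ≟ᶠ v
      ...   | yes refl = trans (W′-χ (is s)) (trans (·-congʳ W χ-s) (trans S-tight (sym (*-identityʳ Q))))
      ...   | no s≢v = trans (W′-χ (is v)) (trans (·-congʳ W (χ-cong is-ρ-off))
                         (trans (·-comm W _) (trans (·-zeroˡ W) (sym (*-zeroʳ Q)))))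
        where
        is-ρ-off : is v ∘ ρ ≗ const false
        is-ρ-off u with S u in Su
        ... | true = is-≢ λ { refl → true≢false Su Sv }
        ... | false = is-≢ (s≢v ∘ sym)

    cut-one : ∀ {M} → Perfect p′ q′ A′ W′ M → card (λ e → M e ∧ cut p q S e) ≡ 1ℤ
    cut-one {M} PM = trans (sym (·-card M (cut p q S)))
      (trans (sym (·-congʳ (⟦_⟧ ∘ M) χ-s)) (trans (Perfect.degree PM s) active))
      where
      active : ⟦ A′ s ⟧ ≡ 1ℤ
      active rewrite s∉S | is-refl s = refl

    meets-support : ∀ {M} → Perfect p′ q′ A′ W′ M → ∀ {e} → M e ≡ true → meets e ≡ true
    meets-support PM {e} Me with meets e | Perfect.support PM e Me
    ... | true | _ = refl
    ... | false | 0≢0 = contradiction refl 0≢0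

    W′≢0 : ∀ {e} → W′ e ≢ 0ℤ → W e ≢ 0ℤ
    W′≢0 {e} W′≢0 with meets e
    ... | true = W′≢0
    ... | false = contradiction refl W′≢0

    inside-degree : ∀ {M M′} → Perfect p′ q′ A′ W′ M′ → (∀ e → meets e ≡ true → M e ≡ M′ e) →
      ∀ v → S v ≡ true → (⟦_⟧ ∘ M) · χ p q (is v) ≡ ⟦ A v ⟧
    inside-degree {M} {M′} PM agree v Sv = trans (·-cong term) (trans (Perfect.degree PM v)
      (cong ⟦_⟧ (cong (λ b → if b then A v else is s v) Sv)))
      where
      term : ∀ e → ⟦ M e ⟧ * χ p q (is v) e ≡ ⟦ M′ e ⟧ * χ p′ q′ (is v) e
      term e = trans at (cong (⟦ M′ e ⟧ *_) (sym (χ-cong {p = p} {q} (is-ρ-in Sv) e)))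
        where
        at : ⟦ M e ⟧ * χ p q (is v) e ≡ ⟦ M′ e ⟧ * χ p q (is v) e
        at with v ≟ᶠ p e | v ≟ᶠ q e
        ... | yes refl | _ rewrite agree e (cong (_∨ S (q e)) Sv) = refl
        ... | no _ | yes refl rewrite agree e (trans (cong (S (p e) ∨_) Sv) (Bool.∨-zeroʳ (S (p e)))) = refl
        ... | no _ | no _ = trans (*-zeroʳ ⟦ M e ⟧) (sym (*-zeroʳ ⟦ M′ e ⟧))

  -- Optimal matchings and gluing along a tight cut

  -- By linear programming duality, Good says that W / Q is a convex combination of perfect matchings.
  Good : ∀ {m n} → (Fin m → Fin n) → (Fin m → Fin n) → (Fin n → Bool) → (Fin m → ℤ) → ℤ → Set
  Good p q A W Q = ∀ c → ∃ λ M → Perfect p q A W M × c · W ≤ Q * c · (⟦_⟧ ∘ M)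

  Perfect-resp : ∀ {m n} {p q : Fin m → Fin n} {A W M M′} → M ≗ M′ →
    Perfect p q A W M → Perfect p q A W M′
  Perfect-resp {p = p} {q} eq PM = record
    { degree = λ v → trans (·-congˡ (χ p q (is v)) λ e → cong ⟦_⟧ (sym (eq e))) (Perfect.degree PM v)
    ; support = λ e M′e → Perfect.support PM e (trans (eq e) M′e) }

  Perfect? : ∀ {m n} {p q : Fin m → Fin n} {A W} M → Dec (Perfect p q A W M)
  Perfect? {p = p} {q} {A} {W} M
    with all? (λ v → (⟦_⟧ ∘ M) · χ p q (is v) ≟ᶻ ⟦ A v ⟧)
       | all? (λ e → (M e Bool.≟ true) →-dec ¬? (W e ≟ᶻ 0ℤ))
  ... | yes deg | yes supp = yes (record { degree = deg ; support = supp })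
  ... | no ¬deg | _ = no λ PM → ¬deg (Perfect.degree PM)
  ... | _ | no ¬supp = no λ PM → ¬supp (Perfect.support PM)

  Optimal : ∀ {m n} → (Fin m → Fin n) → (Fin m → Fin n) → (Fin n → Bool) → (Fin m → ℤ) →
    (Fin m → ℤ) → Fin m → ℤ → Set
  Optimal p q A W c f b =
    (∃ λ M → Perfect p q A W M × M f ≡ true × c · (⟦_⟧ ∘ M) ≡ b) ×
    (∀ M → Perfect p q A W M → M f ≡ true → c · (⟦_⟧ ∘ M) ≤ b)

  optimum : ∀ {m n} {p q : Fin m → Fin n} {A W} c f →
    (∃ λ M → Perfect p q A W M × M f ≡ true) → ∃ λ b → Optimal p q A W c f b
  optimum {m} {p = p} {q} {A} {W} c f (M₀ , PM₀ , M₀f)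
    with least (subsets m) {λ X → Perfect p q A W (lookup X) × lookup X f ≡ true}
      (λ X → Perfect? (lookup X) ×-dec (lookup X f Bool.≟ true))
      (λ X Y → c · (⟦_⟧ ∘ lookup Y) ≤ c · (⟦_⟧ ∘ lookup X))
      (λ X Y _ _ → ≤-total (c · (⟦_⟧ ∘ lookup Y)) (c · (⟦_⟧ ∘ lookup X)))
      (λ X Y Z _ _ _ Y≤X Z≤Y → ≤-trans Z≤Y Y≤X)
  ... | inj₁ none = contradiction
    (Perfect-resp (sym ∘ lookup∘tabulate M₀) PM₀ , trans (lookup∘tabulate M₀ f) M₀f)
    (none (tabulate M₀) (∈-subsets _))
  ... | inj₂ (X , (PX , Xf) , max) = c · (⟦_⟧ ∘ lookup X) , (lookup X , PX , Xf , refl) , λ M PM Mf →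
    subst (_≤ c · (⟦_⟧ ∘ lookup X)) (·-congʳ c λ e → cong ⟦_⟧ (lookup∘tabulate M e))
      (max (tabulate M) (∈-subsets _)
        (Perfect-resp (sym ∘ lookup∘tabulate M) PM , trans (lookup∘tabulate M f) Mf))

  -- The two contractions are solved separately.  The price b f of a cut edge f is the best value that
  -- a perfect matching through f attains on the side outside S; it is charged to the side inside S.
  module Gluing {m n} {p q : Fin m → Fin n} {A W Q} (F : Fractional p q A W Q) (0<Q : 0ℤ < Q)
    (S : Fin n → Bool) (s t : Fin n) (s∉S : S s ≡ false) (t∈S : S t ≡ true)
    (S-odd : parity S A ≡ true) (S-tight : W · χ p q S ≡ Q) where

    module C₁ = Contraction F 0<Q S s s∉S S-odd S-tight
    module C₂ = Contraction F 0<Q (not ∘ S) t (cong not t∈S) C₁.outside-odd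
      (trans (·-congʳ W (χ-not S)) S-tight)

    module _ (good₁ : Good C₁.p′ C₁.q′ C₁.A′ C₁.W′ Q) (good₂ : Good C₂.p′ C₂.q′ C₂.A′ C₂.W′ Q)
      (c : Fin m → ℤ) where

      Perfect₁ = Perfect C₁.p′ C₁.q′ C₁.A′ C₁.W′
      Perfect₂ = Perfect C₂.p′ C₂.q′ C₂.A′ C₂.W′

      -- Cut edges survive in both contractions; their own cost is kept on the inner side only, so
      -- that it is counted once.
      cᵢ cₒ : Fin m → ℤ
      cᵢ e = if C₁.meets e then c e else 0ℤ
      cₒ e = if C₁.meets e then 0ℤ else c e

      cut⇒meets : ∀ {e} → cut p q S e ≡ true → C₂.meets e ≡ true
      cut⇒meets {e} _ with S (p e) | S (q e)
      ... | true | false = refl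
      ... | false | true = refl

      -- With the indicator of `f` as objective the average is W f > 0, while a matching that misses
      -- `f` has value 0.
      through : ∀ f → cut p q S f ≡ true → W f ≢ 0ℤ → ∃ λ M → Perfect₂ M × M f ≡ true
      through f f∈ Wf≢0 with good₂ (⟦_⟧ ∘ is f)
      ... | M , PM , bound with M f in Mf
      ...   | true = M , PM , Mf
      ...   | false = contradiction (subst₂ _≤_ lhs rhs bound) (<⇒≱ (≢0∧≥0⇒>0 (Fractional.nonneg F f) Wf≢0))
        where
        lhs : (⟦_⟧ ∘ is f) · C₂.W′ ≡ W f
        lhs = trans (·-comm _ C₂.W′) (trans (·-at C₂.W′ f) (cong (λ b → if b then W f else 0ℤ) (cut⇒meets f∈)))
        rhs : Q * (⟦_⟧ ∘ is f) · (⟦_⟧ ∘ M) ≡ 0ℤ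
        rhs = trans (cong (Q *_) (trans (·-comm _ (⟦_⟧ ∘ M)) (trans (·-at (⟦_⟧ ∘ M) f) (cong ⟦_⟧ Mf)))) (*-zeroʳ Q)

      opaque
        price : ∀ f → ∃ λ b → cut p q S f ≡ true → W f ≢ 0ℤ → Optimal C₂.p′ C₂.q′ C₂.A′ C₂.W′ cₒ f b
        price f with (cut p q S f Bool.≟ true) ×-dec ¬? (W f ≟ᶻ 0ℤ)
        ... | yes (f∈ , Wf≢0) with optimum cₒ f (through f f∈ Wf≢0)
        ...   | b , opt = b , λ _ _ → opt
        -- A default without effect: off the cut `bχ` vanishes anyway, and an edge of weight zero
        -- lies in no matching considered.
        price f | no ∄ = 0ℤ , λ f∈ Wf≢0 → contradiction (f∈ , Wf≢0) ∄

      b : Fin m → ℤ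
      b f = proj₁ (price f)

      bχ : Fin m → ℤ
      bχ e = b e * χ p q S e

      cut-edge : ∀ {M} → card (λ e → M e ∧ cut p q S e) ≡ 1ℤ →
        ∃ λ f → M f ≡ true × cut p q S f ≡ true × bχ · (⟦_⟧ ∘ M) ≡ b f ×
          (∀ {e} → M e ≡ true → cut p q S e ≡ true → e ≡ f)
      cut-edge {M} c≡1 with card-pick (λ e → M e ∧ cut p q S e) (subst (0ℤ <_) (sym c≡1) (+<+ (s≤s z≤n)))
      ... | f , both with ∧-true {M f} both
      ...   | Mf , f∈ = f , Mf , f∈ , value , λ Me e∈ → unique (cong₂ _∧_ Me e∈) (cong₂ _∧_ Mf f∈)
        where
        unique : ∀ {i j} → M i ∧ cut p q S i ≡ true → M j ∧ cut p q S j ≡ true → i ≡ j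
        unique = card≡1⇒unique _ c≡1
        term : ∀ e → bχ e * ⟦ M e ⟧ ≡ b e * ⟦ is f e ⟧
        term e with f ≟ᶠ e
        ... | yes refl = trans (cong₂ (λ x y → b f * ⟦ x ⟧ * ⟦ y ⟧) f∈ Mf) (*-identityʳ (b f * 1ℤ))
        ... | no f≢e = trans (vanish (b e) (M e) (cut p q S e)
                (≢true⇒false λ eq → f≢e (unique (cong₂ _∧_ Mf f∈) eq))) (sym (*-zeroʳ (b e)))
          where
          vanish : ∀ b x y → x ∧ y ≡ false → b * ⟦ y ⟧ * ⟦ x ⟧ ≡ 0ℤ
          vanish b false y _ = *-zeroʳ (b * ⟦ y ⟧)
          vanish b true false _ = trans (*-identityʳ (b * 0ℤ)) (*-zeroʳ b)
        value : bχ · (⟦_⟧ ∘ M) ≡ b f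
        value = trans (·-cong term) (·-at b f)

      -- cₒ − bχ is nonpositive on every perfect matching of the second side.
      prices-cover : cₒ · W ≤ bχ · W
      prices-cover with good₂ (λ e → 1ℤ * cₒ e + - 1ℤ * bχ e)
      ... | M , PM , bound with cut-edge {M} (trans (sum-cong-≗ λ e → cong (λ x → ⟦ M e ∧ x ⟧) (sym (cut-not {p = p} {q} S e))) (C₂.cut-one PM))
      ...   | f , Mf , f∈ , value , _ = ≤-by (0≤+ (0≤* (<⇒≤ 0<Q) (0≤- best)) (0≤- bound′))
              (combine (bχ · W) (cₒ · W) Q (cₒ · (⟦_⟧ ∘ M)) (b f))
        where
        best : cₒ · (⟦_⟧ ∘ M) ≤ b f
        best = proj₂ (proj₂ (price f) f∈ (C₂.W′≢0 (Perfect.support PM f Mf))) M PM Mf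
        weight : ∀ e → (1ℤ * cₒ e + - 1ℤ * bχ e) * C₂.W′ e ≡ (1ℤ * cₒ e + - 1ℤ * bχ e) * W e
        weight e with S (p e) | S (q e)
        ... | true | true = trans (cong (_* 0ℤ) (z (b e))) (sym (cong (_* W e) (z (b e))))
          where
          z : ∀ b → 1ℤ * 0ℤ + - 1ℤ * (b * 0ℤ) ≡ 0ℤ
          z = solve-∀
        ... | true | false = refl
        ... | false | _ = refl
        bound′ : 1ℤ * cₒ · W + - 1ℤ * bχ · W ≤ Q * (1ℤ * cₒ · (⟦_⟧ ∘ M) + - 1ℤ * b f)
        bound′ = subst₂ _≤_ (trans (·-cong weight) (·-comb 1ℤ (- 1ℤ) cₒ bχ W))
          (cong (Q *_) (trans (·-comb 1ℤ (- 1ℤ) cₒ bχ (⟦_⟧ ∘ M))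
            (cong (λ x → 1ℤ * cₒ · (⟦_⟧ ∘ M) + - 1ℤ * x) value))) bound
        combine : ∀ x y Q u v → x - y ≡ Q * (v - u) + (Q * (1ℤ * u + - 1ℤ * v) - (1ℤ * y + - 1ℤ * x))
        combine = solve-∀

      -- The inner matching for `cᵢ` plus prices contains a single cut edge `f` and earns `b f` for
      -- it. An optimal outer matching through `f` earns exactly that much on the outer edges. Both
      -- meet the cut in `f` alone, so their union is perfect, and `prices-cover` bounds the outer
      -- part of `c · W` by the priced weight.
      glue : ∃ λ M → Perfect p q A W M × c · W ≤ Q * c · (⟦_⟧ ∘ M)
      glue with good₁ (λ e → cᵢ e + bχ e)
      ... | M₁ , PM₁ , bound₁ with cut-edge {M₁} (C₁.cut-one PM₁)
      ...   | f , M₁f , f∈ , value , only with proj₁ (proj₂ (price f) f∈ (C₁.W′≢0 (Perfect.support PM₁ f M₁f)))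
      ...     | M₂ , PM₂ , M₂f , optimal = M , PM , bound
        where
        M : Fin m → Bool
        M e = M₁ e ∨ M₂ e
        only₂ : ∀ {e} → M₂ e ≡ true → cut p q S e ≡ true → e ≡ f
        only₂ {e} M₂e e∈ = card≡1⇒unique _ (C₂.cut-one PM₂)
          (cong₂ _∧_ M₂e (trans (cut-not {p = p} {q} S e) e∈))
          (cong₂ _∧_ M₂f (trans (cut-not {p = p} {q} S f) f∈))
        cut-if : ∀ e → C₁.meets e ≡ true → C₂.meets e ≡ true → cut p q S e ≡ true
        cut-if e _ _ with S (p e) | S (q e)
        ... | true | false = refl
        ... | false | true = refl
        inside : ∀ e → C₁.meets e ≡ true → M e ≡ M₁ e
        inside e meets with M₁ e in M₁e | M₂ e in M₂e
        ... | true | _ = refl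
        ... | false | false = refl
        ... | false | true with only₂ M₂e (cut-if e meets (C₂.meets-support PM₂ M₂e))
        ...   | refl = contradiction M₁f λ eq → true≢false eq M₁e
        outside : ∀ e → C₂.meets e ≡ true → M e ≡ M₂ e
        outside e meets with M₁ e in M₁e | M₂ e in M₂e
        ... | false | _ = refl
        ... | true | true = refl
        ... | true | false with only M₁e (cut-if e (C₁.meets-support PM₁ M₁e) meets)
        ...   | refl = contradiction M₂f λ eq → true≢false eq M₂e
        degree : ∀ v → (⟦_⟧ ∘ M) · χ p q (is v) ≡ ⟦ A v ⟧
        degree v with S v in Sv
        ... | true = C₁.inside-degree PM₁ inside v Sv
        ... | false = C₂.inside-degree PM₂ outside v (cong not Sv)
        support : ∀ e → M e ≡ true → W e ≢ 0ℤ
        support e Me with M₁ e in M₁e | M₂ e in M₂e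
        ... | true | _ = C₁.W′≢0 (Perfect.support PM₁ e M₁e)
        ... | false | true = C₂.W′≢0 (Perfect.support PM₂ e M₂e)
        PM : Perfect p q A W M
        PM = record { degree = degree ; support = support }
        split : ∀ g → c · g ≡ cᵢ · g + cₒ · g
        split g = trans (·-congˡ g term) (·-+ˡ cᵢ cₒ g)
          where
          term : ∀ e → c e ≡ cᵢ e + cₒ e
          term e with C₁.meets e
          ... | true = sym (+-identityʳ _)
          ... | false = sym (+-identityˡ _)
        value-M : c · (⟦_⟧ ∘ M) ≡ cᵢ · (⟦_⟧ ∘ M₁) + cₒ · (⟦_⟧ ∘ M₂)
        value-M = trans (split (⟦_⟧ ∘ M)) (cong₂ _+_ (·-cong termᵢ) (·-cong termₒ))
          where
          termᵢ : ∀ e → cᵢ e * ⟦ M e ⟧ ≡ cᵢ e * ⟦ M₁ e ⟧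
          termᵢ e with C₁.meets e in meets
          ... | true = cong (λ x → c e * ⟦ x ⟧) (inside e meets)
          ... | false = trans (*-zeroˡ ⟦ M e ⟧) (sym (*-zeroˡ ⟦ M₁ e ⟧))
          termₒ : ∀ e → cₒ e * ⟦ M e ⟧ ≡ cₒ e * ⟦ M₂ e ⟧
          termₒ e with C₁.meets e in meets
          ... | true = trans (*-zeroˡ ⟦ M e ⟧) (sym (*-zeroˡ ⟦ M₂ e ⟧))
          ... | false with M₁ e in M₁e
          ...   | false = refl
          ...   | true = contradiction (C₁.meets-support PM₁ M₁e) λ eq → true≢false eq meets
        weight : ∀ e → (cᵢ e + bχ e) * C₁.W′ e ≡ (cᵢ e + bχ e) * W e
        weight e with S (p e) | S (q e)
        ... | true | _ = refl
        ... | false | true = refl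
        ... | false | false = trans (cong (_* 0ℤ) (z (b e))) (sym (cong (_* W e) (z (b e))))
          where
          z : ∀ b → 0ℤ + b * 0ℤ ≡ 0ℤ
          z = solve-∀
        bound₁′ : cᵢ · W + bχ · W ≤ Q * (cᵢ · (⟦_⟧ ∘ M₁) + cₒ · (⟦_⟧ ∘ M₂))
        bound₁′ = subst₂ _≤_ (trans (·-cong weight) (·-+ˡ cᵢ bχ W))
          (cong (Q *_) (trans (·-+ˡ cᵢ bχ (⟦_⟧ ∘ M₁))
            (cong (λ x → cᵢ · (⟦_⟧ ∘ M₁) + x) (trans value (sym optimal))))) bound₁
        bound : c · W ≤ Q * c · (⟦_⟧ ∘ M)
        bound = subst₂ _≤_ (sym (split W)) (cong (Q *_) (sym value-M))
          (≤-trans (ℤ.+-monoʳ-≤ (cᵢ · W) prices-cover) bound₁′)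

  -- Nontrivial odd sets and the support of the weights

  module _ {n} (A : Fin n → Bool) where

    inside outside : (Fin n → Bool) → ℤ
    inside X = card λ v → X v ∧ A v
    outside X = card λ v → not (X v) ∧ A v

    card-split : ∀ X → card A ≡ inside X + outside X
    card-split X = trans (sum-cong-≗ λ v → term (X v) (A v)) (∑-distrib-+ (λ v → ⟦ X v ∧ A v ⟧) (λ v → ⟦ not (X v) ∧ A v ⟧))
      where
      term : ∀ x a → ⟦ a ⟧ ≡ ⟦ x ∧ a ⟧ + ⟦ not x ∧ a ⟧
      term true a = sym (+-identityʳ ⟦ a ⟧)
      term false a = sym (+-identityˡ ⟦ a ⟧)

    Nontrivial : (Fin n → Bool) → Set
    Nontrivial X = 1ℤ < inside X × 1ℤ < outside X

    Nontrivial? : ∀ X → Dec (Nontrivial X)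
    Nontrivial? X = (1ℤ <? inside X) ×-dec (1ℤ <? outside X)

    inside-cong : ∀ {X Y} → X ≗ Y → inside X ≡ inside Y
    inside-cong X≗Y = sum-cong-≗ λ v → cong (λ x → ⟦ x ∧ A v ⟧) (X≗Y v)

    outside-cong : ∀ {X Y} → X ≗ Y → outside X ≡ outside Y
    outside-cong X≗Y = sum-cong-≗ λ v → cong (λ x → ⟦ not x ∧ A v ⟧) (X≗Y v)

    Nontrivial-resp : ∀ {X Y} → X ≗ Y → Nontrivial X → Nontrivial Y
    Nontrivial-resp eq (in>1 , out>1) =
      subst (1ℤ <_) (inside-cong eq) in>1 , subst (1ℤ <_) (outside-cong eq) out>1

    parity-resp : ∀ {X Y} → X ≗ Y → parity X A ≡ parity Y A
    parity-resp X≗Y = par-cong λ v → cong (_∧ A v) (X≗Y v)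

    singleton : ∀ X → parity X A ≡ true → ¬ 1ℤ < inside X → ∃ λ v → A v ≡ true × ∀ u → A u ≡ true → X u ≡ is v u
    singleton X odd ≯1 with ≤-antisym (≮⇒≥ ≯1) (par⇒card≥1 (λ v → X v ∧ A v) odd)
    ... | one with card-pick (λ v → X v ∧ A v) (subst (0ℤ <_) (sym one) (+<+ (s≤s z≤n)))
    ... | v , XAv with ∧-true {X v} XAv
    ... | Xv , Av = v , Av , only
      where
      only : ∀ u → A u ≡ true → X u ≡ is v u
      only u Au with v ≟ᶠ u
      ... | yes refl = Xv
      ... | no v≢u = ≢true⇒false λ Xu → v≢u (card≡1⇒unique (λ v → X v ∧ A v) one XAv (cong₂ _∧_ Xu Au))

  module Support {m n} {p q : Fin m → Fin n} {A W Q} (F : Fractional p q A W Q) (0<Q : 0ℤ < Q) where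

    open Fractional F

    active : ∀ {v e} → W e ≢ 0ℤ → cut p q (is v) e ≡ true → A v ≡ true
    active {v} {e} We≢0 v∈e with A v in Av
    ... | true = refl
    ... | false = contradiction (sum-zero⁻¹ (λ f → 0≤* (nonneg f) 0≤⟦ cut p q (is v) f ⟧)
            (trans (sym (·-unfold W (χ p q (is v)))) (trans (degree v) (trans (cong (λ b → Q * ⟦ b ⟧) Av) (*-zeroʳ Q)))) e)
          (λ eq → We≢0 (trans (sym (trans (cong (λ b → W e * ⟦ b ⟧) v∈e) (*-identityʳ (W e)))) eq))

    active-degree : ∀ {v} → A v ≡ true → W · χ p q (is v) ≡ Q
    active-degree {v} Av = trans (degree v) (trans (cong (λ b → Q * ⟦ b ⟧) Av) (*-identityʳ Q))

    ends≢ : ∀ {e} → W e ≢ 0ℤ → p e ≢ q e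
    ends≢ We≢0 pe≡qe = We≢0 (loop _ pe≡qe)

    cut-p : ∀ {e} → W e ≢ 0ℤ → cut p q (is (p e)) e ≡ true
    cut-p {e} We≢0 rewrite is-refl (p e) | is-≢ (ends≢ We≢0) = refl

    cut-q : ∀ {e} → W e ≢ 0ℤ → cut p q (is (q e)) e ≡ true
    cut-q {e} We≢0 rewrite is-refl (q e) | is-≢ (ends≢ We≢0 ∘ sym) = refl

    active-p : ∀ {e} → W e ≢ 0ℤ → A (p e) ≡ true
    active-p We≢0 = active We≢0 (cut-p We≢0)

    active-q : ∀ {e} → W e ≢ 0ℤ → A (q e) ≡ true
    active-q We≢0 = active We≢0 (cut-q We≢0)

    -- One of `X` and its complement has a single active vertex `v`. Edges of the support have both
    -- ends active, so on the support the cut is the star of `v`.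
    trivial-cut : ∀ X → parity X A ≡ true → ¬ Nontrivial A X →
      ∃ λ v → A v ≡ true × ∀ e → W e ≢ 0ℤ → χ p q X e ≡ χ p q (is v) e
    trivial-cut X odd trivial with 1ℤ <? inside A X
    ... | no ≯1 with singleton A X odd ≯1
    ...   | v , Av , only = v , Av , λ e We≢0 →
            cong₂ (λ a b → ⟦ a xor b ⟧) (only (p e) (active-p We≢0)) (only (q e) (active-q We≢0))
    trivial-cut X odd trivial | yes >1 with singleton A (not ∘ X) (complement-odd F 0<Q odd) (λ out>1 → trivial (>1 , out>1))
    ...   | v , Av , only = v , Av , λ e We≢0 → trans (sym (χ-not {p = p} {q} X e))
            (cong₂ (λ a b → ⟦ a xor b ⟧) (only (p e) (active-p We≢0)) (only (q e) (active-q We≢0)))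

  -- The ratio test

  -- Moving from W in the direction y until an edge of the support vanishes or a nontrivial odd cut
  -- becomes tight: a ratio test, with the ratio kept as numerator b and denominator a.
  module Perturbation {m n} {p q : Fin m → Fin n} {A W Q} (F : Fractional p q A W Q) (0<Q : 0ℤ < Q)
    (slack : ∀ X → Nontrivial A X → parity X A ≡ true → Q < W · χ p q X)
    (y : Fin m → ℤ) (y-support : ∀ e → W e ≡ 0ℤ → y e ≡ 0ℤ) (y-balanced : ∀ v → y · χ p q (is v) ≡ 0ℤ)
    (e₀ : Fin m) (ye₀<0 : y e₀ < 0ℤ) where

    open Fractional F
    open Support F 0<Q

    Constraint : Set
    Constraint = Fin m ⊎ Vec Bool n

    gap slope : Constraint → ℤ
    gap (inj₁ e) = W e
    gap (inj₂ X) = W · χ p q (lookup X) - Q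
    slope (inj₁ e) = y e
    slope (inj₂ X) = y · χ p q (lookup X)

    -- Only strictly slack constraints enter the ratio test. Edges outside the support do not move,
    -- as `y` vanishes there, and trivial odd cuts keep equality, being stars on the support, where
    -- `y` has degree zero.
    Valid : Constraint → Set
    Valid (inj₁ e) = W e ≢ 0ℤ
    Valid (inj₂ X) = Nontrivial A (lookup X) × parity (lookup X) A ≡ true

    Valid? : ∀ x → Dec (Valid x)
    Valid? (inj₁ e) = ¬? (W e ≟ᶻ 0ℤ)
    Valid? (inj₂ X) = Nontrivial? A (lookup X) ×-dec (parity (lookup X) A Bool.≟ true)

    gap>0 : ∀ x → Valid x → 0ℤ < gap x
    gap>0 (inj₁ e) We≢0 = ≢0∧≥0⇒>0 (nonneg e) We≢0
    gap>0 (inj₂ X) (nt , odd) = 0<- (slack (lookup X) nt odd)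

    constraints : List Constraint
    constraints = map inj₁ (allFin m) ++ map inj₂ (subsets n)

    ∈-constraints : ∀ x → x ∈ constraints
    ∈-constraints (inj₁ e) = ∈-++⁺ˡ (∈-map⁺ inj₁ (∈-allFin e))
    ∈-constraints (inj₂ X) = ∈-++⁺ʳ _ (∈-map⁺ inj₂ (∈-subsets X))

    Blocking : Constraint → Set
    Blocking x = Valid x × slope x < 0ℤ

    -- The comparison gap x / (- slope x) ≤ gap z / (- slope z), with denominators cleared; for
    -- blocking constraints these are positive.
    _≼_ : Constraint → Constraint → Set
    x ≼ z = gap x * - slope z ≤ gap z * - slope x

    ≼-trans : ∀ x z w → Blocking x → Blocking z → Blocking w → x ≼ z → z ≼ w → x ≼ w
    ≼-trans x z w (vx , sx) (vz , sz) (vw , sw) x≼z z≼w = *-cancelˡ (0<-neg sz)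
      (≤-by (0≤+ (0≤* (<⇒≤ (0<-neg sw)) (0≤- x≼z)) (0≤* (<⇒≤ (0<-neg sx)) (0≤- z≼w)))
        (combine (gap x) (gap z) (gap w) (- slope x) (- slope z) (- slope w)))
      where
      combine : ∀ gx gz gw bx bz bw →
        bz * (gw * bx) - bz * (gx * bw) ≡ bw * (gz * bx - gx * bz) + bx * (gw * bz - gz * bw)
      combine = solve-∀

    blocking : ∃ λ x → Blocking x × ∀ z → z ∈ constraints → Blocking z → x ≼ z
    blocking with least constraints (λ x → Valid? x ×-dec (slope x <? 0ℤ)) _≼_
                    (λ x z _ _ → ≤-total (gap x * - slope z) (gap z * - slope x)) ≼-trans
    ... | inj₂ found = found
    ... | inj₁ none = contradiction ((λ We≡0 → <-irrefl (y-support e₀ We≡0) ye₀<0) , ye₀<0)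
                        (none (inj₁ e₀) (∈-constraints _))

    x₀ : Constraint
    x₀ = proj₁ blocking

    a b : ℤ
    a = - slope x₀
    b = gap x₀

    0<a : 0ℤ < a
    0<a = 0<-neg (proj₂ (proj₁ (proj₂ blocking)))

    0<b : 0ℤ < b
    0<b = gap>0 x₀ (proj₁ (proj₁ (proj₂ blocking)))

    W′ : Fin m → ℤ
    W′ e = a * W e + b * y e

    new-gap : ∀ z → Valid z → 0ℤ ≤ a * gap z + b * slope z
    new-gap z vz with slope z <? 0ℤ
    ... | no ≮0 = 0≤+ (0≤* (<⇒≤ 0<a) (<⇒≤ (gap>0 z vz))) (0≤* (<⇒≤ 0<b) (≮⇒≥ ≮0))
    ... | yes sz = subst (0ℤ ≤_) (rearrange a (gap z) b (slope z))
            (0≤- (proj₂ (proj₂ blocking) z (∈-constraints z) (vz , sz)))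
      where
      rearrange : ∀ a g b s → g * a - b * - s ≡ a * g + b * s
      rearrange = solve-∀

    new-gap-x₀ : a * gap x₀ + b * slope x₀ ≡ 0ℤ
    new-gap-x₀ = cancel (slope x₀) (gap x₀)
      where
      cancel : ∀ s g → - s * g + g * s ≡ 0ℤ
      cancel = solve-∀

    W′-zero : ∀ {e} → W e ≡ 0ℤ → W′ e ≡ 0ℤ
    W′-zero {e} We≡0 = trans (cong₂ (λ w z → a * w + b * z) We≡0 (y-support e We≡0)) (zero-comb a b)
      where
      zero-comb : ∀ a b → a * 0ℤ + b * 0ℤ ≡ 0ℤ
      zero-comb = solve-∀

    W′-χ : ∀ X → W′ · χ p q X ≡ a * W · χ p q X + b * y · χ p q X
    W′-χ X = ·-comb a b W y (χ p q X)

    W′-gap : ∀ X → a * (W · χ p q X - Q) + b * y · χ p q X ≡ W′ · χ p q X - a * Q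
    W′-gap X = trans (expand a (W · χ p q X) Q (b * y · χ p q X)) (cong (_- a * Q) (sym (W′-χ X)))
      where
      expand : ∀ a w Q x → a * (w - Q) + x ≡ a * w + x - a * Q
      expand = solve-∀

    W′-degree : ∀ v → W′ · χ p q (is v) ≡ a * Q * ⟦ A v ⟧
    W′-degree v = trans (W′-χ (is v)) (trans (cong₂ (λ w z → a * w + b * z) (degree v) (y-balanced v))
      (simplify a Q ⟦ A v ⟧ b))
      where
      simplify : ∀ a Q x b → a * (Q * x) + b * 0ℤ ≡ a * Q * x
      simplify = solve-∀

    perturbed : Fractional p q A W′ (a * Q)
    perturbed = record
      { nonneg = nonneg′ ; degree = W′-degree ; loop = λ e eq → W′-zero (loop e eq) ; odd-cut = odd-cut′ }
      where
      nonneg′ : ∀ e → 0ℤ ≤ W′ e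
      nonneg′ e with W e ≟ᶻ 0ℤ
      ... | yes We≡0 = ≤-reflexive (sym (W′-zero We≡0))
      ... | no We≢0 = new-gap (inj₁ e) We≢0
      odd-cut′ : ∀ X → parity X A ≡ true → a * Q ≤ W′ · χ p q X
      odd-cut′ X odd with Nontrivial? A X
      ... | yes nt = subst (a * Q ≤_) (·-congʳ W′ (χ-cong (lookup∘tabulate X)))
              (0≤i-j⇒j≤i (subst (0ℤ ≤_) (W′-gap (lookup (tabulate X)))
                (new-gap (inj₂ (tabulate X))
                  ( Nontrivial-resp A (sym ∘ lookup∘tabulate X) nt
                  , trans (parity-resp A (lookup∘tabulate X)) odd))))
      ... | no trivial with trivial-cut X odd trivial
      ...   | v , Av , same = ≤-reflexive (sym (trans (·-cong term)
                (trans (W′-degree v) (trans (cong (λ b → a * Q * ⟦ b ⟧) Av) (*-identityʳ (a * Q))))))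
        where
        term : ∀ e → W′ e * χ p q X e ≡ W′ e * χ p q (is v) e
        term e with W e ≟ᶻ 0ℤ
        ... | no We≢0 = cong (W′ e *_) (same e We≢0)
        ... | yes We≡0 = trans (cong (_* χ p q X e) (W′-zero We≡0)) (cong (_* χ p q (is v) e) (sym (W′-zero We≡0)))

    Progress : Set
    Progress = (∃ λ e → W e ≢ 0ℤ × W′ e ≡ 0ℤ) ⊎
      (∃ λ X → Nontrivial A X × parity X A ≡ true × W′ · χ p q X ≡ a * Q)

    progress : Progress
    progress = go x₀ (proj₁ (proj₁ (proj₂ blocking))) new-gap-x₀
      where
      go : ∀ x → Valid x → a * gap x + b * slope x ≡ 0ℤ → Progress
      go (inj₁ e) We≢0 eq = inj₁ (e , We≢0 , eq)
      go (inj₂ X) (nt , odd) eq = inj₂ (lookup X , nt , odd ,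
        ℤ.i-j≡0⇒i≡j _ _ (trans (sym (W′-gap (lookup X))) eq))

    -- With `c · y` nonnegative the average does not drop along the step, and edges of weight zero
    -- stay at zero, so a matching that serves `W′` also serves `W` after cancelling `a`.
    good : ∀ c → 0ℤ ≤ c · y → (∃ λ M → Perfect p q A W′ M × c · W′ ≤ a * Q * c · (⟦_⟧ ∘ M)) →
      ∃ λ M → Perfect p q A W M × c · W ≤ Q * c · (⟦_⟧ ∘ M)
    good c 0≤c·y (M , PM , bound) = M , record
      { degree = Perfect.degree PM ; support = λ e Me We≡0 → Perfect.support PM e Me (W′-zero We≡0) } ,
      *-cancelˡ 0<a (≤-trans
        (≤-by (0≤* (<⇒≤ 0<b) 0≤c·y) (trans (cong (_- a * c · W) c·W′) (cancel (a * c · W) (b * c · y))))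
        (≤-trans bound (≤-reflexive (*-assoc a Q _))))
      where
      c·W′ : c · W′ ≡ a * c · W + b * c · y
      c·W′ = trans (·-comm c W′) (trans (·-comb a b W y c)
        (cong₂ (λ w z → a * w + b * z) (·-comm W c) (·-comm y c)))
      cancel : ∀ x z → x + z - x ≡ z
      cancel = solve-∀

  -- Directions of zero degree

  supp : ∀ {m} → (Fin m → ℤ) → Fin m → Bool
  supp W e = not ⌊ W e ≟ᶻ 0ℤ ⌋

  supp⇒≢0 : ∀ {m} {W : Fin m → ℤ} {e} → supp W e ≡ true → W e ≢ 0ℤ
  supp⇒≢0 {W = W} {e} eq with W e ≟ᶻ 0ℤ
  supp⇒≢0 () | yes _
  ... | no We≢0 = We≢0

  ≢0⇒supp : ∀ {m} {W : Fin m → ℤ} {e} → W e ≢ 0ℤ → supp W e ≡ true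
  ≢0⇒supp {W = W} {e} We≢0 with W e ≟ᶻ 0ℤ
  ... | yes We≡0 = contradiction We≡0 We≢0
  ... | no _ = refl

  card-is′ : ∀ {n} (i : Fin n) → sum (λ j → ⟦ is j i ⟧) ≡ 1ℤ
  card-is′ i = trans (sum-at _ i λ j j≢i → cong ⟦_⟧ (is-≢ j≢i)) (cong ⟦_⟧ (is-refl i))

  ∃-positive : ∀ {n} (f : Fin n → ℤ) → 0ℤ < sum f → ∃ λ i → 0ℤ < f i
  ∃-positive {n} f 0<∑ with any? (λ i → 0ℤ <? f i)
  ... | yes found = found
  ... | no none = contradiction 0<∑ (ℤ.≤⇒≯ (≤-trans (sum-mono {g = λ _ → 0ℤ} λ i → ≮⇒≥ λ 0<fi → none (i , 0<fi))
                    (≤-reflexive (sum-zero {n} (λ _ → 0ℤ) λ _ → refl))))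

  module Directions {m n} {p q : Fin m → Fin n} {A W Q} (F : Fractional p q A W Q) (0<Q : 0ℤ < Q) where

    open Fractional F
    open Support F 0<Q

    -- An edge is counted twice only if its ends differ; a loop would count 0. Hence `g` is confined
    -- to the support of `W`, which is free of loops.
    handshake : ∀ g → (∀ e → g e ≢ 0ℤ → W e ≢ 0ℤ) → sum (λ v → g · χ p q (is v)) ≡ + 2 * sum g
    handshake g g⊆W = begin
      sum (λ v → g · χ p q (is v))                     ≡⟨ sum-cong-≗ (λ v → ·-unfold g (χ p q (is v))) ⟩
      sum (λ v → sum λ e → g e * χ p q (is v) e)       ≡⟨ ∑-comm (λ v e → g e * χ p q (is v) e) ⟩
      sum (λ e → sum λ v → g e * χ p q (is v) e)       ≡⟨ sum-cong-≗ term ⟩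
      sum (λ e → + 2 * g e)                            ≡⟨ sym (*-distribˡ-sum (+ 2) g) ⟩
      + 2 * sum g ∎
      where
      open ≡-Reasoning
      disjoint : ∀ {i j : Fin n} → i ≢ j → ∀ v → ⟦ is v i xor is v j ⟧ ≡ ⟦ is v i ⟧ + ⟦ is v j ⟧
      disjoint {i} {j} i≢j v with v ≟ᶠ i | v ≟ᶠ j
      ... | yes refl | yes refl = contradiction refl i≢j
      ... | yes _ | no _ = refl
      ... | no _ | yes _ = refl
      ... | no _ | no _ = refl
      term : ∀ e → sum (λ v → g e * χ p q (is v) e) ≡ + 2 * g e
      term e with g e ≟ᶻ 0ℤ
      ... | yes ge≡0 = trans (sum-zero _ λ v → trans (cong (_* χ p q (is v) e) ge≡0) (*-zeroˡ (χ p q (is v) e)))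
                         (sym (trans (cong (λ x → + 2 * x) ge≡0) (*-zeroʳ (+ 2))))
      ... | no ge≢0 = trans (sym (*-distribˡ-sum (g e) (λ v → χ p q (is v) e)))
        (trans (cong (g e *_) (trans (sum-cong-≗ (disjoint (ends≢ (g⊆W e ge≢0))))
          (trans (∑-distrib-+ (λ v → ⟦ is v (p e) ⟧) (λ v → ⟦ is v (q e) ⟧))
            (cong₂ _+_ (card-is′ (p e)) (card-is′ (q e)))))) (*-comm (g e) (+ 2)))

    total-weight : + 2 * sum W ≡ Q * card A
    total-weight = trans (sym (handshake W λ e We≢0 → We≢0))
      (trans (sum-cong-≗ degree) (sym (*-distribˡ-sum Q (⟦_⟧ ∘ A))))

    -- The deficits `⟦ A v ⟧ - deg v` are nonnegative and sum to zero by the handshake, so each of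
    -- them vanishes.
    perfect-by-counting : ∀ M → (∀ e → M e ≡ true → W e ≢ 0ℤ) →
      (∀ v → (⟦_⟧ ∘ M) · χ p q (is v) ≤ ⟦ A v ⟧) → + 2 * card M ≡ card A → Perfect p q A W M
    perfect-by-counting M M⊆W deg≤ count = record
      { degree = λ v → sym (ℤ.i-j≡0⇒i≡j _ _ (sum-zero⁻¹ (λ v → 0≤- (deg≤ v)) deficit v)) ; support = M⊆W }
      where
      deg : Fin n → ℤ
      deg v = (⟦_⟧ ∘ M) · χ p q (is v)
      sum-deg : sum deg ≡ card A
      sum-deg = trans (handshake (⟦_⟧ ∘ M) λ e Me≢0 → M⊆W e (true-if Me≢0)) count
        where
        true-if : ∀ {b} → ⟦ b ⟧ ≢ 0ℤ → b ≡ true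
        true-if {true} _ = refl
        true-if {false} 0≢0 = contradiction refl 0≢0
      cancel : ∀ x → x + - 1ℤ * x ≡ 0ℤ
      cancel = solve-∀
      minus : ∀ x y → x - y ≡ x + - 1ℤ * y
      minus = solve-∀
      deficit : sum (λ v → ⟦ A v ⟧ - deg v) ≡ 0ℤ
      deficit = trans (sum-cong-≗ λ v → minus ⟦ A v ⟧ (deg v)) (trans (∑-distrib-+ (⟦_⟧ ∘ A) (λ v → - 1ℤ * deg v))
        (trans (cong (λ x → card A + x) (trans (sym (*-distribˡ-sum (- 1ℤ) deg)) (cong (- 1ℤ *_) sum-deg)))
          (cancel (card A))))

    edge-at : ∀ {v} → A v ≡ true → ∃ λ e → W e ≢ 0ℤ × cut p q (is v) e ≡ true
    edge-at {v} Av with ∃-positive (λ e → W e * χ p q (is v) e) (subst (0ℤ <_)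
        (sym (trans (sym (·-unfold W (χ p q (is v)))) (active-degree Av))) 0<Q)
    ... | e , 0<We with cut p q (is v) e in v∈e
    ...   | true = e , (λ We≡0 → <⇒≢0 0<We (trans (cong (_* 1ℤ) We≡0) refl)) , v∈e
    ...   | false = contradiction (*-zeroʳ (W e)) (<⇒≢0 0<We)

    χ≤A : ∀ {e} → W e ≢ 0ℤ → ∀ v → χ p q (is v) e ≤ ⟦ A v ⟧
    χ≤A {e} We≢0 v with cut p q (is v) e in v∈e
    ... | false = 0≤⟦ A v ⟧
    ... | true = ≤-reflexive (cong ⟦_⟧ (sym (active {v} {e} We≢0 v∈e)))

    is·χ : ∀ e v → (⟦_⟧ ∘ is e) · χ p q (is v) ≡ χ p q (is v) e
    is·χ e v = trans (·-comm (⟦_⟧ ∘ is e) (χ p q (is v))) (·-at (χ p q (is v)) e)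

    perfect₀ : card A ≡ + 0 → Perfect p q A W (const false)
    perfect₀ cA = perfect-by-counting (const false) (λ _ ())
      (λ v → ≤-trans (≤-reflexive (·-zeroˡ (χ p q (is v)))) 0≤⟦ A v ⟧)
      (trans (cong (λ x → + 2 * x) (sum-zero {m} (λ _ → 0ℤ) λ _ → refl)) (sym cA))

    perfect₂ : card A ≡ + 2 → ∃ (Perfect p q A W)
    perfect₂ cA with card-pick A (subst (0ℤ <_) (sym cA) (+<+ (s≤s z≤n)))
    ... | a , Aa with edge-at Aa
    ... | e , We≢0 , _ = is e , perfect-by-counting (is e)
      (λ f f∈ → subst (λ f → W f ≢ 0ℤ) (is⇒≡ f∈) We≢0)
      (λ v → ≤-trans (≤-reflexive (is·χ e v)) (χ≤A We≢0 v))
      (trans (cong (λ x → + 2 * x) (card-is e)) (sym cA))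

    -- With four active vertices the total weight is 2Q, so W · (1 − χ (is a) − χ (is b)) vanishes for an
    -- edge e = ab; the summand of e is negative, hence some edge of the support misses both a and b.
    perfect₄ : card A ≡ + 4 → ∃ (Perfect p q A W)
    perfect₄ cA with card-pick A (subst (0ℤ <_) (sym cA) (+<+ (s≤s z≤n)))
    ... | v₀ , Av₀ with edge-at Av₀
    ... | e , We≢0 , _ = found (∃-pos f e fe<0 (≤-reflexive (sym sum-f)))
      where
      a b : Fin n
      a = p e
      b = q e
      coeff : Fin m → ℤ
      coeff e′ = 1ℤ + (- 1ℤ * χ p q (is a) e′ + - 1ℤ * χ p q (is b) e′)
      f : Fin m → ℤ
      f e′ = W e′ * coeff e′
      fe<0 : f e < 0ℤ
      fe<0 = subst (_< 0ℤ) (cong₂ (λ x y → W e * (1ℤ + (- 1ℤ * ⟦ x ⟧ + - 1ℤ * ⟦ y ⟧))) (sym (cut-p We≢0)) (sym (cut-q We≢0)))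
        (subst (_< 0ℤ) (flip (W e)) (ℤ.neg-mono-< (≢0∧≥0⇒>0 (nonneg e) We≢0)))
        where
        flip : ∀ w → - w ≡ w * - 1ℤ
        flip = solve-∀
      W·1 : W · (λ _ → 1ℤ) ≡ sum W
      W·1 = trans (·-unfold W (λ _ → 1ℤ)) (sum-cong-≗ λ e → *-identityʳ (W e))
      sum-W : sum W ≡ + 2 * Q
      sum-W = *-cancelˡ-≡ (+ 2) (sum W) (+ 2 * Q) (trans total-weight (trans (cong (Q *_) cA) (four Q)))
        where
        four : ∀ Q → Q * + 4 ≡ + 2 * (+ 2 * Q)
        four = solve-∀
      sum-f : sum f ≡ 0ℤ
      sum-f = trans (sym (·-unfold W coeff))
        (trans (·-+ʳ W (λ _ → 1ℤ) _)
        (trans (cong₂ _+_ (trans W·1 sum-W) (trans (·-+ʳ W (λ e → - 1ℤ * χ p q (is a) e) (λ e → - 1ℤ * χ p q (is b) e))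
          (cong₂ _+_ (trans (·-*ʳ (- 1ℤ) W (χ p q (is a))) (cong (- 1ℤ *_) (active-degree (active-p We≢0))))
                     (trans (·-*ʳ (- 1ℤ) W (χ p q (is b))) (cong (- 1ℤ *_) (active-degree (active-q We≢0)))))))
          (zero-sum Q)))
        where
        zero-sum : ∀ Q → + 2 * Q + (- 1ℤ * Q + - 1ℤ * Q) ≡ 0ℤ
        zero-sum = solve-∀
      misses : ∀ w x y → 0ℤ ≤ w → 0ℤ < w * (1ℤ + (- 1ℤ * ⟦ x ⟧ + - 1ℤ * ⟦ y ⟧)) → x ≡ false × y ≡ false × w ≢ 0ℤ
      misses w false false 0≤w 0<f = refl , refl , λ w≡0 → <⇒≢0 0<f (trans (cong (_* 1ℤ) w≡0) refl)
      misses w true false 0≤w 0<f = contradiction (*-zeroʳ w) (<⇒≢0 0<f)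
      misses w false true 0≤w 0<f = contradiction (*-zeroʳ w) (<⇒≢0 0<f)
      misses w true true 0≤w 0<f = contradiction 0≤w (<⇒≱ (*-neg w 0<f))
        where
        *-neg : ∀ w → 0ℤ < w * - 1ℤ → w < 0ℤ
        *-neg w lt = ≰⇒> λ 0≤w → <⇒≱ lt (subst (_≤ 0ℤ) (flip w) (ℤ.neg-mono-≤ 0≤w))
          where
          flip : ∀ w → - w ≡ w * - 1ℤ
          flip = solve-∀
      found : (∃ λ e′ → 0ℤ < f e′) → ∃ (Perfect p q A W)
      found (e′ , 0<f) with misses (W e′) (cut p q (is a) e′) (cut p q (is b) e′) (nonneg e′) 0<f
      ... | a∉ , b∉ , We′≢0 = M , perfect-by-counting M M⊆W deg≤ count
        where
        M : Fin m → Bool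
        M f = is e f ∨ is e′ f
        e≢e′ : e ≢ e′
        e≢e′ refl = true≢false (cut-p We≢0) a∉
        split : ∀ f → ⟦ M f ⟧ ≡ ⟦ is e f ⟧ + ⟦ is e′ f ⟧
        split f with e ≟ᶠ f | e′ ≟ᶠ f
        ... | yes refl | yes e′≡e = contradiction (sym e′≡e) e≢e′
        ... | yes _ | no _ = refl
        ... | no _ | yes _ = refl
        ... | no _ | no _ = refl
        M⊆W : ∀ f → M f ≡ true → W f ≢ 0ℤ
        M⊆W f Mf with e ≟ᶠ f | e′ ≟ᶠ f
        ... | yes refl | _ = We≢0
        ... | no _ | yes refl = We′≢0
        deg≤ : ∀ v → (⟦_⟧ ∘ M) · χ p q (is v) ≤ ⟦ A v ⟧
        deg≤ v = ≤-trans (≤-reflexive (trans (·-congˡ (χ p q (is v)) split)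
          (trans (·-+ˡ (⟦_⟧ ∘ is e) (⟦_⟧ ∘ is e′) (χ p q (is v))) (cong₂ _+_ (is·χ e v) (is·χ e′ v))))) sum≤
          where
          sum≤ : χ p q (is v) e + χ p q (is v) e′ ≤ ⟦ A v ⟧
          sum≤ with v ≟ᶠ p e | v ≟ᶠ q e
          ... | yes refl | yes pe≡qe = contradiction pe≡qe (ends≢ We≢0)
          ... | no _ | no _ = ≤-trans (≤-reflexive (+-identityˡ _)) (χ≤A We′≢0 v)
          ... | yes refl | no _ rewrite a∉ | active-p We≢0 = ≤-refl
          ... | no _ | yes refl rewrite b∉ | active-q We≢0 = ≤-refl
        count : + 2 * card M ≡ card A
        count = trans (cong (λ x → + 2 * x) (trans (sum-cong-≗ split)
          (trans (∑-distrib-+ (⟦_⟧ ∘ is e) (⟦_⟧ ∘ is e′)) (cong₂ _+_ (card-is e) (card-is e′))))) (sym cA)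

  module ManyActive {m n} {p q : Fin m → Fin n} {A W Q} (F : Fractional p q A W Q) (0<Q : 0ℤ < Q)
    (slack : ∀ X → Nontrivial A X → parity X A ≡ true → Q < W · χ p q X) (5≤A : + 5 ≤ card A) where

    open Fractional F
    open Support F 0<Q
    open Directions F 0<Q

    -- For distinct vertices this is the set {v, a, b}; written with `xor`, its cut becomes the sum
    -- modulo 2 of the three stars.
    triple : Fin n → Fin n → Fin n → Fin n → Bool
    triple v a b u = is v u xor (is a u xor is b u)

    module _ {v a b} (v≢a : v ≢ a) (v≢b : v ≢ b) (a≢b : a ≢ b)
      (Av : A v ≡ true) (Aa : A a ≡ true) (Ab : A b ≡ true) where

      private X = triple v a b

      X-odd : parity X A ≡ true
      X-odd = begin
        parity X A
          ≡⟨ par-cong (λ u → distribute (is v u) (is a u) (is b u) (A u)) ⟩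
        par (λ u → (A u ∧ is v u) xor ((A u ∧ is a u) xor (A u ∧ is b u)))
          ≡⟨ par-xor (λ u → A u ∧ is v u) (λ u → (A u ∧ is a u) xor (A u ∧ is b u)) ⟩
        par (λ u → A u ∧ is v u) xor par (λ u → (A u ∧ is a u) xor (A u ∧ is b u))
          ≡⟨ cong₂ _xor_ (trans (par-is A v) Av)
               (trans (par-xor (λ u → A u ∧ is a u) (λ u → A u ∧ is b u))
                      (cong₂ _xor_ (trans (par-is A a) Aa) (trans (par-is A b) Ab))) ⟩
        true ∎
        where
        open ≡-Reasoning
        distribute : ∀ x y z w → (x xor (y xor z)) ∧ w ≡ (w ∧ x) xor ((w ∧ y) xor (w ∧ z))
        distribute x y z true = Bool.∧-identityʳ _
        distribute x y z false = Bool.∧-zeroʳ _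

      -- Inside there is an odd number of active vertices, among them `v` and `a`; being at most
      -- three of at least five, they leave two outside.
      X-nontrivial : Nontrivial A X
      X-nontrivial = ≰⇒> inside≰1 , outside>1
        where
        Xv : X v ∧ A v ≡ true
        Xv rewrite is-refl v | is-≢ (v≢a ∘ sym) | is-≢ (v≢b ∘ sym) = Av
        Xa : X a ∧ A a ≡ true
        Xa rewrite is-refl a | is-≢ v≢a | is-≢ (a≢b ∘ sym) = Aa
        inside≰1 : ¬ inside A X ≤ 1ℤ
        inside≰1 ≤1 = v≢a (card≡1⇒unique (λ u → X u ∧ A u)
          (≤-antisym ≤1 (par⇒card≥1 (λ u → X u ∧ A u) X-odd)) Xv Xa)
        at-most : ∀ x y z w → ⟦ (x xor (y xor z)) ∧ w ⟧ ≤ ⟦ x ⟧ + (⟦ y ⟧ + ⟦ z ⟧)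
        at-most false false false false = +≤+ z≤n
        at-most false false false true = +≤+ z≤n
        at-most false false true false = +≤+ z≤n
        at-most false false true true = +≤+ (s≤s z≤n)
        at-most false true false false = +≤+ z≤n
        at-most false true false true = +≤+ (s≤s z≤n)
        at-most false true true false = +≤+ z≤n
        at-most false true true true = +≤+ z≤n
        at-most true false false false = +≤+ z≤n
        at-most true false false true = +≤+ (s≤s z≤n)
        at-most true false true false = +≤+ z≤n
        at-most true false true true = +≤+ z≤n
        at-most true true false false = +≤+ z≤n
        at-most true true false true = +≤+ z≤n
        at-most true true true false = +≤+ z≤n
        at-most true true true true = +≤+ (s≤s z≤n)
        inside≤3 : inside A X ≤ + 3
        inside≤3 = ≤-trans (sum-mono λ u → at-most (is v u) (is a u) (is b u) (A u)) (≤-reflexive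
          (trans (∑-distrib-+ (⟦_⟧ ∘ is v) (λ u → ⟦ is a u ⟧ + ⟦ is b u ⟧))
            (cong₂ _+_ (card-is v) (trans (∑-distrib-+ (⟦_⟧ ∘ is a) (⟦_⟧ ∘ is b))
              (cong₂ _+_ (card-is a) (card-is b))))))
        outside>1 : 1ℤ < outside A X
        outside>1 = <-≤-trans (+<+ (s≤s (s≤s z≤n))) (≤-by (0≤+ (0≤- 5≤A) (0≤- inside≤3))
          (trans (combine (inside A X) (outside A X)) (cong (λ c → c - + 5 + (+ 3 - inside A X)) (sym (card-split A X)))))
          where
          combine : ∀ i o → o - + 2 ≡ i + o - + 5 + (+ 3 - i)
          combine = solve-∀

      -- If every support edge at `v` led to `a` or `b`, then edge by edge χ(X) + χ(v) ≤ χ(a) +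
      -- χ(b), and the cut of `X` would weigh at most 2Q - Q = Q, against the assumption that no
      -- nontrivial odd cut is tight.
      not-star : ¬ (∀ e → W e ≢ 0ℤ → cut p q (is v) e ≡ true →
        cut p q (is a) e ≡ true ⊎ cut p q (is b) e ≡ true)
      not-star star = <⇒≱ (slack X X-nontrivial X-odd) (≤-by (0≤- bound)
        (trans (rearrange (W · χ p q X) Q) refl))
        where
        rearrange : ∀ x Q → Q - x ≡ Q + Q - (x + Q)
        rearrange = solve-∀
        regroup : ∀ x y z x′ y′ z′ →
          (x xor (y xor z)) xor (x′ xor (y′ xor z′)) ≡ (x xor x′) xor ((y xor y′) xor (z xor z′))
        regroup x y z x′ y′ z′ = begin
          (x xor (y xor z)) xor (x′ xor (y′ xor z′)) ≡⟨ exchange x (y xor z) x′ (y′ xor z′) ⟩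
          (x xor x′) xor ((y xor z) xor (y′ xor z′)) ≡⟨ cong ((x xor x′) xor_) (exchange y z y′ z′) ⟩
          (x xor x′) xor ((y xor y′) xor (z xor z′)) ∎
          where
          open ≡-Reasoning
          exchange : ∀ a b c d → (a xor b) xor (c xor d) ≡ (a xor c) xor (b xor d)
          exchange a b c d = trans (Bool.xor-assoc a b (c xor d)) (trans (cong (a xor_)
            (trans (sym (Bool.xor-assoc b c d)) (trans (cong (_xor d) (Bool.xor-comm b c)) (Bool.xor-assoc c b d))))
            (sym (Bool.xor-assoc a c (b xor d))))
        pointwise : ∀ x y z → (x ≡ true → y ≡ true ⊎ z ≡ true) → ⟦ x xor (y xor z) ⟧ + ⟦ x ⟧ ≤ ⟦ y ⟧ + ⟦ z ⟧
        pointwise false false false _ = ≤-refl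
        pointwise false false true _ = ≤-refl
        pointwise false true false _ = ≤-refl
        pointwise false true true _ = +≤+ z≤n
        pointwise true false true _ = ≤-refl
        pointwise true true false _ = ≤-refl
        pointwise true true true _ = ≤-refl
        pointwise true false false or = contradiction (or refl) λ { (inj₁ ()) ; (inj₂ ()) }
        bound : W · χ p q X + Q ≤ Q + Q
        bound = subst₂ _≤_
          (trans (·-+ʳ W (χ p q X) (χ p q (is v))) (cong (λ x → W · χ p q X + x) (active-degree Av)))
          (trans (·-+ʳ W (χ p q (is a)) (χ p q (is b))) (cong₂ _+_ (active-degree Aa) (active-degree Ab)))
          (·-monoʳ nonneg λ e We≢0 → subst (λ x → ⟦ x ⟧ + χ p q (is v) e ≤ χ p q (is a) e + χ p q (is b) e)
            (sym (regroup (is v (p e)) (is a (p e)) (is b (p e)) (is v (q e)) (is a (q e)) (is b (q e))))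
            (pointwise (cut p q (is v) e) (cut p q (is a) e) (cut p q (is b) e) (star e We≢0)))

    other-end : ∀ {v e} → W e ≢ 0ℤ → cut p q (is v) e ≡ true →
      ∃ λ a → v ≢ a × A a ≡ true × cut p q (is a) e ≡ true
    other-end {v} {e} We≢0 v∈e with v ≟ᶠ p e | v ≟ᶠ q e
    ... | yes refl | no v≢q = q e , v≢q , active-q We≢0 , cut-q We≢0
    ... | no v≢p | yes refl = p e , v≢p , active-p We≢0 , cut-p We≢0

    Star : Fin n → Fin m → Bool
    Star v e = supp W e ∧ cut p q (is v) e

    -- If `v` had at most two edges in the support, their other ends, padded by a further active
    -- vertex if they coincide, would be the forbidden `a` and `b` of `not-star`.
    degree≥3 : ∀ v → A v ≡ true → + 3 ≤ card (Star v)
    degree≥3 v Av with + 3 ≤? card (Star v)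
    ... | yes ≥3 = ≥3
    ... | no ≱3 with edge-at Av
    ...   | e₁ , We₁≢0 , v∈e₁ with other-end We₁≢0 v∈e₁
    ...     | a , v≢a , Aa , a∈e₁ = ⊥-elim two-edges
      where
      star₁ : Star v e₁ ≡ true
      star₁ = cong₂ _∧_ (≢0⇒supp {W = W} We₁≢0) v∈e₁
      card≤ : card (Star v ∖ e₁) ≤ 1ℤ
      card≤ = ≮⇒≥ λ 1<c → ≱3 (≤-by (0≤- (ℤ.i<j⇒suc[i]≤j 1<c))
        (trans (cong (_- + 3) (card-∖ (Star v) e₁ star₁)) (shift (card (Star v ∖ e₁)))))
        where
        shift : ∀ x → x + 1ℤ - + 3 ≡ x - + 2
        shift = solve-∀
      third : ∃ λ b → v ≢ b × a ≢ b × A b ≡ true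
      third with card-pick ((A ∖ v) ∖ a) (<-≤-trans (+<+ (s≤s z≤n)) (≤-by (0≤- 5≤A)
          (trans (shift (card ((A ∖ v) ∖ a))) (cong (_- + 5) (sym (trans (card-∖ A v Av)
            (cong (λ x → x + 1ℤ) (card-∖ (A ∖ v) a (cong₂ _∧_ Aa (cong not (is-≢ v≢a)))))))))))
        where
        shift : ∀ x → x - + 3 ≡ x + 1ℤ + 1ℤ - + 5
        shift = solve-∀
      ... | b , Ab′ with ∖-true {f = A ∖ v} Ab′
      ... | Ab″ , a≢b with ∖-true {f = A} Ab″
      ... | Ab , v≢b = b , v≢b , a≢b , Ab
      only : ∀ {b} → v ≢ b → A b ≡ true →
        (∀ e → W e ≢ 0ℤ → cut p q (is v) e ≡ true → cut p q (is a) e ≡ true ⊎ cut p q (is b) e ≡ true) → ⊥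
      only {b} v≢b Ab star with a ≟ᶠ b
      ... | no a≢b = not-star v≢a v≢b a≢b Av Aa Ab star
      -- There is only one neighbour, reached by one edge or by two parallel ones. Any further
      -- active vertex completes the triple.
      ... | yes refl with third
      ...   | b′ , v≢b′ , a≢b′ , Ab′ = not-star v≢a v≢b′ a≢b′ Av Aa Ab′ λ e We≢0 v∈e →
              inj₁ ([ id , id ] (star e We≢0 v∈e))
      two-edges : ⊥
      two-edges with any? (λ e → (Star v ∖ e₁) e Bool.≟ true)
      ... | no none = only v≢a Aa λ e We≢0 v∈e → inj₁ (at e We≢0 v∈e)
        where
        at : ∀ e → W e ≢ 0ℤ → cut p q (is v) e ≡ true → cut p q (is a) e ≡ true
        at e We≢0 v∈e with e₁ ≟ᶠ e
        ... | yes refl = a∈e₁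
        ... | no e₁≢e = contradiction (e , cong₂ _∧_ (cong₂ _∧_ (≢0⇒supp {W = W} We≢0) v∈e) (cong not (is-≢ e₁≢e))) none
      ... | yes (e₂ , e₂∈) with ∖-true {f = Star v} e₂∈
      ...   | star₂ , e₁≢e₂ with ∧-true {supp W e₂} star₂
      ...   | We₂ , v∈e₂ with other-end (supp⇒≢0 {W = W} We₂) v∈e₂
      ...     | b , v≢b , Ab , b∈e₂ = only v≢b Ab at
        where
        card≡1 : card (Star v ∖ e₁) ≡ 1ℤ
        card≡1 = ≤-antisym card≤ (subst (1ℤ ≤_) (sym (card-∖ (Star v ∖ e₁) e₂ e₂∈))
          (≤-by (card-nonneg ((Star v ∖ e₁) ∖ e₂)) (shift (card ((Star v ∖ e₁) ∖ e₂)))))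
          where
          shift : ∀ x → x + 1ℤ - 1ℤ ≡ x
          shift = solve-∀
        at : ∀ e → W e ≢ 0ℤ → cut p q (is v) e ≡ true → cut p q (is a) e ≡ true ⊎ cut p q (is b) e ≡ true
        at e We≢0 v∈e with e₁ ≟ᶠ e
        ... | yes refl = inj₁ a∈e₁
        ... | no e₁≢e = inj₂ (subst (λ f → cut p q (is b) f ≡ true)
          (card≡1⇒unique (Star v ∖ e₁) card≡1 e₂∈
            (cong₂ _∧_ (cong₂ _∧_ (≢0⇒supp {W = W} We≢0) v∈e) (cong not (is-≢ e₁≢e)))) b∈e₂)

    -- Counting edge ends in the support gives 3 |A| ≤ 2 |supp W|, and |A| is positive.
    more-edges-than-vertices : card A < card (supp W)
    more-edges-than-vertices = ≰⇒> λ s≤A → <⇒≱ (<-≤-trans (+<+ (s≤s z≤n)) 5≤A)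
      (≤-by (0≤+ (0≤- 3A≤2s) (0≤+ (0≤- s≤A) (0≤- s≤A))) (combine (card A) (card (supp W))))
      where
      combine : ∀ a s → 0ℤ - a ≡ + 2 * s - + 3 * a + (a - s + (a - s))
      combine = solve-∀
      term : ∀ v → + 3 * ⟦ A v ⟧ ≤ (⟦_⟧ ∘ supp W) · χ p q (is v)
      term v with A v in Av
      ... | false = ·-nonneg (λ e → 0≤⟦ supp W e ⟧) (λ e → 0≤⟦ cut p q (is v) e ⟧)
      ... | true = subst (+ 3 ≤_) (sym (·-card (supp W) (cut p q (is v)))) (degree≥3 v Av)
      3A≤2s : + 3 * card A ≤ + 2 * card (supp W)
      3A≤2s = subst₂ _≤_ (sym (*-distribˡ-sum (+ 3) (⟦_⟧ ∘ A)))
        (handshake (⟦_⟧ ∘ supp W) λ e s≢0 We≡0 → s≢0 (cong ⟦_⟧ (vanish We≡0))) (sum-mono term)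
        where
        vanish : ∀ {e} → W e ≡ 0ℤ → supp W e ≡ false
        vanish {e} We≡0 with W e ≟ᶻ 0ℤ
        ... | yes _ = refl
        ... | no We≢0 = contradiction We≡0 We≢0

    -- Only active vertices count as equations for `kernel`. At an inactive vertex the balance is
    -- automatic, since no edge of the support meets it.
    direction : Σ (Fin m → ℤ) λ y → (∃ λ e → y e ≢ 0ℤ) × (∀ e → W e ≡ 0ℤ → y e ≡ 0ℤ) ×
      (∀ v → y · χ p q (is v) ≡ 0ℤ)
    direction with kernel n (λ v → χ p q (is v)) A (supp W) more-edges-than-vertices
    ... | y , y≢0 , y-supp , ker = y , y≢0 , y-support , balanced
      where
      y-support : ∀ e → W e ≡ 0ℤ → y e ≡ 0ℤ
      y-support e We≡0 = y-supp e (≢true⇒false λ s → supp⇒≢0 {W = W} s We≡0)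
      balanced : ∀ v → y · χ p q (is v) ≡ 0ℤ
      balanced v with A v in Av
      ... | true = trans (·-comm y _) (ker v Av)
      ... | false = trans (·-cong {f′ = λ _ → 0ℤ} {λ _ → 0ℤ} term) (·-zeroˡ (λ _ → 0ℤ))
        where
        term : ∀ e → y e * χ p q (is v) e ≡ 0ℤ
        term e with W e ≟ᶻ 0ℤ
        ... | yes We≡0 = trans (cong (_* χ p q (is v) e) (y-support e We≡0)) (*-zeroˡ (χ p q (is v) e))
        ... | no We≢0 with cut p q (is v) e in v∈e
        ...   | false = *-zeroʳ (y e)
        ...   | true = ⊥-elim (true≢false (active {v} {e} We≢0 v∈e) Av)

  -- The induction for Edmonds' theorem

  Tight : ∀ {m n} → (Fin m → Fin n) → (Fin m → Fin n) → (Fin n → Bool) → (Fin m → ℤ) → ℤ → (Fin n → Bool) → Set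
  Tight p q A W Q X = Nontrivial A X × parity X A ≡ true × W · χ p q X ≡ Q

  Tight? : ∀ {m n} (p q : Fin m → Fin n) A W Q → Dec (∃ (Tight p q A W Q))
  Tight? p q A W Q = ∃-function? resp λ X →
    Nontrivial? A X ×-dec ((parity X A Bool.≟ true) ×-dec (W · χ p q X ≟ᶻ Q))
    where
    resp : ∀ {X Y} → X ≗ Y → Tight p q A W Q X → Tight p q A W Q Y
    resp eq (nt , odd , tight) = Nontrivial-resp A eq nt , trans (sym (parity-resp A eq)) odd ,
      trans (sym (·-congʳ W (χ-cong eq))) tight

  Direction : ∀ {m n} → (Fin m → Fin n) → (Fin m → Fin n) → (Fin m → ℤ) → Set
  Direction {m} p q W = Σ (Fin m → ℤ) λ y → (∃ λ e → y e ≢ 0ℤ) × (∀ e → W e ≡ 0ℤ → y e ≡ 0ℤ) ×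
    (∀ v → y · χ p q (is v) ≡ 0ℤ)

  contraction-card : ∀ {n} (A S : Fin n → Bool) {s} → S s ≡ false → 1ℤ < outside A S →
    card (λ v → if S v then A v else is s v) < card A
  contraction-card A S {s} s∉S out>1 = subst₂ _<_ (sym count) (sym (card-split A S)) (ℤ.+-monoʳ-< (inside A S) out>1)
    where
    term : ∀ v → ⟦ if S v then A v else is s v ⟧ ≡ ⟦ S v ∧ A v ⟧ + ⟦ is s v ⟧
    term v with S v in Sv
    ... | false = sym (+-identityˡ ⟦ is s v ⟧)
    ... | true rewrite is-≢ {i = s} {v} (λ { refl → true≢false Sv s∉S }) = sym (+-identityʳ ⟦ A v ⟧)
    count : card (λ v → if S v then A v else is s v) ≡ inside A S + 1ℤ
    count = trans (sum-cong-≗ term) (trans (∑-distrib-+ (λ v → ⟦ S v ∧ A v ⟧) (⟦_⟧ ∘ is s))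
      (cong (λ x → inside A S + x) (card-is s)))

  card≤ : ∀ {n} (f : Fin n → Bool) → card f ≤ + n
  card≤ {zero} f = ≤-refl
  card≤ {suc n} f = +-mono-≤ ⟦ f zero ⟧≤1 (card≤ (f ∘ suc))

  <-suc : ∀ {x y a} → x < y → y ≤ + suc a → x ≤ + a
  <-suc {x} {y} {a} x<y y≤ = ≤-by (0≤+ (0≤- y≤) (0≤- (ℤ.i<j⇒suc[i]≤j x<y))) (shift x y (+ a))
    where
    shift : ∀ x y a → a - x ≡ 1ℤ + a - y + (y - (1ℤ + x))
    shift = solve-∀

  module Start {m n} {p q : Fin m → Fin n} {A W Q} (F : Fractional p q A W Q) (0<Q : 0ℤ < Q) where

    open Fractional F
    open Directions F 0<Q

    -- The first alternative ends the descent: the weights are a multiple of one perfect matching,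
    -- which then attains the average for every objective.
    Start : Set
    Start = (∃ λ M → Perfect p q A W M × ∀ e → W e ≡ Q * ⟦ M e ⟧) ⊎ Direction p q W

    from-perfect : ∀ M → Perfect p q A W M → Start
    from-perfect M PM with any? (λ e → ¬? (1ℤ * W e + - Q * ⟦ M e ⟧ ≟ᶻ 0ℤ))
    ... | yes y≢0 = inj₂ ((λ e → 1ℤ * W e + - Q * ⟦ M e ⟧) , y≢0 , y-support , balanced)
      where
      y-support : ∀ e → W e ≡ 0ℤ → 1ℤ * W e + - Q * ⟦ M e ⟧ ≡ 0ℤ
      y-support e We≡0 with M e in Me
      ... | false = trans (cong (λ w → 1ℤ * w + - Q * 0ℤ) We≡0) (zero-comb Q)
        where
        zero-comb : ∀ Q → 1ℤ * 0ℤ + - Q * 0ℤ ≡ 0ℤ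
        zero-comb = solve-∀
      ... | true = contradiction We≡0 (Perfect.support PM e Me)
      balanced : ∀ v → (λ e → 1ℤ * W e + - Q * ⟦ M e ⟧) · χ p q (is v) ≡ 0ℤ
      balanced v = trans (·-comb 1ℤ (- Q) W (⟦_⟧ ∘ M) (χ p q (is v)))
        (trans (cong₂ (λ x z → 1ℤ * x + - Q * z) (degree v) (Perfect.degree PM v)) (cancel Q ⟦ A v ⟧))
        where
        cancel : ∀ Q a → 1ℤ * (Q * a) + - Q * a ≡ 0ℤ
        cancel = solve-∀
    ... | no none = inj₁ (M , PM , equal)
      where
      equal : ∀ e → W e ≡ Q * ⟦ M e ⟧
      equal e with 1ℤ * W e + - Q * ⟦ M e ⟧ ≟ᶻ 0ℤ
      ... | no y≢0 = contradiction (e , y≢0) none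
      ... | yes y≡0 = ℤ.i-j≡0⇒i≡j _ _ (trans (shape (W e) Q ⟦ M e ⟧) y≡0)
        where
        shape : ∀ w Q m → w - Q * m ≡ 1ℤ * w + - Q * m
        shape = solve-∀

    start : (∀ X → Nontrivial A X → parity X A ≡ true → Q < W · χ p q X) → Start
    start slack with card-par A
    ... | 0 , cA , _ = from-perfect (const false) (perfect₀ cA)
    ... | 2 , cA , _ = from-perfect (proj₁ (perfect₂ cA)) (proj₂ (perfect₂ cA))
    ... | 4 , cA , _ = from-perfect (proj₁ (perfect₄ cA)) (proj₂ (perfect₄ cA))
    ... | 1 , _ , par-odd = contradiction (total-even F 0<Q) (true≢false par-odd)
    ... | 3 , _ , par-odd = contradiction (total-even F 0<Q) (true≢false par-odd)
    ... | suc (suc (suc (suc (suc k)))) , cA , _ = inj₂ (ManyActive.direction F 0<Q slack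
      (subst (+ 5 ≤_) (sym cA) (+≤+ (s≤s (s≤s (s≤s (s≤s (s≤s z≤n))))))))

    -- At the end `p e` of a positive entry the values of `y` sum to zero, so another edge there has
    -- a negative one.
    negative-entry : ∀ y → (∀ e → W e ≡ 0ℤ → y e ≡ 0ℤ) → (∀ v → y · χ p q (is v) ≡ 0ℤ) →
      (∃ λ e → y e ≢ 0ℤ) → ∃ λ e → y e < 0ℤ
    negative-entry y y-support balanced (e , ye≢0) with <-cmp (y e) 0ℤ
    ... | tri< ye<0 _ _ = e , ye<0
    ... | tri≈ _ ye≡0 _ = contradiction ye≡0 ye≢0
    ... | tri> _ _ 0<ye with ∃-pos f e fe<0 (≤-reflexive (sym sum-f))
      where
      f : Fin m → ℤ
      f e′ = - 1ℤ * (y e′ * χ p q (is (p e)) e′)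
      negate : ∀ x → - x ≡ - 1ℤ * (x * 1ℤ)
      negate = solve-∀
      fe<0 : f e < 0ℤ
      fe<0 = subst (_< 0ℤ) (trans (negate (y e)) (cong (λ b → - 1ℤ * (y e * ⟦ b ⟧))
        (sym (Support.cut-p F 0<Q {e} λ We≡0 → ye≢0 (y-support e We≡0))))) (ℤ.neg-mono-< 0<ye)
      sum-f : sum f ≡ 0ℤ
      sum-f = trans (sym (*-distribˡ-sum (- 1ℤ) (λ e′ → y e′ * χ p q (is (p e)) e′)))
        (cong (- 1ℤ *_) (trans (sym (·-unfold y (χ p q (is (p e))))) (balanced (p e))))
    ... | e′ , 0<fe′ = e′ , negative (y e′) (cut p q (is (p e)) e′) 0<fe′
      where
      negative : ∀ x b → 0ℤ < - 1ℤ * (x * ⟦ b ⟧) → x < 0ℤ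
      negative x b lt = ≰⇒> λ 0≤x → <⇒≱ lt (subst (_≤ 0ℤ) (negate (x * ⟦ b ⟧)) (ℤ.neg-mono-≤ (0≤* 0≤x 0≤⟦ b ⟧)))
        where
        negate : ∀ x → - x ≡ - 1ℤ * x
        negate = solve-∀

    -- Directions may be negated, so the sign is chosen to favour `c`. Either sign has a negative
    -- entry, which guarantees that the ratio test finds a blocking constraint.
    improving : Direction p q W → ∀ c → ∃ λ y → 0ℤ ≤ c · y × (∃ λ e → y e < 0ℤ) ×
      (∀ e → W e ≡ 0ℤ → y e ≡ 0ℤ) × (∀ v → y · χ p q (is v) ≡ 0ℤ)
    improving (y , y≢0 , y-support , balanced) c with 0ℤ ≤? c · y
    ... | yes 0≤c·y = y , 0≤c·y , negative-entry y y-support balanced y≢0 , y-support , balanced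
    ... | no c·y<0 = -y , 0≤c·-y , negative-entry -y -y-support -balanced -y≢0 , -y-support , -balanced
      where
      -y : Fin m → ℤ
      -y e = - 1ℤ * y e
      0≤c·-y : 0ℤ ≤ c · -y
      0≤c·-y = subst (0ℤ ≤_) (trans (negate (c · y)) (sym (·-*ʳ (- 1ℤ) c y))) (ℤ.neg-mono-≤ (<⇒≤ (≰⇒> c·y<0)))
        where
        negate : ∀ x → - x ≡ - 1ℤ * x
        negate = solve-∀
      -y-support : ∀ e → W e ≡ 0ℤ → -y e ≡ 0ℤ
      -y-support e We≡0 = cong (- 1ℤ *_) (y-support e We≡0)
      -balanced : ∀ v → -y · χ p q (is v) ≡ 0ℤ
      -balanced v = trans (·-*ˡ (- 1ℤ) y (χ p q (is v))) (cong (- 1ℤ *_) (balanced v))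
      -y≢0 : ∃ λ e → -y e ≢ 0ℤ
      -y≢0 = proj₁ y≢0 , λ eq → proj₂ y≢0 (*-cancelˡ-≡ (- 1ℤ) (y (proj₁ y≢0)) 0ℤ eq)

  mutual
    -- Lexicographic recursion on `a`, bounding the active vertices, and `k`, bounding the support.
    -- A contraction lowers `a` and lets `k` start again from `m`; a step that empties an edge
    -- lowers `k`; a step that makes an odd cut tight is followed by a contraction at once.
    edmonds : ∀ a {m n} {p q : Fin m → Fin n} {A W Q} → Fractional p q A W Q → 0ℤ < Q →
      card A ≤ + a → Good p q A W Q
    edmonds a {m} {W = W} F 0<Q A≤a = shrink a m F 0<Q A≤a (card≤ (supp W))

    contract : ∀ a {m n} {p q : Fin m → Fin n} {A W Q} → Fractional p q A W Q → 0ℤ < Q →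
      card A ≤ + a → ∃ (Tight p q A W Q) → Good p q A W Q
    contract zero {A = A} F 0<Q A≤0 (S , (in>1 , out>1) , _) = contradiction A≤0
      (<⇒≱ (subst (0ℤ <_) (sym (card-split A S)) (+-mono-< (ℤ.<-trans (+<+ (s≤s z≤n)) in>1) (ℤ.<-trans (+<+ (s≤s z≤n)) out>1))))
    contract (suc a) {A = A} F 0<Q A≤a (S , (in>1 , out>1) , S-odd , S-tight)
      with card-pick (λ v → not (S v) ∧ A v) (ℤ.<-trans (+<+ (s≤s z≤n)) out>1)
         | card-pick (λ v → S v ∧ A v) (ℤ.<-trans (+<+ (s≤s z≤n)) in>1)
    ... | s , s∈ | t , t∈ = glue
        (edmonds a C₁.contracted 0<Q (<-suc (contraction-card A S s∉S out>1) A≤a))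
        (edmonds a C₂.contracted 0<Q (<-suc (contraction-card A (not ∘ S) (cong not t∈S)
          (subst (1ℤ <_) (inside-cong A λ v → sym (Bool.not-involutive (S v))) in>1)) A≤a))
      where
      s∉S : S s ≡ false
      s∉S = trans (sym (Bool.not-involutive (S s))) (cong not (proj₁ (∧-true {not (S s)} s∈)))
      t∈S : S t ≡ true
      t∈S = proj₁ (∧-true {S t} t∈)
      open Gluing F 0<Q S s t s∉S t∈S S-odd S-tight

    shrink : ∀ a k {m n} {p q : Fin m → Fin n} {A W Q} → Fractional p q A W Q → 0ℤ < Q →
      card A ≤ + a → card (supp W) ≤ + k → Good p q A W Q
    shrink a k {p = p} {q} {A} {W} {Q} F 0<Q A≤a W≤k c with Tight? p q A W Q
    ... | yes tight = contract a F 0<Q A≤a tight c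
    ... | no ∄tight with Start.start F 0<Q slack
      where
      slack : ∀ X → Nontrivial A X → parity X A ≡ true → Q < W · χ p q X
      slack X nt odd = ≤∧≢⇒< (Fractional.odd-cut F X odd) λ eq → ∄tight (X , nt , odd , sym eq)
    ...   | inj₁ (M , PM , W≡QM) = M , PM , ≤-reflexive (trans (·-congʳ c W≡QM) (·-*ʳ Q c (⟦_⟧ ∘ M)))
    ...   | inj₂ direction with Start.improving F 0<Q direction c
    ...     | y , 0≤c·y , (e₀ , ye₀<0) , y-support , balanced = good c 0≤c·y (next k W≤k progress)
      where
      slack : ∀ X → Nontrivial A X → parity X A ≡ true → Q < W · χ p q X
      slack X nt odd = ≤∧≢⇒< (Fractional.odd-cut F X odd) λ eq → ∄tight (X , nt , odd , sym eq)
      open Perturbation F 0<Q slack y y-support balanced e₀ ye₀<0 using (W′; W′-zero; perturbed; 0<a; progress; Progress; good) renaming (a to α)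
      next : ∀ k → card (supp W) ≤ + k → Progress → ∃ λ M → Perfect p q A W′ M × c · W′ ≤ α * Q * c · (⟦_⟧ ∘ M)
      next k W≤k (inj₂ tight) = contract a perturbed (0<* 0<a 0<Q) A≤a tight c
      next zero W≤0 (inj₁ (e , We≢0 , _)) = contradiction W≤0 (<⇒≱ (<-≤-trans (+<+ (s≤s z≤n))
        (subst (1ℤ ≤_) (sym (card-∖ (supp W) e (≢0⇒supp {W = W} We≢0)))
          (≤-by (card-nonneg (supp W ∖ e)) (shift (card (supp W ∖ e)))))))
        where
        shift : ∀ x → x + 1ℤ - 1ℤ ≡ x
        shift = solve-∀
      next (suc k) W≤k (inj₁ (e , We≢0 , W′e≡0)) = shrink a k perturbed (0<* 0<a 0<Q) A≤a
        (<-suc (card-strict e supp⊆ (≢true⇒false λ s → supp⇒≢0 {W = W′} s W′e≡0) (≢0⇒supp {W = W} We≢0)) W≤k) c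
        where
        supp⊆ : ∀ f → supp W′ f ≡ true → supp W f ≡ true
        supp⊆ f s = ≢0⇒supp {W = W} λ Wf≡0 → supp⇒≢0 {W = W′} s (W′-zero Wf≡0)

  -- Matchings that meet every tight odd cut once

  -- Charging every edge B > m for each tight odd cut through it forces the matching to be tight as well.
  module Tightness {m n} {p q : Fin m → Fin n} {A W Q} (F : Fractional p q A W Q) (0<Q : 0ℤ < Q) where

    open Fractional F

    TightOdd : (Fin n → Bool) → Set
    TightOdd X = parity X A ≡ true × W · χ p q X ≡ Q

    TightOdd? : ∀ X → Dec (TightOdd X)
    TightOdd? X = (parity X A Bool.≟ true) ×-dec (W · χ p q X ≟ᶻ Q)

    penalty : List (Vec Bool n) → Fin m → ℤ
    penalty [] e = 0ℤ
    penalty (X ∷ Xs) e = ⟦ ⌊ TightOdd? (lookup X) ⌋ ⟧ * χ p q (lookup X) e + penalty Xs e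

    tights : List (Vec Bool n) → ℤ
    tights [] = 0ℤ
    tights (X ∷ Xs) = ⟦ ⌊ TightOdd? (lookup X) ⌋ ⟧ + tights Xs

    ·-penalty-∷ : ∀ g X Xs →
      g · penalty (X ∷ Xs) ≡ ⟦ ⌊ TightOdd? (lookup X) ⌋ ⟧ * g · χ p q (lookup X) + g · penalty Xs
    ·-penalty-∷ g X Xs = trans (·-+ʳ g (λ e → t * χ p q (lookup X) e) (penalty Xs))
      (cong (λ x → x + g · penalty Xs) (·-*ʳ t g (χ p q (lookup X))))
      where t = ⟦ ⌊ TightOdd? (lookup X) ⌋ ⟧

    -- The weights pay exactly Q for each tight odd cut, whereas a perfect matching pays at least 1
    -- for each and more as soon as it meets one of them more than once.
    weight-penalty : ∀ Xs → W · penalty Xs ≡ Q * tights Xs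
    weight-penalty [] = trans (·-comm W _) (trans (·-zeroˡ W) (sym (*-zeroʳ Q)))
    weight-penalty (X ∷ Xs) = trans (·-penalty-∷ W X Xs)
      (trans (cong₂ _+_ head (weight-penalty Xs)) (sym (ℤ.*-distribˡ-+ Q _ (tights Xs))))
      where
      head : ⟦ ⌊ TightOdd? (lookup X) ⌋ ⟧ * W · χ p q (lookup X) ≡ Q * ⟦ ⌊ TightOdd? (lookup X) ⌋ ⟧
      head with TightOdd? (lookup X)
      ... | yes (_ , tight) = trans (*-identityˡ (W · χ p q (lookup X))) (trans tight (sym (*-identityʳ Q)))
      ... | no _ = trans (*-zeroˡ (W · χ p q (lookup X))) (sym (*-zeroʳ Q))

    module _ {M} (PM : Perfect p q A W M) where

      matching-odd : ∀ X → parity X A ≡ true → 1ℤ ≤ (⟦_⟧ ∘ M) · χ p q X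
      matching-odd X odd = subst (1ℤ ≤_) (sym (·-card M (cut p q X)))
        (par⇒card≥1 (λ e → M e ∧ cut p q X e) (trans (matching-parity PM X) odd))

      head≥ : ∀ X → ⟦ ⌊ TightOdd? (lookup X) ⌋ ⟧ ≤ ⟦ ⌊ TightOdd? (lookup X) ⌋ ⟧ * (⟦_⟧ ∘ M) · χ p q (lookup X)
      head≥ X with TightOdd? (lookup X)
      ... | yes (odd , _) = subst (1ℤ ≤_) (sym (*-identityˡ ((⟦_⟧ ∘ M) · χ p q (lookup X)))) (matching-odd (lookup X) odd)
      ... | no _ = ≤-reflexive (sym (*-zeroˡ ((⟦_⟧ ∘ M) · χ p q (lookup X))))

      matching-penalty : ∀ Xs → tights Xs ≤ (⟦_⟧ ∘ M) · penalty Xs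
      matching-penalty [] = ≤-reflexive (sym (trans (·-comm (⟦_⟧ ∘ M) (λ _ → 0ℤ)) (·-zeroˡ (⟦_⟧ ∘ M))))
      matching-penalty (X ∷ Xs) = subst (tights (X ∷ Xs) ≤_) (sym (·-penalty-∷ (⟦_⟧ ∘ M) X Xs))
        (+-mono-≤ (head≥ X) (matching-penalty Xs))

      matching-excess : ∀ Xs X → X ∈ Xs → TightOdd (lookup X) → 1ℤ < (⟦_⟧ ∘ M) · χ p q (lookup X) →
        tights Xs < (⟦_⟧ ∘ M) · penalty Xs
      matching-excess (X ∷ Xs) X (here refl) tight 1<MX = subst (tights (X ∷ Xs) <_)
        (sym (·-penalty-∷ (⟦_⟧ ∘ M) X Xs)) (+-mono-<-≤ head (matching-penalty Xs))
        where
        head : ⟦ ⌊ TightOdd? (lookup X) ⌋ ⟧ < ⟦ ⌊ TightOdd? (lookup X) ⌋ ⟧ * (⟦_⟧ ∘ M) · χ p q (lookup X)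
        head with TightOdd? (lookup X)
        ... | yes _ = subst (1ℤ <_) (sym (*-identityˡ ((⟦_⟧ ∘ M) · χ p q (lookup X)))) 1<MX
        ... | no ¬tight = contradiction tight ¬tight
      matching-excess (Y ∷ Xs) X (there X∈) tight 1<MX = subst (tights (Y ∷ Xs) <_)
        (sym (·-penalty-∷ (⟦_⟧ ∘ M) Y Xs)) (+-mono-≤-< (head≥ Y) (matching-excess Xs X X∈ tight 1<MX))

    tight-perfect : ∀ c → (∀ e → 0ℤ ≤ c e) → (∀ e → c e ≤ 1ℤ) →
      ∃ λ M → Perfect p q A W M × c · W ≤ Q * c · (⟦_⟧ ∘ M) ×
        (∀ X → parity X A ≡ true → W · χ p q X ≡ Q → (⟦_⟧ ∘ M) · χ p q X ≡ 1ℤ)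
    tight-perfect c 0≤c c≤1 = M , PM , bound′ , tight-one
      where
      B T : ℤ
      B = + suc m
      T = tights (subsets n)
      Y : Fin m → ℤ
      Y = penalty (subsets n)
      solution : ∃ λ M → Perfect p q A W M × (λ e → 1ℤ * c e + - B * Y e) · W ≤ Q * (λ e → 1ℤ * c e + - B * Y e) · (⟦_⟧ ∘ M)
      solution with card-par A
      ... | a , cA , _ = edmonds a F 0<Q (≤-reflexive cA) (λ e → 1ℤ * c e + - B * Y e)
      M = proj₁ solution
      PM = proj₁ (proj₂ solution)
      u = c · (⟦_⟧ ∘ M)
      z = (⟦_⟧ ∘ M) · Y
      bound : 1ℤ * c · W + - B * (Q * T) ≤ Q * (1ℤ * u + - B * z)
      bound = subst₂ _≤_
        (trans (·-comb 1ℤ (- B) c Y W) (cong (λ x → 1ℤ * c · W + - B * x) (trans (·-comm Y W) (weight-penalty (subsets n)))))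
        (cong (Q *_) (trans (·-comb 1ℤ (- B) c Y (⟦_⟧ ∘ M)) (cong (λ x → 1ℤ * u + - B * x) (·-comm Y (⟦_⟧ ∘ M)))))
        (proj₂ (proj₂ solution))
      T≤z : T ≤ z
      T≤z = matching-penalty PM (subsets n)
      u≤m : u ≤ + m
      u≤m = ≤-trans (≤-reflexive (·-unfold c (⟦_⟧ ∘ M))) (≤-trans (sum-mono term) (card≤ M))
        where
        term : ∀ e → c e * ⟦ M e ⟧ ≤ ⟦ M e ⟧
        term e = ≤-by (0≤* (0≤⟦ M e ⟧) (0≤- (c≤1 e))) (factor (c e) ⟦ M e ⟧)
          where
          factor : ∀ c x → x - c * x ≡ x * (1ℤ - c)
          factor = solve-∀
      -- One excess crossing would cost Q B = Q (m + 1), but the objective earns at most Q u ≤ Q m,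
      -- and the average `c · W` it has to reach is nonnegative.
      z≤T : z ≤ T
      z≤T = ≮⇒≥ λ T<z → <⇒≱ 0<Q (≤-by
        (0≤+ (0≤- bound) (0≤+ (·-nonneg 0≤c nonneg) (0≤+ (0≤* (<⇒≤ 0<Q) (0≤- u≤m))
          (0≤* (0≤* (<⇒≤ 0<Q) (+≤+ z≤n)) (0≤- (ℤ.i<j⇒suc[i]≤j T<z))))))
        (combine Q (+ m) T z u (c · W)))
        where
        combine : ∀ Q m T z u w → 0ℤ - Q ≡ Q * (1ℤ * u + - (1ℤ + m) * z) - (1ℤ * w + - (1ℤ + m) * (Q * T)) +
          (w + (Q * (m - u) + Q * (1ℤ + m) * (z - (1ℤ + T))))
        combine = solve-∀
      bound′ : c · W ≤ Q * u
      bound′ = ≤-by (0≤+ (0≤- bound) (0≤* (0≤* (<⇒≤ 0<Q) (+≤+ z≤n)) (0≤- T≤z))) (combine Q B T z u (c · W))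
        where
        combine : ∀ Q B T z u w → Q * u - w ≡ Q * (1ℤ * u + - B * z) - (1ℤ * w + - B * (Q * T)) + Q * B * (z - T)
        combine = solve-∀
      tight-one : ∀ X → parity X A ≡ true → W · χ p q X ≡ Q → (⟦_⟧ ∘ M) · χ p q X ≡ 1ℤ
      tight-one X odd tight = ≤-antisym
        (≮⇒≥ λ 1<MX → <⇒≱ (matching-excess PM (subsets n) (tabulate X) (∈-subsets _)
          (trans (parity-resp A eq) odd , trans (·-congʳ W (χ-cong eq)) tight)
          (subst (1ℤ <_) (sym (·-congʳ (⟦_⟧ ∘ M) (χ-cong eq))) 1<MX)) z≤T)
        (matching-odd PM X odd)
        where
        eq : lookup (tabulate X) ≗ X
        eq = lookup∘tabulate X

  -- Growing the family of perfect matchings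

  same-parity : ∀ a b → odd a ≡ odd b → b ℕ.≤ a → ∃ λ h → a ≡ b ℕ.+ 2 ℕ.* h
  same-parity zero zero _ _ = 0 , refl
  same-parity (suc a) zero eq _ with a
  same-parity (suc a) zero () _ | zero
  ... | suc a′ with same-parity a′ zero (trans (sym (Bool.not-involutive (odd a′))) eq) z≤n
  ...   | h , eq′ = suc h , trans (cong (λ x → suc (suc x)) eq′) (sym (ℕ.*-suc 2 h))
  same-parity (suc a) (suc b) eq (s≤s b≤a) with same-parity a b (Bool.not-injective eq) b≤a
  ... | h , eq′ = h , cong suc eq′

  card-odd : ∀ {n} (f : Fin n → Bool) r → par f ≡ odd r → + r ≤ card f → ∃ λ h → card f ≡ + r + + 2 * + h
  card-odd f r pf r≤ with card-par f
  ... | a , ca , po with same-parity a r (trans (sym po) pf) (ℤ.drop‿+≤+ (subst (+ r ≤_) ca r≤))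
  ... | h , eq = h , trans ca (trans (cong +_ eq) (trans (ℤ.pos-+ r (2 ℕ.* h)) (cong (λ x → + r + x) (ℤ.pos-* 2 h))))

  parity-all : ∀ {n} (X : Fin n → Bool) → parity X (const true) ≡ par X
  parity-all X = par-cong {x = λ v → X v ∧ true} {X} λ v → Bool.∧-identityʳ (X v)

  coverage : ∀ {m} k → (Fin k → Fin m → Bool) → Fin m → ℤ
  coverage zero Ms e = 0ℤ
  coverage (suc k) Ms e = ⟦ Ms zero e ⟧ + coverage k (Ms ∘ suc) e

  covered : ∀ {m} k → (Fin k → Fin m → Bool) → Fin m → Bool
  covered zero Ms e = false
  covered (suc k) Ms e = Ms zero e ∨ covered k (Ms ∘ suc) e

  coverage≤ : ∀ {m} k (Ms : Fin k → Fin m → Bool) e → coverage k Ms e ≤ + k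
  coverage≤ zero Ms e = ≤-refl
  coverage≤ (suc k) Ms e = +-mono-≤ ⟦ Ms zero e ⟧≤1 (coverage≤ k (Ms ∘ suc) e)

  uncovered : ∀ {m} k (Ms : Fin k → Fin m → Bool) e → covered k Ms e ≡ false → coverage k Ms e ≡ 0ℤ
  uncovered zero Ms e _ = refl
  uncovered (suc k) Ms e eq with Ms zero e
  ... | false = trans (+-identityˡ _) (uncovered k (Ms ∘ suc) e eq)

  -- For N = |∂X| = r + 2h and t = k + 2g the bound of the invariant reads 2g ≤ 2hw, so a miss is a
  -- miss by at least 2.
  miss-even : ∀ {N r h w t k g} → N ≡ r + + 2 * h → t ≡ k + + 2 * g → t ≤ (N - r) * w + k → + 2 * g ≤ + 2 * (h * w)
  miss-even {r = r} {h} {w} {k = k} {g} refl refl t≤ = ≤-by (0≤- t≤) (shape r h w k g)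
    where
    shape : ∀ r h w k g → + 2 * (h * w) - + 2 * g ≡ (r + + 2 * h - r) * w + k - (k + + 2 * g)
    shape = solve-∀

  attain : ∀ {N r h w t k g} → N ≡ r + + 2 * h → t ≡ k + + 2 * g → g ≡ h * w → t ≡ (N - r) * w + k
  attain {r = r} {h} {w} {k = k} refl refl refl = shape r h w k
    where
    shape : ∀ r h w k → k + + 2 * (h * w) ≡ (r + + 2 * h - r) * w + k
    shape = solve-∀

  attained-room : ∀ {N r w t k d x} → 0ℤ ≤ N - r → 0ℤ ≤ d → t ≡ (N - r) * w + k → x ≡ 1ℤ →
    x + t ≤ (N - r) * (w + d) + (1ℤ + k)
  attained-room {N} {r} {w} {k = k} {d} 0≤j 0≤d refl refl = ≤-by (0≤* 0≤j 0≤d) (shape (N - r) w k d)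
    where
    shape : ∀ j w k d → j * (w + d) + (1ℤ + k) - (1ℤ + (j * w + k)) ≡ j * d
    shape = solve-∀

  -- Here the conditions on `d` arise. The new matching may take all r + 2h edges of the cut, the
  -- bound grows by 2hd + 1, and the miss leaves 2 to spare: what is needed is r ≤ 2h (d - 1) + 3,
  -- which for h ≥ 1 follows from d ≥ 1 and r ≤ 2d + 1. That h ≥ 1 holds because 0 ≤ g < hw.
  room : ∀ {N r h w t k d g x} → 1ℤ + g ≤ h * w → 0ℤ ≤ g → 0ℤ ≤ w → 1ℤ ≤ d → r ≤ + 2 * d + 1ℤ →
    N ≡ r + + 2 * h → t ≡ k + + 2 * g → x ≤ N → x + t ≤ (N - r) * (w + d) + (1ℤ + k)
  room {r = r} {h} {w} {k = k} {d} {g} {x} g<hw 0≤g 0≤w 1≤d r≤ refl refl x≤N = ≤-by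
    (0≤+ (0≤+ (0≤* {+ 2} (+≤+ z≤n) (0≤- g<hw)) (0≤- x≤N)) (0≤+ (0≤- r≤) (0≤* {+ 2} (+≤+ z≤n) (0≤* (0≤- 1≤h) (0≤- 1≤d)))))
    (trans (cong (λ y → y + (1ℤ + k) - (x + (k + + 2 * g))) (expand r h w d))
      (trans (collect r h k d g x (h * w) (h * d))
        (cong (λ y → + 2 * (h * w - (1ℤ + g)) + (r + + 2 * h - x) + (+ 2 * d + 1ℤ - r + + 2 * y)) (product h d))))
    where
    1≤h : 1ℤ ≤ h
    1≤h = ≮⇒≥ λ h<1 → <⇒≱ (<-≤-trans (+<+ (s≤s z≤n)) (≤-trans (ℤ.+-monoʳ-≤ 1ℤ 0≤g) g<hw))
      (≤-by (0≤* (0≤- {h} {0ℤ} (ℤ.i<j⇒i≤pred[j] h<1)) 0≤w) (shape h w))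
      where
      shape : ∀ h w → 0ℤ - h * w ≡ (0ℤ - h) * w
      shape = solve-∀
    expand : ∀ r h w d → (r + + 2 * h - r) * (w + d) ≡ + 2 * (h * w) + + 2 * (h * d)
    expand = solve-∀
    product : ∀ h d → h * d - h - d + 1ℤ ≡ (h - 1ℤ) * (d - 1ℤ)
    product = solve-∀
    collect : ∀ r h k d g x y z → + 2 * y + + 2 * z + (1ℤ + k) - (x + (k + + 2 * g)) ≡
      + 2 * (y - (1ℤ + g)) + (r + + 2 * h - x) + (+ 2 * d + 1ℤ - r + + 2 * (z - h - d + 1ℤ))
    collect = solve-∀


  module Iteration {m n} (p q : Fin m → Fin n) (loopless : ∀ e → p e ≢ q e) (r w₀ d : ℕ)
    (1≤r : 1 ℕ.≤ r) (r≤2d+1 : r ℕ.≤ 2 ℕ.* d ℕ.+ 1) (1≤d : 1 ℕ.≤ d) (1≤w₀ : 1 ℕ.≤ w₀)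
    (regular : ∀ v → card (cut p q (is v)) ≡ + r)
    (odd-cuts : ∀ X → par {n} X ≡ true → + r ≤ card (cut p q X)) where

    w : ℕ → ℤ
    w zero = + w₀
    w (suc k) = w k + + d

    Q : ℕ → ℤ
    Q k = + r * w k - + k

    -- An edge lies in at most k of the chosen matchings, so its weight, `w k` minus its coverage,
    -- is at least 1. The same inequality keeps `Q k` positive.
    w≥k+1 : ∀ k → 1ℤ + + k ≤ w k
    w≥k+1 zero = +≤+ 1≤w₀
    w≥k+1 (suc k) = subst (_≤ w (suc k)) (shift (+ k)) (+-mono-≤ (w≥k+1 k) (+≤+ 1≤d))
      where
      shift : ∀ k → 1ℤ + k + 1ℤ ≡ 1ℤ + (1ℤ + k)
      shift = solve-∀

    0≤w : ∀ k → 0ℤ ≤ w k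
    0≤w k = ≤-trans (+≤+ z≤n) (w≥k+1 k)

    0<Q : ∀ k → 0ℤ < Q k
    0<Q k = <-≤-trans (+<+ (s≤s z≤n)) (≤-by
      (0≤+ (0≤- (w≥k+1 k)) (0≤* (0≤- {1ℤ} {+ r} (+≤+ 1≤r)) (0≤w k))) (expand (w k) (+ k) (+ r)))
      where
      expand : ∀ w k r → r * w - k - 1ℤ ≡ w - (1ℤ + k) + (r - 1ℤ) * w
      expand = solve-∀

    cut-size : (Fin n → Bool) → ℤ
    cut-size X = card (cut p q X)

    -- Choosing all edges in `cut-parity`, where every degree is r, gives |∂X| ≡ r |X| modulo 2.
    cut-size-parity : ∀ X → par {m} (cut p q X) ≡ par {n} X ∧ odd r
    cut-size-parity X = trans (cut-parity {p = p} {q} {const true} {const (odd r)} degree-parity X)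
      (trans (par-cong {n} λ v → Bool.∧-comm (X v) (odd r)) (trans (sym (par-∧ {n} (odd r) X)) (Bool.∧-comm (odd r) (par X))))
      where
      degree-parity : ∀ v → par (cut p q (is v)) ≡ odd r
      degree-parity v with card-par (cut p q (is v))
      ... | k , ck , po = trans po (cong odd (ℤ.+-injective (trans (sym ck) (regular v))))

    Factor : (Fin m → Bool) → Set
    Factor M = ∀ v → (⟦_⟧ ∘ M) · χ p q (is v) ≡ 1ℤ

    -- As g is a natural number, `odd-value` holds two facts at once: t ≥ k and t ≡ k modulo 2. Both
    -- come from each matching meeting an odd cut in an odd number of edges.
    record Family (k : ℕ) (Ms : Fin k → Fin m → Bool) : Set where
      field
        factors   : ∀ i → Factor (Ms i)
        odd-bound : ∀ X → par {n} X ≡ true → coverage k Ms · χ p q X ≤ (cut-size X - + r) * w k + + k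
        odd-value : ∀ X → par {n} X ≡ true → ∃ λ g → coverage k Ms · χ p q X ≡ + k + + 2 * + g

    coverage-∷ : ∀ k (Ms : Fin (suc k) → Fin m → Bool) g →
      coverage (suc k) Ms · g ≡ (⟦_⟧ ∘ Ms zero) · g + coverage k (Ms ∘ suc) · g
    coverage-∷ k Ms g = ·-+ˡ (⟦_⟧ ∘ Ms zero) (coverage k (Ms ∘ suc)) g

    coverage-degree : ∀ k Ms → (∀ i → Factor (Ms i)) → ∀ v → coverage k Ms · χ p q (is v) ≡ + k
    coverage-degree zero Ms _ v = ·-zeroˡ (χ p q (is v))
    coverage-degree (suc k) Ms factors v = trans (coverage-∷ k Ms (χ p q (is v)))
      (cong₂ _+_ (factors zero v) (coverage-degree k (Ms ∘ suc) (factors ∘ suc) v))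

    W : ∀ k → (Fin k → Fin m → Bool) → Fin m → ℤ
    W k Ms e = w k * 1ℤ + - 1ℤ * coverage k Ms e

    W-χ : ∀ k Ms X → W k Ms · χ p q X ≡ w k * cut-size X + - 1ℤ * coverage k Ms · χ p q X
    W-χ k Ms X = trans (·-comb (w k) (- 1ℤ) (λ _ → 1ℤ) (coverage k Ms) (χ p q X))
      (cong (λ x → w k * x + - 1ℤ * coverage k Ms · χ p q X)
        (trans (·-unfold (λ _ → 1ℤ) (χ p q X)) (sum-cong-≗ λ e → *-identityˡ (χ p q X e))))

    module Step {k Ms} (fam : Family k Ms) where

      open Family fam

      fractional : Fractional p q (const true) (W k Ms) (Q k)
      fractional = record
        { nonneg = λ e → ≤-by (0≤+ (0≤- (w≥k+1 k)) (0≤+ (+≤+ z≤n) (0≤- (coverage≤ k Ms e)))) (slack (w k) (+ k) (coverage k Ms e))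
        ; degree = λ v → trans (W-χ k Ms (is v)) (trans (cong₂ (λ x y → w k * x + - 1ℤ * y) (regular v)
            (coverage-degree k Ms factors v)) (simplify (w k) (+ r) (+ k)))
        ; loop = λ e pe≡qe → contradiction pe≡qe (loopless e)
        ; odd-cut = λ X odd → ≤-by (0≤- (odd-bound X (trans (sym (parity-all {n} X)) odd)))
            (trans (cong (_- Q k) (W-χ k Ms X)) (rearrange (w k) (cut-size X) (coverage k Ms · χ p q X) (+ r) (+ k))) }
        where
        slack : ∀ w k a → w * 1ℤ + - 1ℤ * a - 0ℤ ≡ w - (1ℤ + k) + (1ℤ + (k - a))
        slack = solve-∀
        simplify : ∀ w r k → w * r + - 1ℤ * k ≡ (r * w - k) * 1ℤ
        simplify = solve-∀
        rearrange : ∀ w N t r k → w * N + - 1ℤ * t - (r * w - k) ≡ (N - r) * w + k - t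
        rearrange = solve-∀

      uncovered-indicator : Fin m → ℤ
      uncovered-indicator e = ⟦ not (covered k Ms e) ⟧

      opaque
        solution : ∃ λ M → Perfect p q (const true) (W k Ms) M ×
          uncovered-indicator · W k Ms ≤ Q k * uncovered-indicator · (⟦_⟧ ∘ M) ×
          (∀ X → parity X (const true) ≡ true → W k Ms · χ p q X ≡ Q k → (⟦_⟧ ∘ M) · χ p q X ≡ 1ℤ)
        solution = Tightness.tight-perfect fractional (0<Q k) uncovered-indicator
          (λ e → 0≤⟦ not (covered k Ms e) ⟧) (λ e → ⟦ not (covered k Ms e) ⟧≤1)

      M : Fin m → Bool
      M = proj₁ solution

      M-perfect : Perfect p q (const true) (W k Ms) M
      M-perfect = proj₁ (proj₂ solution)

      Ms′ : Fin (suc k) → Fin m → Bool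
      Ms′ zero = M
      Ms′ (suc i) = Ms i

      u u′ : ℤ
      u = card (not ∘ covered k Ms)
      u′ = card (not ∘ covered (suc k) Ms′)

      -- Every uncovered edge still has the full weight `w k`, so the objective has weight w u, and
      -- the number x of newly covered edges satisfies Q x ≥ w u. Substituting x = u - u′ gives the
      -- inequality.
      uncovered-shrinks : Q k * u′ ≤ (Q k - w k) * u
      uncovered-shrinks = ≤-by (0≤- (proj₁ (proj₂ (proj₂ solution))))
        (trans (cong (λ x → (Q k - w k) * x - Q k * u′) u-split)
          (trans (rearrange (Q k) (w k) u′ x) (cong (λ y → Q k * x - y) (sym value))))
        where
        x = uncovered-indicator · (⟦_⟧ ∘ M)
        rearrange : ∀ Q w u x → (Q - w) * (x + u) - Q * u ≡ Q * x - w * (x + u)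
        rearrange = solve-∀
        term : ∀ e → uncovered-indicator e ≡ uncovered-indicator e * ⟦ M e ⟧ + ⟦ not (M e ∨ covered k Ms e) ⟧
        term e with M e | covered k Ms e
        ... | false | false = refl
        ... | false | true = refl
        ... | true | false = refl
        ... | true | true = refl
        u-split : u ≡ x + u′
        u-split = trans (sum-cong-≗ term) (trans (∑-distrib-+ (λ e → uncovered-indicator e * ⟦ M e ⟧) (λ e → ⟦ not (M e ∨ covered k Ms e) ⟧))
          (cong (λ y → y + u′) (sym (·-unfold uncovered-indicator (⟦_⟧ ∘ M)))))
        weight : ∀ e → uncovered-indicator e * W k Ms e ≡ w k * uncovered-indicator e
        weight e with covered k Ms e in ce
        ... | true = trans (*-zeroˡ (W k Ms e)) (sym (*-zeroʳ (w k)))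
        ... | false = trans (cong (λ a → 1ℤ * (w k * 1ℤ + - 1ℤ * a)) (uncovered k Ms e ce)) (simplify (w k))
          where
          simplify : ∀ w → 1ℤ * (w * 1ℤ + - 1ℤ * 0ℤ) ≡ w * 1ℤ
          simplify = solve-∀
        value : uncovered-indicator · W k Ms ≡ w k * (x + u′)
        value = trans (·-unfold uncovered-indicator (W k Ms)) (trans (sum-cong-≗ weight)
          (trans (sym (*-distribˡ-sum (w k) uncovered-indicator)) (cong (w k *_) u-split)))

      all-active : ∀ X → par {n} X ≡ true → parity X (const true) ≡ true
      all-active X odd = trans (parity-all {n} X) odd

      M-odd : ∀ X → par {n} X ≡ true → ∃ λ g → (⟦_⟧ ∘ M) · χ p q X ≡ 1ℤ + + 2 * + g
      M-odd X odd with card-odd (λ e → M e ∧ cut p q X e) 1 M-par (par⇒card≥1 (λ e → M e ∧ cut p q X e) M-par)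
        where
        M-par : parity M (cut p q X) ≡ true
        M-par = trans (matching-parity M-perfect X) (all-active X odd)
      ... | g , eq = g , trans (·-card M (cut p q X)) eq

      M≤cut : ∀ X → (⟦_⟧ ∘ M) · χ p q X ≤ cut-size X
      M≤cut X = ≤-trans (≤-reflexive (·-card M (cut p q X)))
        (card-mono λ e both → proj₂ (∧-true {M e} both))

      -- For an odd X write |∂X| = r + 2h and t = k + 2g.  If the bound is not attained then g < h w,
      -- so t misses it by at least 2 and h ≥ 1; this leaves room for all of ∂X to be in M.
      bound : ∀ X → par {n} X ≡ true →
        (⟦_⟧ ∘ M) · χ p q X + coverage k Ms · χ p q X ≤ (cut-size X - + r) * w (suc k) + + suc k
      bound X X-odd with (coverage k Ms · χ p q X) ≟ᶻ ((cut-size X - + r) * w k + + k)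
      ... | yes attained = attained-room {cut-size X} {+ r} {w k} {k = + k} {+ d} (0≤- (odd-cuts X X-odd)) (+≤+ z≤n) attained
        (proj₂ (proj₂ (proj₂ solution)) X (all-active X X-odd) tight)
        where
        rearrange : ∀ w N r k → w * N + - 1ℤ * ((N - r) * w + k) ≡ r * w - k
        rearrange = solve-∀
        tight : W k Ms · χ p q X ≡ Q k
        tight = trans (W-χ k Ms X) (trans (cong (λ t → w k * cut-size X + - 1ℤ * t) attained)
          (rearrange (w k) (cut-size X) (+ r) (+ k)))
      ... | no slack with card-odd (cut p q X) r (trans (cut-size-parity X) (cong (_∧ odd r) X-odd)) (odd-cuts X X-odd)
                        | odd-value X X-odd
      ...   | h , N≡ | g , t≡ = room {cut-size X} {+ r} {+ h} {w k} {k = + k} {+ d} {+ g} (ℤ.i<j⇒suc[i]≤j g<hw) (+≤+ z≤n) (0≤w k) (+≤+ 1≤d) r≤ N≡ t≡ (M≤cut X)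
        where
        g≤hw : + 2 * + g ≤ + 2 * (+ h * w k)
        g≤hw = miss-even {cut-size X} {+ r} {+ h} {w k} {k = + k} {+ g} N≡ t≡ (odd-bound X X-odd)
        g<hw : + g < + h * w k
        g<hw = ≤∧≢⇒< (*-cancelˡ {c = + 2} (+<+ (s≤s z≤n)) g≤hw) λ g≡hw → slack (attain {cut-size X} {+ r} {+ h} {w k} {k = + k} {+ g} N≡ t≡ g≡hw)
        r≤ : + r ≤ + 2 * + d + 1ℤ
        r≤ = subst (+ r ≤_) (trans (ℤ.pos-+ (2 ℕ.* d) 1) (cong (_+ 1ℤ) (ℤ.pos-* 2 d))) (+≤+ r≤2d+1)

      family : Family (suc k) Ms′
      family = record
        { factors = λ { zero → Perfect.degree M-perfect ; (suc i) → factors i }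
        ; odd-bound = λ X odd → subst (_≤ (cut-size X - + r) * w (suc k) + + suc k)
            (sym (coverage-∷ k Ms′ (χ p q X))) (bound X odd)
        ; odd-value = value }
        where
        value : ∀ X → par {n} X ≡ true → ∃ λ g → coverage (suc k) Ms′ · χ p q X ≡ + suc k + + 2 * + g
        value X odd with M-odd X odd | odd-value X odd
        ... | g , M≡ | g′ , t≡ = g ℕ.+ g′ , trans (coverage-∷ k Ms′ (χ p q X)) (trans (cong₂ _+_ M≡ t≡)
            (regroup (+ k) (+ g) (+ g′)))
          where
          regroup : ∀ k g g′ → 1ℤ + + 2 * g + (k + + 2 * g′) ≡ 1ℤ + k + + 2 * (g + g′)
          regroup = solve-∀

    initial : Family 0 λ ()
    initial = record
      { factors = λ ()
      ; odd-bound = λ X odd → ≤-by (0≤* (0≤- (odd-cuts X odd)) (0≤w 0))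
          (trans (cong (λ t → (cut-size X - + r) * w 0 + 0ℤ - t) (·-zeroˡ (χ p q X))) (simplify ((cut-size X - + r) * w 0)))
      ; odd-value = λ X _ → 0 , ·-zeroˡ (χ p q X) }
      where
      simplify : ∀ x → x + 0ℤ - 0ℤ ≡ x
      simplify = solve-∀

    -- `U` stands for the bound on the number of uncovered edges; leaving it abstract keeps rational
    -- numbers out of the iteration.
    iterate : (U : ℕ → ℤ → Set) → U 0 (+ m) →
      (∀ k u u′ → Q k * u′ ≤ (Q k - w k) * u → U k u → U (suc k) u′) →
      ∀ k → ∃ λ Ms → Family k Ms × U k (card (not ∘ covered k Ms))
    iterate U U₀ Uₛ zero = (λ ()) , initial , subst (U 0) (sym (card-true m)) U₀
      where
      card-true : ∀ m → card {m} (const true) ≡ + m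
      card-true zero = refl
      card-true (suc m) = cong (λ x → 1ℤ + x) (card-true m)
    iterate U U₀ Uₛ (suc k) with iterate U U₀ Uₛ k
    ... | Ms , fam , Uk = Ms′ , family , Uₛ k u u′ uncovered-shrinks Uk
      where open Step fam

  -- Fractions and products of rationals

  ι : ℤ → ℚ
  ι i = i ℚ./ 1

  private
    ι≃ : ∀ i → ℚ.toℚᵘ (ι i) ℚᵘ.≃ ℚᵘ.mkℚᵘ i 0
    ι≃ i = ℚ.toℚᵘ-fromℚᵘ (ℚᵘ.mkℚᵘ i 0)

  ι-* : ∀ i j → ι (i * j) ≡ ι i ℚ.* ι j
  ι-* i j = ℚ.toℚᵘ-injective (ℚᵘ.≃-trans (ι≃ (i * j))
    (ℚᵘ.≃-sym (ℚᵘ.≃-trans (ℚ.toℚᵘ-homo-* (ι i) (ι j)) (ℚᵘ.*-cong (ι≃ i) (ι≃ j)))))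

  ι-+ : ∀ i j → ι (i + j) ≡ ι i ℚ.+ ι j
  ι-+ i j = ℚ.toℚᵘ-injective (ℚᵘ.≃-trans (ι≃ (i + j)) (ℚᵘ.≃-trans (ℚᵘ.*≡* (unit i j))
    (ℚᵘ.≃-sym (ℚᵘ.≃-trans (ℚ.toℚᵘ-homo-+ (ι i) (ι j)) (ℚᵘ.+-cong (ι≃ i) (ι≃ j))))))
    where
    unit : ∀ i j → (i + j) * 1ℤ ≡ (i * 1ℤ + j * 1ℤ) * 1ℤ
    unit = solve-∀

  ι-mono : ∀ {i j} → i ≤ j → ι i ℚ.≤ ι j
  ι-mono {i} {j} i≤j = ℚ.toℚᵘ-cancel-≤ (ℚᵘ.≤-respˡ-≃ (ℚᵘ.≃-sym (ι≃ i)) (ℚᵘ.≤-respʳ-≃ (ℚᵘ.≃-sym (ι≃ j))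
    (ℚᵘ.*≤* (subst₂ _≤_ (sym (*-identityʳ i)) (sym (*-identityʳ j)) i≤j))))

  ι-mono-< : ∀ {i j} → i < j → ι i ℚ.< ι j
  ι-mono-< {i} {j} i<j = ℚ.toℚᵘ-cancel-< (ℚᵘ.<-respˡ-≃ (ℚᵘ.≃-sym (ι≃ i)) (ℚᵘ.<-respʳ-≃ (ℚᵘ.≃-sym (ι≃ j))
    (ℚᵘ.*<* (subst₂ _<_ (sym (*-identityʳ i)) (sym (*-identityʳ j)) i<j))))

  -- A positive `b` keeps `frac` off its default value. Nonnegativity is returned as well, because
  -- `prod-step` multiplies an inequality by the fraction.
  frac-bound : ∀ a b u u′ → 0ℤ < b → 0ℤ ≤ a → b * u′ ≤ a * u →
    0ℚ ℚ.≤ frac a b × ι u′ ℚ.≤ frac a b ℚ.* ι u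
  frac-bound a b u u′ 0<b 0≤a le with (b ℚ./ 1) ℚ.≟ 0ℚ
  ... | yes b≡0 = contradiction (ι-mono-< 0<b) (ℚ.<-irrefl (sym b≡0))
  ... | no b≢0 = 0≤frac , bound
    where
    instance
      nonZero : ℚ.NonZero (ι b)
      nonZero = ℚ.≢-nonZero b≢0
      positive-b : ℚ.Positive (ι b)
      positive-b = ℚ.positive (ι-mono-< 0<b)
    R : ℚ
    R = ℚ.1/ ι b
    instance
      nonNeg-R : ℚ.NonNegative R
      nonNeg-R = ℚ.pos⇒nonNeg R {{ℚ.1/pos⇒pos (ι b)}}
    0≤frac : 0ℚ ℚ.≤ ι a ℚ.* R
    0≤frac = subst (ℚ._≤ ι a ℚ.* R) (ℚ.*-zeroˡ R) (ℚ.*-monoʳ-≤-nonNeg R (ι-mono 0≤a))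
    cancel-b : ι (b * u′) ℚ.* R ≡ ι u′
    cancel-b = begin
      ι (b * u′) ℚ.* R           ≡⟨ cong (ℚ._* R) (trans (ι-* b u′) (ℚ.*-comm (ι b) (ι u′))) ⟩
      ι u′ ℚ.* ι b ℚ.* R         ≡⟨ ℚ.*-assoc (ι u′) (ι b) R ⟩
      ι u′ ℚ.* (ι b ℚ.* R)       ≡⟨ cong (ι u′ ℚ.*_) (ℚ.*-inverseʳ (ι b)) ⟩
      ι u′ ℚ.* 1ℚ                ≡⟨ ℚ.*-identityʳ (ι u′) ⟩
      ι u′ ∎
      where open ≡-Reasoning
    regroup : ι (a * u) ℚ.* R ≡ ι a ℚ.* R ℚ.* ι u
    regroup = begin
      ι (a * u) ℚ.* R            ≡⟨ cong (ℚ._* R) (ι-* a u) ⟩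
      ι a ℚ.* ι u ℚ.* R          ≡⟨ ℚ.*-assoc (ι a) (ι u) R ⟩
      ι a ℚ.* (ι u ℚ.* R)        ≡⟨ cong (ι a ℚ.*_) (ℚ.*-comm (ι u) R) ⟩
      ι a ℚ.* (R ℚ.* ι u)        ≡⟨ sym (ℚ.*-assoc (ι a) R (ι u)) ⟩
      ι a ℚ.* R ℚ.* ι u ∎
      where open ≡-Reasoning
    bound : ι u′ ℚ.≤ ι a ℚ.* R ℚ.* ι u
    bound = subst₂ ℚ._≤_ cancel-b regroup (ℚ.*-monoʳ-≤-nonNeg R (ι-mono le))

  prod-step : ∀ (f : ℕ → ℚ) k m {u u′} → 0ℚ ℚ.≤ f (suc k) → u′ ℚ.≤ f (suc k) ℚ.* u →
    u ℚ.≤ prodFrom1 k f ℚ.* m → u′ ℚ.≤ prodFrom1 (suc k) f ℚ.* m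
  prod-step f k m {u} {u′} 0≤f u′≤ u≤ = ℚ.≤-trans u′≤ (subst (f (suc k) ℚ.* u ℚ.≤_) regroup
    (ℚ.*-monoˡ-≤-nonNeg (f (suc k)) {{ℚ.nonNegative 0≤f}} u≤))
    where
    regroup : f (suc k) ℚ.* (prodFrom1 k f ℚ.* m) ≡ prodFrom1 k f ℚ.* f (suc k) ℚ.* m
    regroup = trans (sym (ℚ.*-assoc (f (suc k)) (prodFrom1 k f) m)) (cong (ℚ._* m) (ℚ.*-comm (f (suc k)) (prodFrom1 k f)))

  complement-bound : ∀ P {m u v : ℤ} → v + u ≡ m → ι u ℚ.≤ P ℚ.* ι m → (1ℚ ℚ.- P) ℚ.* ι m ℚ.≤ ι v
  complement-bound P {m} {u} {v} eq u≤ = subst₂ ℚ._≤_ (sym lhs) rhs (ℚ.+-monoʳ-≤ (ι m) (ℚ.neg-antimono-≤ u≤))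
    where
    open ≡-Reasoning
    lhs : (1ℚ ℚ.- P) ℚ.* ι m ≡ ι m ℚ.- P ℚ.* ι m
    lhs = begin
      (1ℚ ℚ.- P) ℚ.* ι m                    ≡⟨ ℚ.*-distribʳ-+ (ι m) 1ℚ (ℚ.- P) ⟩
      1ℚ ℚ.* ι m ℚ.+ (ℚ.- P) ℚ.* ι m        ≡⟨ cong₂ ℚ._+_ (ℚ.*-identityˡ (ι m)) (sym (ℚ.neg-distribˡ-* P (ι m))) ⟩
      ι m ℚ.- P ℚ.* ι m ∎
    rhs : ι m ℚ.- ι u ≡ ι v
    rhs = begin
      ι m ℚ.- ι u                    ≡⟨ cong (ℚ._- ι u) (trans (cong ι (sym eq)) (ι-+ v u)) ⟩
      ι v ℚ.+ ι u ℚ.- ι u            ≡⟨ ℚ.+-assoc (ι v) (ι u) (ℚ.- ι u) ⟩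
      ι v ℚ.+ (ι u ℚ.- ι u)          ≡⟨ cong (ι v ℚ.+_) (ℚ.+-inverseʳ (ι u)) ⟩
      ι v ℚ.+ 0ℚ                     ≡⟨ ℚ.+-identityʳ (ι v) ⟩
      ι v ∎

  -- Translation to subsets and r-graphs

  size : ∀ {n} (S : Subset n) → + ∣ S ∣ ≡ card (lookup S)
  size [] = refl
  size (false ∷ S) = trans (size S) (sym (+-identityˡ (card (lookup S))))
  size (true ∷ S) = cong (λ x → 1ℤ + x) (size S)

  size-tabulate : ∀ {n} (f : Fin n → Bool) → + ∣ tabulate f ∣ ≡ card f
  size-tabulate f = trans (size (tabulate f)) (sum-cong-≗ λ i → cong ⟦_⟧ (lookup∘tabulate f i))

  size-∩ : ∀ {n} (f g : Fin n → Bool) → + ∣ tabulate f ∩ tabulate g ∣ ≡ (⟦_⟧ ∘ f) · (⟦_⟧ ∘ g)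
  size-∩ f g = trans (size (tabulate f ∩ tabulate g)) (trans (sum-cong-≗ λ i → cong ⟦_⟧
    (trans (lookup-zipWith _∧_ i (tabulate f) (tabulate g)) (cong₂ _∧_ (lookup∘tabulate f i) (lookup∘tabulate g i))))
    (sym (·-card f g)))

  par-size : ∀ {n} (S : Subset n) → par (lookup S) ≡ odd ∣ S ∣
  par-size S with card-par (lookup S)
  ... | k , ck , po = trans po (cong odd (ℤ.+-injective (trans (sym ck) (sym (size S)))))

  lookup-union : ∀ {m} k (Ms : Fin k → Fin m → Bool) e → lookup (unionFin k (tabulate ∘ Ms)) e ≡ covered k Ms e
  lookup-union zero Ms e = lookup-replicate e false
  lookup-union (suc k) Ms e = trans (lookup-zipWith _∨_ e (tabulate (Ms zero)) (unionFin k (tabulate ∘ Ms ∘ suc)))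
    (cong₂ _∨_ (lookup∘tabulate (Ms zero) e) (lookup-union k (Ms ∘ suc) e))

  covered-count : ∀ {m} (c : Fin m → Bool) → card c + card (not ∘ c) ≡ + m
  covered-count {zero} c = refl
  covered-count {suc m} c = trans (exchange ⟦ c zero ⟧ (card (c ∘ suc)) ⟦ not (c zero) ⟧ (card (not ∘ c ∘ suc)))
    (cong₂ _+_ (one (c zero)) (covered-count (c ∘ suc)))
    where
    exchange : ∀ a b c d → a + b + (c + d) ≡ a + c + (b + d)
    exchange = solve-∀
    one : ∀ b → ⟦ b ⟧ + ⟦ not b ⟧ ≡ 1ℤ
    one true = refl
    one false = refl

  odd-mod : ∀ k → (odd k ≡ true × k ℕ.% 2 ≡ 1) ⊎ (odd k ≡ false × k ℕ.% 2 ≡ 0)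
  odd-mod zero = inj₂ (refl , refl)
  odd-mod (suc zero) = inj₁ (refl , refl)
  odd-mod (suc (suc k)) with odd-mod k
  ... | inj₁ (o , e) = inj₁ (trans (Bool.not-involutive (odd k)) o , e)
  ... | inj₂ (o , e) = inj₂ (trans (Bool.not-involutive (odd k)) o , e)

  Even⇒odd≡false : ∀ {k} → k ℕ.% 2 ≡ 0 → odd k ≡ false
  Even⇒odd≡false {k} even with odd-mod k
  ... | inj₁ (_ , e) = contradiction (trans (sym e) even) λ ()
  ... | inj₂ (o , _) = o

  Odd⇒odd≡true : ∀ {k} → k ℕ.% 2 ≡ 1 → odd k ≡ true
  Odd⇒odd≡true {k} isOdd with odd-mod k
  ... | inj₁ (o , _) = o
  ... | inj₂ (_ , e) = contradiction (trans (sym e) isOdd) λ ()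

  odd≡true⇒Odd : ∀ {k} → odd k ≡ true → k ℕ.% 2 ≡ 1
  odd≡true⇒Odd {k} o with odd-mod k
  ... | inj₁ (_ , e) = e
  ... | inj₂ (o′ , _) = ⊥-elim (true≢false o o′)

  module RGraph (r : ℕ) (3≤r : 3 ℕ.≤ r) (G : Graph) (r-graph : IsRGraph r G) where

    m n : ℕ
    m = Defs.m G
    n = Defs.n G

    p q : Fin m → Fin n
    p = proj₁ ∘ Defs.ends G
    q = proj₂ ∘ Defs.ends G

    -- `∨` and `xor` disagree only on an edge with both ends at `v`, that is, on a loop.
    incident-cut : ∀ v → incident G v ≡ tabulate (cut p q (is v))
    incident-cut v = tabulate-cong term
      where
      term : ∀ e → ⌊ p e ≟ᶠ v ⌋ ∨ ⌊ q e ≟ᶠ v ⌋ ≡ cut p q (is v) e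
      term e with p e ≟ᶠ v | q e ≟ᶠ v | v ≟ᶠ p e | v ≟ᶠ q e
      ... | yes pe≡v | yes qe≡v | _ | _ = contradiction (trans pe≡v (sym qe≡v)) (Defs.loopless G e)
      ... | yes _ | no _ | yes _ | no _ = refl
      ... | no _ | yes _ | no _ | yes _ = refl
      ... | no _ | no _ | no _ | no _ = refl
      ... | yes pe≡v | _ | no v≢pe | _ = contradiction (sym pe≡v) v≢pe
      ... | no pe≢v | _ | yes v≡pe | _ = contradiction (sym v≡pe) pe≢v
      ... | _ | yes qe≡v | _ | no v≢qe = contradiction (sym qe≡v) v≢qe
      ... | _ | no qe≢v | _ | yes v≡qe = contradiction (sym v≡qe) qe≢v

    regular : ∀ v → card (cut p q (is v)) ≡ + r
    regular v = trans (sym (size-tabulate (cut p q (is v)))) (cong +_ (trans (cong ∣_∣ (sym (incident-cut v))) (proj₁ r-graph v)))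

    odd-cuts : ∀ X → par {n} X ≡ true → + r ≤ card (cut p q X)
    odd-cuts X X-odd = subst (+ r ≤_) (trans (size-tabulate (cut p q (lookup S)))
        (sum-cong-≗ (χ-cong {p = p} {q} (lookup∘tabulate X))))
      (+≤+ (proj₂ r-graph S (odd≡true⇒Odd {∣ S ∣} (trans (sym (par-size S)) (trans (par-cong {n} (lookup∘tabulate X)) X-odd)))))
      where
      S : Subset n
      S = tabulate X

    module Families (w₀ d : ℕ) (r≤2d+1 : r ℕ.≤ 2 ℕ.* d ℕ.+ 1) (1≤d : 1 ℕ.≤ d) (1≤w₀ : 1 ℕ.≤ w₀) where

      open Iteration p q (Defs.loopless G) r w₀ d (ℕ.≤-trans (s≤s z≤n) 3≤r) r≤2d+1 1≤d 1≤w₀ regular odd-cuts public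

      w-closed : ∀ k → w k ≡ + w₀ + + k * + d
      w-closed zero = sym (trans (cong (λ x → + w₀ + x) (*-zeroˡ (+ d))) (+-identityʳ (+ w₀)))
      w-closed (suc k) = trans (cong (_+ + d) (w-closed k)) (shift (+ w₀) (+ k) (+ d))
        where
        shift : ∀ w k d → w + k * d + d ≡ w + (1ℤ + k) * d
        shift = solve-∀

      w≤Q : ∀ k → 0ℤ ≤ Q k - w k
      w≤Q k = subst (0ℤ ≤_) (shape (+ r) (w k) (+ k))
        (0≤+ (0≤* (0≤- {+ 2} {+ r} (+≤+ (ℕ.≤-trans (s≤s (s≤s z≤n)) 3≤r))) (0≤w k)) (0≤+ {1ℤ} (+≤+ z≤n) (0≤- (w≥k+1 k))))
        where
        shape : ∀ r w k → (r - + 2) * w + (1ℤ + (w - (1ℤ + k))) ≡ r * w - k - w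
        shape = solve-∀

      ∂-parity : ∀ S → odd ∣ ∂ G S ∣ ≡ odd ∣ S ∣ ∧ odd r
      ∂-parity S = trans (sym (par-size (∂ G S))) (trans (par-cong {m} (lookup∘tabulate (cut p q (lookup S))))
        (trans (cut-size-parity (lookup S)) (cong (_∧ odd r) (par-size S))))

      intersections : ∀ k (Ms : Fin k → Fin m → Bool) S →
        + sumFin k (λ i → ∣ tabulate (Ms i) ∩ ∂ G S ∣) ≡ coverage k Ms · χ p q (lookup S)
      intersections zero Ms S = sym (·-zeroˡ (χ p q (lookup S)))
      intersections (suc k) Ms S = trans (cong₂ _+_ (size-∩ (Ms zero) (cut p q (lookup S))) (intersections k (Ms ∘ suc) S))
        (sym (coverage-∷ k Ms (χ p q (lookup S))))

      one-factor : ∀ M → Factor M → IsOneFactor G (tabulate M)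
      one-factor M factor v = trans (cong (λ I → ∣ tabulate M ∩ I ∣) (incident-cut v))
        (ℤ.+-injective (trans (size-∩ M (cut p q (is v))) (factor v)))

      OddCuts : ∀ k → (Fin k → ESet G) → Set
      OddCuts k Ms = ∀ S → odd ∣ S ∣ ≡ true →
        (∃ λ g → + sumFin k (λ i → ∣ Ms i ∩ ∂ G S ∣) ≡ + k + + 2 * + g) ×
        + sumFin k (λ i → ∣ Ms i ∩ ∂ G S ∣) ≤ (+ ∣ ∂ G S ∣ - + r) * w k + + k

      odd-cut-bounds : ∀ k Ms → Family k Ms → OddCuts k (tabulate ∘ Ms)
      odd-cut-bounds k Ms family S S-odd =
        (proj₁ value , trans (intersections k Ms S) (proj₂ value)) ,
        subst₂ _≤_ (sym (intersections k Ms S))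
          (cong (λ N → (N - + r) * w k + + k) (sym (size-tabulate (cut p q (lookup S)))))
          (Family.odd-bound family (lookup S) X-odd)
        where
        X-odd : par (lookup S) ≡ true
        X-odd = trans (par-size S) S-odd
        value = Family.odd-value family (lookup S) X-odd

      -- Factor number k + 1 of the product is the ratio (Q k - w k) / Q k of step k. The scalar `c`
      -- expands this fraction to the stated polynomials: 1 for even r, and 2 for odd r, where it
      -- clears the half in d = (r - 1) / 2.
      module Ratio (num den : ℕ → ℤ) (c : ℤ) (0<c : 0ℤ < c) (num≡ : ∀ k → num (suc k) ≡ c * (Q k - w k))
        (den≡ : ∀ k → den (suc k) ≡ c * Q k) where

        f : ℕ → ℚ
        f i = frac (num i) (den i)

        U : ℕ → ℤ → Set
        U k u = ι u ℚ.≤ prodFrom1 k f ℚ.* ι (+ m)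

        ratio : ∀ k u u′ → Q k * u′ ≤ (Q k - w k) * u → 0ℚ ℚ.≤ f (suc k) × ι u′ ℚ.≤ f (suc k) ℚ.* ι u
        ratio k u u′ le = frac-bound (num (suc k)) (den (suc k)) u u′
          (subst (0ℤ <_) (sym (den≡ k)) (0<* 0<c (0<Q k)))
          (subst (0ℤ ≤_) (sym (num≡ k)) (0≤* (<⇒≤ 0<c) (w≤Q k)))
          (subst₂ (λ a b → b * u′ ≤ a * u) (sym (num≡ k)) (sym (den≡ k))
            (subst₂ _≤_ (sym (*-assoc c (Q k) u′)) (sym (*-assoc c (Q k - w k) u)) (*-monoˡ (<⇒≤ 0<c) le)))

        U-step : ∀ k u u′ → Q k * u′ ≤ (Q k - w k) * u → U k u → U (suc k) u′
        U-step k u u′ le = prod-step f k (ι (+ m)) {ι u} {ι u′} (proj₁ (ratio k u u′ le)) (proj₂ (ratio k u u′ le))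

        U₀ : U 0 (+ m)
        U₀ = ℚ.≤-reflexive (sym (ℚ.*-identityˡ (ι (+ m))))

        union-count : ∀ k (Ms : Fin k → Fin m → Bool) →
          + ∣ unionFin k (tabulate ∘ Ms) ∣ + card (not ∘ covered k Ms) ≡ + m
        union-count k Ms = trans (cong (λ x → x + card (not ∘ covered k Ms))
            (trans (size (unionFin k (tabulate ∘ Ms))) (sum-cong-≗ λ e → cong ⟦_⟧ (lookup-union k Ms e))))
          (covered-count (covered k Ms))

        Result : ∀ k → (Fin k → ESet G) → Set
        Result k Ms = (∀ i → IsOneFactor G (Ms i)) ×
          (1ℚ ℚ.- prodFrom1 k f) ℚ.* ℕtoℚ m ℚ.≤ ℕtoℚ ∣ unionFin k Ms ∣ × OddCuts k Ms

        union-bound : ∀ k (Ms : Fin k → Fin m → Bool) → U k (card (not ∘ covered k Ms)) →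
          (1ℚ ℚ.- prodFrom1 k f) ℚ.* ℕtoℚ m ℚ.≤ ℕtoℚ ∣ unionFin k (tabulate ∘ Ms) ∣
        union-bound k Ms = complement-bound (prodFrom1 k f) {+ m} {card (not ∘ covered k Ms)}
          {+ ∣ unionFin k (tabulate ∘ Ms) ∣} (union-count k Ms)

        result : ∀ k Ms → Family k Ms → U k (card (not ∘ covered k Ms)) → Result k (tabulate ∘ Ms)
        result k Ms family Uk = (λ i → one-factor (Ms i) (Family.factors family i)) ,
          union-bound k Ms Uk , odd-cut-bounds k Ms family

        as-result : ∀ k → (∃ λ Ms → Family k Ms × U k (card (not ∘ covered k Ms))) → ∃ (Result k)
        as-result k (Ms , family , Uk) = tabulate ∘ Ms , result k Ms family Uk

        opaque
          iterated : ∀ k → ∃ λ Ms → Family k Ms × U k (card (not ∘ covered k Ms))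
          iterated k = iterate U U₀ U-step k

          families : ∀ k → ∃ (Result k)
          families k = as-result k (iterated k)

  -- The constants and cut conditions for even and odd r

  numₐ denₐ numᵦ denᵦ : ℕ → ℕ → ℤ
  numₐ r i = (+ (r ℕ.* r) - + (3 ℕ.* r) + + 1) * + i - (+ (r ℕ.* r) - + (5 ℕ.* r) + + 3)
  denₐ r i = (+ (r ℕ.* r) - + (2 ℕ.* r) - + 1) * + i - (+ (r ℕ.* r) - + (4 ℕ.* r) - + 1)
  numᵦ r i = (+ (r ℕ.* r) - + (2 ℕ.* r) - + 1) * + i - (+ (r ℕ.* r) - + (4 ℕ.* r) + + 1)
  denᵦ r i = (+ (r ℕ.* r) - + r - + 2) * + i - (+ (r ℕ.* r) - + (3 ℕ.* r) - + 2)

  module EvenCase (d : ℕ) (1≤d : 1 ℕ.≤ d) (3≤r : 3 ℕ.≤ 2 ℕ.+ d) (G : Graph) (r-graph : IsRGraph (2 ℕ.+ d) G)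
    (even : odd (2 ℕ.+ d) ≡ false) where

    r : ℕ
    r = 2 ℕ.+ d

    r≤2d+1 : r ℕ.≤ 2 ℕ.* d ℕ.+ 1
    r≤2d+1 = subst₂ ℕ._≤_ (shape₁ d) (shape₂ d) (ℕ.+-monoʳ-≤ (d ℕ.+ 1) 1≤d)
      where
      shape₁ : ∀ d → d ℕ.+ 1 ℕ.+ 1 ≡ 2 ℕ.+ d
      shape₁ = ℕ.solve-∀
      shape₂ : ∀ d → d ℕ.+ 1 ℕ.+ d ≡ 2 ℕ.* d ℕ.+ 1
      shape₂ = ℕ.solve-∀

    open RGraph r 3≤r G r-graph
    open Families 2 d r≤2d+1 1≤d (s≤s z≤n)

    num≡ : ∀ k → numₐ r (suc k) ≡ 1ℤ * (Q k - w k)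
    num≡ k = begin
      (+ (r ℕ.* r) - + (3 ℕ.* r) + + 1) * + suc k - (+ (r ℕ.* r) - + (5 ℕ.* r) + + 3)
        ≡⟨ cong₂ (λ a bc → (a - proj₁ bc + + 1) * + suc k - (a - proj₂ bc + + 3)) (ℤ.pos-* r r) (cong₂ _,_ (ℤ.pos-* 3 r) (ℤ.pos-* 5 r)) ⟩
      (+ r * + r - + 3 * + r + + 1) * + suc k - (+ r * + r - + 5 * + r + + 3)
        ≡⟨ shape (+ d) (+ k) ⟩
      1ℤ * (+ r * (+ 2 + + k * + d) - + k - (+ 2 + + k * + d))
        ≡⟨ cong (λ x → 1ℤ * (+ r * x - + k - x)) (sym (w-closed k)) ⟩
      1ℤ * (Q k - w k) ∎
      where
      open ≡-Reasoning
      shape : ∀ d k → let r = + 2 + d in (r * r - + 3 * r + + 1) * (1ℤ + k) - (r * r - + 5 * r + + 3) ≡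
        1ℤ * (r * (+ 2 + k * d) - k - (+ 2 + k * d))
      shape = solve-∀

    den≡ : ∀ k → denₐ r (suc k) ≡ 1ℤ * Q k
    den≡ k = begin
      (+ (r ℕ.* r) - + (2 ℕ.* r) - + 1) * + suc k - (+ (r ℕ.* r) - + (4 ℕ.* r) - + 1)
        ≡⟨ cong₂ (λ a bc → (a - proj₁ bc - + 1) * + suc k - (a - proj₂ bc - + 1)) (ℤ.pos-* r r) (cong₂ _,_ (ℤ.pos-* 2 r) (ℤ.pos-* 4 r)) ⟩
      (+ r * + r - + 2 * + r - + 1) * + suc k - (+ r * + r - + 4 * + r - + 1)
        ≡⟨ shape (+ d) (+ k) ⟩
      1ℤ * (+ r * (+ 2 + + k * + d) - + k)
        ≡⟨ cong (λ x → 1ℤ * (+ r * x - + k)) (sym (w-closed k)) ⟩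
      1ℤ * Q k ∎
      where
      open ≡-Reasoning
      shape : ∀ d k → let r = + 2 + d in (r * r - + 2 * r - + 1) * (1ℤ + k) - (r * r - + 4 * r - + 1) ≡
        1ℤ * (r * (+ 2 + k * d) - k)
      shape = solve-∀

    open Ratio (numₐ r) (denₐ r) 1ℤ (+<+ (s≤s z≤n)) num≡ den≡ public

    -- For even r every edge cut is even, because |∂S| ≡ r |S| modulo 2.
    no-odd-cut : ∀ S → ∣ ∂ G S ∣ ≢ r ℕ.+ 1
    no-odd-cut S size≡ = true≢false
      (trans (cong odd size≡) (trans (cong odd (ℕ.+-comm r 1)) (cong not even)))
      (trans (∂-parity S) (trans (cong (odd ∣ S ∣ ∧_) even) (Bool.∧-zeroʳ (odd ∣ S ∣))))

    Conclusion : ∀ k → (Fin k → ESet G) → Set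
    Conclusion k Ms = (∀ i → IsOneFactor G (Ms i)) ×
      (1ℚ ℚ.- prodFrom1 k f) ℚ.* ℕtoℚ (Defs.m G) ℚ.≤ ℕtoℚ ∣ unionFin k Ms ∣ × (∀ S → ∣ ∂ G S ∣ ≢ r ℕ.+ 1)

    conclude : ∀ k → ∃ (Result k) → ∃ (Conclusion k)
    conclude k (Ms , factors , bound , _) = Ms , factors , bound , no-odd-cut

    opaque
      conclusion : ∀ k → ∃ (Conclusion k)
      conclusion k = conclude k (families k)

  module OddCase (d : ℕ) (1≤d : 1 ℕ.≤ d) (3≤r : 3 ℕ.≤ 1 ℕ.+ 2 ℕ.* d) (G : Graph) (r-graph : IsRGraph (1 ℕ.+ 2 ℕ.* d) G)
    (is-odd : odd (1 ℕ.+ 2 ℕ.* d) ≡ true) where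

    r : ℕ
    r = 1 ℕ.+ 2 ℕ.* d

    open RGraph r 3≤r G r-graph
    open Families 1 d (ℕ.≤-reflexive (ℕ.+-comm 1 (2 ℕ.* d))) 1≤d (s≤s z≤n)

    r≡ : + r ≡ 1ℤ + + 2 * + d
    r≡ = cong (λ x → 1ℤ + x) (ℤ.pos-* 2 d)

    num≡ : ∀ k → numᵦ r (suc k) ≡ + 2 * (Q k - w k)
    num≡ k = begin
      (+ (r ℕ.* r) - + (2 ℕ.* r) - + 1) * + suc k - (+ (r ℕ.* r) - + (4 ℕ.* r) + + 1)
        ≡⟨ cong₂ (λ a bc → (a - proj₁ bc - + 1) * + suc k - (a - proj₂ bc + + 1)) (ℤ.pos-* r r) (cong₂ _,_ (ℤ.pos-* 2 r) (ℤ.pos-* 4 r)) ⟩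
      (+ r * + r - + 2 * + r - + 1) * + suc k - (+ r * + r - + 4 * + r + + 1)
        ≡⟨ shape (+ r) (+ d) (+ k) r≡ ⟩
      + 2 * (+ r * (1ℤ + + k * + d) - + k - (1ℤ + + k * + d))
        ≡⟨ cong (λ x → + 2 * (+ r * x - + k - x)) (sym (w-closed k)) ⟩
      + 2 * (Q k - w k) ∎
      where
      open ≡-Reasoning
      identity : ∀ d k → let r = 1ℤ + + 2 * d in (r * r - + 2 * r - + 1) * (1ℤ + k) - (r * r - + 4 * r + + 1) ≡
        + 2 * (r * (1ℤ + k * d) - k - (1ℤ + k * d))
      identity = solve-∀
      shape : ∀ r d k → r ≡ 1ℤ + + 2 * d → (r * r - + 2 * r - + 1) * (1ℤ + k) - (r * r - + 4 * r + + 1) ≡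
        + 2 * (r * (1ℤ + k * d) - k - (1ℤ + k * d))
      shape r d k refl = identity d k

    den≡ : ∀ k → denᵦ r (suc k) ≡ + 2 * Q k
    den≡ k = begin
      (+ (r ℕ.* r) - + r - + 2) * + suc k - (+ (r ℕ.* r) - + (3 ℕ.* r) - + 2)
        ≡⟨ cong₂ (λ a b → (a - + r - + 2) * + suc k - (a - b - + 2)) (ℤ.pos-* r r) (ℤ.pos-* 3 r) ⟩
      (+ r * + r - + r - + 2) * + suc k - (+ r * + r - + 3 * + r - + 2)
        ≡⟨ shape (+ r) (+ d) (+ k) r≡ ⟩
      + 2 * (+ r * (1ℤ + + k * + d) - + k)
        ≡⟨ cong (λ x → + 2 * (+ r * x - + k)) (sym (w-closed k)) ⟩
      + 2 * Q k ∎
      where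
      open ≡-Reasoning
      identity : ∀ d k → let r = 1ℤ + + 2 * d in (r * r - r - + 2) * (1ℤ + k) - (r * r - + 3 * r - + 2) ≡
        + 2 * (r * (1ℤ + k * d) - k)
      identity = solve-∀
      shape : ∀ r d k → r ≡ 1ℤ + + 2 * d → (r * r - r - + 2) * (1ℤ + k) - (r * r - + 3 * r - + 2) ≡
        + 2 * (r * (1ℤ + k * d) - k)
      shape r d k refl = identity d k

    open Ratio (numᵦ r) (denᵦ r) (+ 2) (+<+ (s≤s z≤n)) num≡ den≡ public

    -- From |∂S| ≡ r |S| modulo 2: the cuts of odd size r and r + 2 have odd sides, so the invariant
    -- applies to them.
    side-odd : ∀ S → odd ∣ ∂ G S ∣ ≡ true → odd ∣ S ∣ ≡ true
    side-odd S ∂-odd = proj₁ (∧-true {odd ∣ S ∣} (trans (sym (∂-parity S)) ∂-odd))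

    -- At |∂S| = r the invariant leaves t ≤ k, and t = k + 2g supplies the reverse inequality.
    minimum-cut : ∀ k Ms → OddCuts k Ms → ∀ S → ∣ ∂ G S ∣ ≡ r → sumFin k (λ i → ∣ Ms i ∩ ∂ G S ∣) ≡ k
    minimum-cut k Ms cuts S size≡ with cuts S (side-odd S (trans (cong odd size≡) is-odd))
    ... | (g , t≡) , t≤ = ℤ.+-injective (≤-antisym
        (≤-trans t≤ (≤-reflexive (trans (cong (λ N → (+ N - + r) * w k + + k) size≡) (vanish (+ r) (w k) (+ k)))))
        (≤-by (0≤* {+ 2} {+ g} (+≤+ z≤n) (+≤+ z≤n)) (trans (cong (_- + k) t≡) (cancel (+ k) (+ 2 * + g)))))
      where
      vanish : ∀ r w k → (r - r) * w + k ≡ k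
      vanish = solve-∀
      cancel : ∀ k x → k + x - k ≡ x
      cancel = solve-∀

    -- At |∂S| = r + 2 the invariant gives t ≤ 2 w k + k, where w k = 1 + k d and 2d = r - 1; the
    -- final 2 is twice the initial weight.
    next-cut : ∀ k Ms → OddCuts k Ms → ∀ S → ∣ ∂ G S ∣ ≡ r ℕ.+ 2 →
      sumFin k (λ i → ∣ Ms i ∩ ∂ G S ∣) ℕ.≤ r ℕ.* k ℕ.+ 2
    next-cut k Ms cuts S size≡ = ℤ.drop‿+≤+ (≤-trans
      (proj₂ (cuts S (side-odd S (trans (cong odd (trans size≡ (ℕ.+-comm r 2))) (trans (Bool.not-involutive (odd r)) is-odd)))))
      (≤-reflexive (begin
        (+ ∣ ∂ G S ∣ - + r) * w k + + k                ≡⟨ cong₂ (λ N x → (+ N - + r) * x + + k) size≡ (w-closed k) ⟩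
        (+ (r ℕ.+ 2) - + r) * (1ℤ + + k * + d) + + k   ≡⟨ cong (λ N → (N - + r) * (1ℤ + + k * + d) + + k) (ℤ.pos-+ r 2) ⟩
        (+ r + + 2 - + r) * (1ℤ + + k * + d) + + k     ≡⟨ shape (+ r) (+ d) (+ k) r≡ ⟩
        + r * + k + + 2                                ≡⟨ cong (λ x → x + + 2) (sym (ℤ.pos-* r k)) ⟩
        + (r ℕ.* k) + + 2                              ≡⟨ sym (ℤ.pos-+ (r ℕ.* k) 2) ⟩
        + (r ℕ.* k ℕ.+ 2) ∎)))
      where
      open ≡-Reasoning
      identity : ∀ d k → let r = 1ℤ + + 2 * d in (r + + 2 - r) * (1ℤ + k * d) + k ≡ r * k + + 2
      identity = solve-∀
      shape : ∀ r d k → r ≡ 1ℤ + + 2 * d → (r + + 2 - r) * (1ℤ + k * d) + k ≡ r * k + + 2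
      shape r d k refl = identity d k

    Conclusion : ∀ k → (Fin k → ESet G) → Set
    Conclusion k Ms = (∀ i → IsOneFactor G (Ms i)) ×
      (1ℚ ℚ.- prodFrom1 k f) ℚ.* ℕtoℚ (Defs.m G) ℚ.≤ ℕtoℚ ∣ unionFin k Ms ∣ ×
      (∀ S → ∣ ∂ G S ∣ ≡ r → sumFin k (λ i → ∣ Ms i ∩ ∂ G S ∣) ≡ k) ×
      (∀ S → ∣ ∂ G S ∣ ≡ r ℕ.+ 2 → sumFin k (λ i → ∣ Ms i ∩ ∂ G S ∣) ℕ.≤ r ℕ.* k ℕ.+ 2)

    conclude : ∀ k → ∃ (Result k) → ∃ (Conclusion k)
    conclude k (Ms , factors , bound , cuts) = Ms , factors , bound , minimum-cut k Ms cuts , next-cut k Ms cuts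

    opaque
      conclusion : ∀ k → ∃ (Conclusion k)
      conclusion k = conclude k (families k)

  even-part : ∀ r → 3 ℕ.≤ r → ∀ G → IsRGraph r G → odd r ≡ false → ∀ k → Σ (Fin k → ESet G) λ Ms →
    (∀ i → IsOneFactor G (Ms i)) ×
    (1ℚ ℚ.- prodFrom1 k (λ i → frac (numₐ r i) (denₐ r i))) ℚ.* ℕtoℚ (Defs.m G) ℚ.≤ ℕtoℚ ∣ unionFin k Ms ∣ ×
    (∀ S → ∣ ∂ G S ∣ ≢ r ℕ.+ 1)
  even-part (suc (suc zero)) (s≤s (s≤s ()))
  even-part (suc (suc (suc s))) 3≤r G r-graph even k = EvenCase.conclusion (suc s) (s≤s z≤n) 3≤r G r-graph even k

  odd-part : ∀ r → 3 ℕ.≤ r → ∀ G → IsRGraph r G → odd r ≡ true → ∀ k → Σ (Fin k → ESet G) λ Ms →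
    (∀ i → IsOneFactor G (Ms i)) ×
    (1ℚ ℚ.- prodFrom1 k (λ i → frac (numᵦ r i) (denᵦ r i))) ℚ.* ℕtoℚ (Defs.m G) ℚ.≤ ℕtoℚ ∣ unionFin k Ms ∣ ×
    (∀ S → ∣ ∂ G S ∣ ≡ r → sumFin k (λ i → ∣ Ms i ∩ ∂ G S ∣) ≡ k) ×
    (∀ S → ∣ ∂ G S ∣ ≡ r ℕ.+ 2 → sumFin k (λ i → ∣ Ms i ∩ ∂ G S ∣) ℕ.≤ r ℕ.* k ℕ.+ 2)
  odd-part r 3≤r G r-graph is-odd with same-parity r 1 is-odd (ℕ.≤-trans (s≤s z≤n) 3≤r)
  ... | zero , r≡1 = contradiction (subst (3 ℕ.≤_) r≡1 3≤r) λ { (s≤s ()) }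
  ... | suc d , refl = OddCase.conclusion (suc d) (s≤s z≤n) 3≤r G r-graph is-odd

open import Defs
open import Data.Nat using (ℕ; _≤_; _+_; _*_; _∸_)
open import Data.Integer as ℤ using (+_)
open import Data.Rational as ℚ using (1ℚ)
open import Data.Fin using (Fin)
open import Data.Fin.Subset using (∣_∣; _∩_)
open import Data.Product using (_×_; Σ; _,_)
open import Relation.Binary.PropositionalEquality using (_≡_)
open import Relation.Nullary using (contradiction)

theorem3p3 : (r : ℕ) → 3 ≤ r → (G : Graph) → IsRGraph r G →
    ((Even r → 4 ≤ r → (k : ℕ) → 1 ≤ k →
    Σ (Fin k → ESet G) λ Ms →
    (∀ i → IsOneFactor G (Ms i)) ×
    ((1ℚ ℚ.- prodFrom1 k (λ i →
    frac ((+ (r * r) ℤ.- + (3 * r) ℤ.+ + 1) ℤ.* + i ℤ.- (+ (r * r) ℤ.- + (5 * r) ℤ.+ + 3))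
    ((+ (r * r) ℤ.- + (2 * r) ℤ.- + 1) ℤ.* + i ℤ.- (+ (r * r) ℤ.- + (4 * r) ℤ.- + 1))))
    ℚ.* ℕtoℚ (m G) ℚ.≤ ℕtoℚ ∣ unionFin k Ms ∣) ×
    (∀ (S : VSet G) → ∣ ∂ G S ∣ ≡ r + 1 →
    sumFin k (λ i → ∣ Ms i ∩ ∂ G S ∣) ≤ (r ∸ 1) * k + 2)))
    × ((Odd r → (k : ℕ) → 1 ≤ k →
    Σ (Fin k → ESet G) λ Ms →
    (∀ i → IsOneFactor G (Ms i)) ×
    ((1ℚ ℚ.- prodFrom1 k (λ i →
    frac ((+ (r * r) ℤ.- + (2 * r) ℤ.- + 1) ℤ.* + i ℤ.- (+ (r * r) ℤ.- + (4 * r) ℤ.+ + 1))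
    ((+ (r * r) ℤ.- + r ℤ.- + 2) ℤ.* + i ℤ.- (+ (r * r) ℤ.- + (3 * r) ℤ.- + 2))))
    ℚ.* ℕtoℚ (m G) ℚ.≤ ℕtoℚ ∣ unionFin k Ms ∣) ×
    (∀ (S : VSet G) → ∣ ∂ G S ∣ ≡ r → sumFin k (λ i → ∣ Ms i ∩ ∂ G S ∣) ≡ k) ×
    (∀ (S : VSet G) → ∣ ∂ G S ∣ ≡ r + 2 →
    sumFin k (λ i → ∣ Ms i ∩ ∂ G S ∣) ≤ r * k + 2)))
theorem3p3 r 3≤r G r-graph =
  (λ even _ k _ → let (Ms , factors , bound , no-cut) = P.even-part r 3≤r G r-graph (P.Even⇒odd≡false {r} even) k in
    Ms , factors , bound , λ S size≡ → contradiction size≡ (no-cut S)) ,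
  λ is-odd k _ → P.odd-part r 3≤r G r-graph (P.Odd⇒odd≡true {r} is-odd) k
  where module P = MatchingPolytope
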